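{- The satisfiability problem for $\mathcal{N}^2$ (deciding whether a given finite set of $\mathcal{N}^2$-formulas has a model), with numerical quantifier subscripts coded in binary, is NEXPTIME-hard.
   Context: We work in first-order logic extended with counting quantifiers $\exists_{\leq C}$, $\exists_{\geq C}$ ($C \geq 0$) with the obvious semantics. $\mathcal{N}^2$ consists of all formulas of the forms $\exists_{\bowtie C} x (p(x) \wedge q(x))$ and $\exists_{\bowtie C} x (p(x) \wedge \neg q(x))$, together with all formulas of the form $\exists_{\bowtie C} x (p(x) \wedge \exists_{\bowtie' D} y (q(y) \wedge r(x,y)))$, where $\bowtie, \bowtie' \in \{\leq, \geq\}$, $C, D \geq 0$ are integers, $p, q$ are unary predicates and $r$ is a binary predicate. Under binary coding a subscript $C$ contributes size $\lfloor \log_2 C \rfloor + 1$ to the input size. -}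

module Defs where

open import Data.Nat using (ℕ; zero; suc; _+_; _*_; _^_; _≤_)
open import Data.Nat.Binary.Base using (ℕᵇ; 2[1+_]; 1+[2_]) renaming (zero to zeroᵇ; fromℕ to toℕᵇ)
open import Data.Bool using (Bool; true; false)
open import Data.List using (List; []; _∷_; _++_; concatMap; length; map)
open import Data.List.Relation.Unary.All using (All)
open import Data.List.Membership.Propositional using (_∈_)
open import Data.Fin using (Fin) renaming (zero to fz; suc to fs)
open import Data.Maybe using (Maybe; just; nothing)
open import Data.Product using (Σ; ∃; _×_; _,_)
open import Relation.Binary.PropositionalEquality using (_≡_)
open import Relation.Nullary using (¬_)
open import Function.Bundles using (_⇔_)
open import Function.Definitions using (Injective)

-- Syntax of N²
-- Unary predicates and binary predicates are named by natural numbers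
-- (two separate name spaces).

data Cmp : Set where
  atMost atLeast : Cmp

data N2 : Set where
  -- ∃_{⋈ C} x (p(x) ∧ q(x))
  cntPos  : (⋈ : Cmp) (C : ℕ) (p q : ℕ) → N2
  -- ∃_{⋈ C} x (p(x) ∧ ¬ q(x))
  cntNeg  : (⋈ : Cmp) (C : ℕ) (p q : ℕ) → N2
  -- ∃_{⋈ C} x (p(x) ∧ ∃_{⋈' D} y (q(y) ∧ r(x,y)))
  cntNest : (⋈ : Cmp) (C : ℕ) (p : ℕ) (⋈' : Cmp) (D : ℕ) (q r : ℕ) → N2

-- Semantics (arbitrary, possibly infinite, non-empty domains)

record Structure : Set₁ where
  field
    Dom   : Set
    point : Dom                       -- domains are non-empty
    U     : ℕ → Dom → Set
    B     : ℕ → Dom → Dom → Set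

AtLeast : {D : Set} → ℕ → (D → Set) → Set
AtLeast {D} C P = Σ (Fin C → D) λ f → Injective _≡_ _≡_ f × (∀ i → P (f i))

AtMost : {D : Set} → ℕ → (D → Set) → Set
AtMost C P = ¬ AtLeast (suc C) P

Count : {D : Set} → Cmp → ℕ → (D → Set) → Set
Count atMost  C P = AtMost  C P
Count atLeast C P = AtLeast C P

_⊨_ : Structure → N2 → Set
𝔄 ⊨ cntPos ⋈ C p q = Count ⋈ C (λ x → U p x × U q x)
  where open Structure 𝔄
𝔄 ⊨ cntNeg ⋈ C p q = Count ⋈ C (λ x → U p x × ¬ U q x)
  where open Structure 𝔄
𝔄 ⊨ cntNest ⋈ C p ⋈' D q r =
  Count ⋈ C (λ x → U p x × Count ⋈' D (λ y → U q y × B r x y))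
  where open Structure 𝔄

Satisfiable : List N2 → Set₁
Satisfiable Γ = Σ Structure λ 𝔄 → All (𝔄 ⊨_) Γ

-- Binary coding of formula sets.
-- Numbers are written in binary (bijective base 2 via ℕᵇ), each digit d
-- as the pair [true , d], and each number is terminated by [false , false];
-- so the number C contributes Θ(log C) bits.

digitsᵇ : ℕᵇ → List Bool
digitsᵇ zeroᵇ     = []
digitsᵇ 2[1+ n ]  = true  ∷ digitsᵇ n
digitsᵇ 1+[2 n ]  = false ∷ digitsᵇ n

encNat : ℕ → List Bool
encNat n = concatMap (λ b → true ∷ b ∷ []) (digitsᵇ (toℕᵇ n)) ++ (false ∷ false ∷ [])

encCmp : Cmp → List Bool
encCmp atMost  = encNat 0
encCmp atLeast = encNat 1

encN2 : N2 → List Bool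
encN2 (cntPos ⋈ C p q) = encNat 0 ++ encCmp ⋈ ++ encNat C ++ encNat p ++ encNat q
encN2 (cntNeg ⋈ C p q) = encNat 1 ++ encCmp ⋈ ++ encNat C ++ encNat p ++ encNat q
encN2 (cntNest ⋈ C p ⋈' D q r) =
  encNat 2 ++ encCmp ⋈ ++ encNat C ++ encNat p ++ encCmp ⋈' ++ encNat D ++ encNat q ++ encNat r

encSet : List N2 → List Bool
encSet = concatMap encN2

-- Turing machines (single two-way infinite tape).
-- Tape symbols Fin (3 + g): fz = blank, fs fz = bit false, fs (fs fz) = bit true.

data Move : Set where
  left right stay : Move

module TM (nQ g : ℕ) where
  Sym : Set
  Sym = Fin (suc (suc (suc g)))

  blank : Sym
  blank = fz

  bitSym : Bool → Sym
  bitSym false = fs fz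
  bitSym true  = fs (fs fz)

  record Config : Set where
    constructor ⟨_,_,_,_⟩
    field
      state : Fin nQ
      lft   : List Sym     -- cells left of the head, nearest first
      hd    : Sym
      rgt   : List Sym     -- cells right of the head, nearest first

  moveHead : Move → List Sym → Sym → List Sym → List Sym × Sym × List Sym
  moveHead left  []      h r       = [] , blank , h ∷ r
  moveHead left  (a ∷ l) h r       = l , a , h ∷ r
  moveHead right l       h []      = h ∷ l , blank , []
  moveHead right l       h (a ∷ r) = h ∷ l , a , r
  moveHead stay  l       h r       = l , h , r

  apply : Config → Fin nQ × Sym × Move → Config
  apply ⟨ _ , l , _ , r ⟩ (q' , w , m) with moveHead m l w r
  ... | l' , h' , r' = ⟨ q' , l' , h' , r' ⟩

  initial : Fin nQ → List Bool → Config
  initial s []      = ⟨ s , [] , blank , [] ⟩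
  initial s (b ∷ x) = ⟨ s , [] , bitSym b , map bitSym x ⟩

  readBits : List Sym → List Bool
  readBits []                   = []
  readBits (fz ∷ _)             = []
  readBits (fs fz ∷ s)          = false ∷ readBits s
  readBits (fs (fs fz) ∷ s)     = true ∷ readBits s
  readBits (fs (fs (fs _)) ∷ _) = []

record NTM : Set where
  field
    nQ g   : ℕ
    start  : Fin nQ
    accept : Fin nQ
    δ      : Fin nQ → TM.Sym nQ g → List (Fin nQ × TM.Sym nQ g × Move)

module NTMRun (M : NTM) where
  open NTM M
  open TM nQ g

  data Step (c : Config) : Config → Set where
    step : ∀ {t} → t ∈ δ (Config.state c) (Config.hd c) → Step c (apply c t)

  data Reach : ℕ → Config → Config → Set where
    done : ∀ {t c} → Reach t c c
    more : ∀ {t c c' c''} → Step c c' → Reach t c' c'' → Reach (suc t) c c''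

  AcceptsWithin : ℕ → List Bool → Set
  AcceptsWithin t x = Σ Config λ c → Reach t (initial start x) c × Config.state c ≡ accept

-- L ∈ NEXPTIME = ⋃_k NTIME(2^{n^k}) (clocked acceptance; n = input length,
-- using (2+n)^k so that the bound is ≥ any constant for large k)
InNEXPTIME : (List Bool → Set) → Set
InNEXPTIME L = Σ NTM λ M → Σ ℕ λ k →
  ∀ x → L x ⇔ NTMRun.AcceptsWithin M (2 ^ ((2 + length x) ^ k)) x

record DTM : Set where
  field
    nQ g  : ℕ
    start : Fin nQ
    δ     : Fin nQ → TM.Sym nQ g → Maybe (Fin nQ × TM.Sym nQ g × Move)

module DTMRun (M : DTM) where
  open DTM M
  open TM nQ g

  Halted : Config → Set
  Halted c = δ (Config.state c) (Config.hd c) ≡ nothing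

  stepD : Config → Maybe Config
  stepD c with δ (Config.state c) (Config.hd c)
  ... | nothing = nothing
  ... | just t  = just (apply c t)

  run : ℕ → Config → Config
  run zero    c = c
  run (suc t) c with stepD c
  ... | nothing = c
  ... | just c' = run t c'

  output : Config → List Bool
  output c = readBits (Config.hd c ∷ Config.rgt c)

PolyTimeComputable : (List Bool → List Bool) → Set
PolyTimeComputable f = Σ DTM λ M → Σ ℕ λ k → ∀ x →
  let open DTMRun M
      c = run ((2 + length x) ^ k) (TM.initial (DTM.nQ M) (DTM.g M) (DTM.start M) x)
  in Halted c × output c ≡ f x

-- Fix a nondeterministic machine running in time T = 2 ^ (N ^ k), where N = 2 + n
-- and n is the length of the input x.  Its accepting runs are tilings of a torus
-- of T rows (time) and W > T columns (distance from the head), where a tile holds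
-- the symbols to the left and to the right of the head at that distance, copies
-- of those of its two neighbours, and the state and action of its row; adjacent
-- tiles constrain each other only pairwise.
--
-- Counting makes the torus definable.  If |dom| ≤ 2c and p, p̄ are disjoint
-- subsets of dom with at least c elements each, then p̄ is the complement of p in
-- dom; so complements, and with them all propositional constraints on cells, are
-- expressible.  Unary predicates give every cell two binary coordinates, the
-- move relations increment one of them, and there is a cell with coordinates
-- (0,0); hence all WT coordinates occur, and if c = WT they occur exactly once.
--
-- The formulas are emitted by nested loops over the input, which a single-tape
-- machine executes in polynomial time by marking the current cell of each loop.
-- A model need not be decidable, so it yields a tiling only up to double negation;
-- this suffices because acceptance within T steps is decidable.

module Submission where

open import Defs
open import Data.Nat using (ℕ; zero; suc; _+_; _*_; _∸_; _^_; _≤_; _<_; _⊔_; z≤n; s≤s)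
open import Data.Bool using (Bool; true; false; not; _∧_; _xor_; if_then_else_)
open import Data.List using (List; []; _∷_; _++_; _ʳ++_; [_]; concatMap; length; map; replicate; reverse)
open import Data.List.Relation.Unary.All using (All; []; _∷_)
open import Data.List.Membership.Propositional using (_∈_)
open import Data.Vec using (Vec; []; _∷_; lookup)
open import Data.Fin using (Fin; toℕ) renaming (zero to fz; suc to fs)
open import Data.Maybe using (Maybe; just; nothing)
open import Data.Product using (Σ; ∃; _×_; _,_; proj₁; proj₂; map₁)
open import Data.Sum using (_⊎_; inj₁; inj₂; [_,_]′)
open import Data.Unit using (⊤; tt)
open import Data.Empty using (⊥; ⊥-elim)
open import Relation.Binary.PropositionalEquality using (_≡_; _≢_; refl; sym; trans; cong; cong₂; subst; subst₂; module ≡-Reasoning)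
open import Relation.Nullary using (¬_; Dec; yes; no; does)
open import Function using (_∘_)
open import Function.Bundles using (_⇔_; mk⇔; Equivalence)
open import Function.Definitions using (Injective)
import Data.Nat.Properties as ℕₚ
import Data.Fin as Fin
import Data.Fin.Properties as Finₚ
import Data.List.Properties as Listₚ
import Data.List.Relation.Unary.All.Properties as Allₚ
open import Relation.Nullary.Decidable using (dec-true; dec-false; decidable-stable)
open import Data.Nat.Tactic.RingSolver using (solve-∀)
open import Data.Nat.Binary.Base using (ℕᵇ; 2[1+_]; 1+[2_]) renaming (zero to zeroᵇ; fromℕ to toℕᵇ; toℕ to fromℕᵇ)
import Data.Nat.Binary.Properties as ℕᵇₚ
open import Relation.Nullary.Decidable using (_×-dec_; _⊎-dec_; _→-dec_; map′)
import Data.Product.Properties as Productₚ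
import Data.List.Membership.DecPropositional as DecMembership
import Data.Bool.Properties as Boolₚ
import Data.List.Relation.Unary.Any as Any
open import Data.List.Membership.Propositional using (find; lose)

-- Since distances are taken from the head, a move shifts both halves of the tape. The new symbol at
-- distance j is an old one at distance j - 1 or j + 1; without the copies this would relate three
-- tiles at once. On a torus the last column is followed by column 0, so copies are not checked at
-- that seam. The damage spreads inwards by one column per step, and W ≥ T + 2 keeps the head out of
-- its reach. The seam from row T to row 0 carries the acceptance condition in place of a
-- transition, and an idle action pads shorter runs. The bound 2c leaves room for c dummies beside
-- the cells. On them each predicate may take the opposite value, so it can be asked to hold of
-- exactly half of `dom` whatever its values on the cells are. A disjunction over a fixed finite set
-- is expressed by a successor in a set of bounded size that is covered by named pieces; bans then
-- exclude each choice that contradicts the cell. Column and row numbers have 1 + N^(k+1) and N^k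
-- bits, so c is a power of two with polynomially many digits, which loops can print without
-- arithmetic.

record Finite (A : Set) : Set where
  field
    size       : ℕ
    index      : A → Fin size
    elem       : Fin size → A
    -- Only this round trip is needed: several numbers may decode to the same element, so `size` is
    -- merely an upper bound.
    elem-index : ∀ a → elem (index a) ≡ a

open Finite

finite-retract : ∀ {A B} (f : A → B) (g : B → A) → (∀ a → g (f a) ≡ a) → Finite B → Finite A
finite-retract f g gf F .size  = size F
finite-retract f g gf F .index = index F ∘ f
finite-retract f g gf F .elem  = g ∘ elem F
finite-retract f g gf F .elem-index a = trans (cong g (elem-index F (f a))) (gf a)

finite-Fin : ∀ n → Finite (Fin n)
finite-Fin n .size       = n
finite-Fin n .index i    = i
finite-Fin n .elem i     = i
finite-Fin n .elem-index i = refl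

finite-⊎ : ∀ {A B} → Finite A → Finite B → Finite (A ⊎ B)
finite-⊎ F G .size = size F + size G
finite-⊎ F G .index (inj₁ a) = Fin.join (size F) (size G) (inj₁ (index F a))
finite-⊎ F G .index (inj₂ b) = Fin.join (size F) (size G) (inj₂ (index G b))
finite-⊎ F G .elem i = Data.Sum.map (elem F) (elem G) (Fin.splitAt (size F) i)
finite-⊎ F G .elem-index (inj₁ a)
  rewrite Finₚ.splitAt-join (size F) (size G) (inj₁ (index F a)) = cong inj₁ (elem-index F a)
finite-⊎ F G .elem-index (inj₂ b)
  rewrite Finₚ.splitAt-join (size F) (size G) (inj₂ (index G b)) = cong inj₂ (elem-index G b)

finite-× : ∀ {A B} → Finite A → Finite B → Finite (A × B)
finite-× F G .size = size F * size G
finite-× F G .index (a , b) = Fin.combine (index F a) (index G b)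
finite-× F G .elem i = Data.Product.map (elem F) (elem G) (Fin.remQuot {size F} (size G) i)
finite-× F G .elem-index (a , b) =
  trans (cong (Data.Product.map (elem F) (elem G)) (Finₚ.remQuot-combine (index F a) (index G b)))
        (cong₂ _,_ (elem-index F a) (elem-index G b))

finite-Maybe : ∀ {A} → Finite A → Finite (Maybe A)
finite-Maybe F .size = suc (size F)
finite-Maybe F .index nothing  = fz
finite-Maybe F .index (just a) = fs (index F a)
finite-Maybe F .elem fz     = nothing
finite-Maybe F .elem (fs i) = just (elem F i)
finite-Maybe F .elem-index nothing  = refl
finite-Maybe F .elem-index (just a) = cong just (elem-index F a)

finite-Bool : Finite Bool
finite-Bool = finite-retract to from from-to (finite-Fin 2)
  where
  to : Bool → Fin 2
  to false = fz
  to true  = fs fz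
  from : Fin 2 → Bool
  from fz      = false
  from (fs fz) = true
  from-to : ∀ b → from (to b) ≡ b
  from-to false = refl
  from-to true  = refl

finite-Vec : ∀ {A} n → Finite A → Finite (Vec A n)
finite-Vec zero F =
  finite-retract (λ _ → fz) (λ _ → []) (λ { [] → refl }) (finite-Fin 1)
finite-Vec (suc n) F =
  finite-retract (λ { (a ∷ v) → a , v }) (λ { (a , v) → a ∷ v }) (λ { (a ∷ v) → refl })
    (finite-× F (finite-Vec n F))

-- Turing machines over an arbitrary alphabet

data Symbol (X : Set) : Set where
  blank : Symbol X
  bit   : Bool → Symbol X
  aux   : X → Symbol X

Tape : Set → Set
Tape X = List (Symbol X) × Symbol X × List (Symbol X)

module _ {X : Set} where

  focusˡ focusʳ : List (Symbol X) → List (Symbol X) → Tape X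
  focusˡ []      r = [] , blank , r
  focusˡ (x ∷ l) r = l , x , r
  focusʳ l []      = l , blank , []
  focusʳ l (x ∷ r) = l , x , r

  shift : Move → List (Symbol X) → Symbol X → List (Symbol X) → Tape X
  shift left  l w r = focusˡ l (w ∷ r)
  shift right l w r = focusʳ (w ∷ l) r
  shift stay  l w r = l , w , r

-- A machine hands over control by moving to the non-state `nothing`, which
-- makes machines composable; `Run δ n q tp tp′` says that this happens within
-- n steps, turning the tape tp into tp′.

Table : Set → Set → Set
Table X Q = Q → Symbol X → Maybe Q × Symbol X × Move

data Run {X Q} (δ : Table X Q) : ℕ → Q → Tape X → Tape X → Set where
  exit : ∀ {n q l h r w m tp} → δ q h ≡ (nothing , w , m) → shift m l w r ≡ tp →
         Run δ (suc n) q (l , h , r) tp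
  next : ∀ {n q l h r q′ w m tp} → δ q h ≡ (just q′ , w , m) → Run δ n q′ (shift m l w r) tp →
         Run δ (suc n) q (l , h , r) tp

record Machine (X : Set) : Set₁ where
  field
    State  : Set
    finite : Finite State
    entry  : State
    table  : Table X State

open Machine

Does : ∀ {X} → Machine X → ℕ → Tape X → Tape X → Set
Does M n = Run (table M) n (entry M)

redirect : ∀ {Q Q′ : Set} → (Q → Q′) → Maybe Q′ → Maybe Q → Maybe Q′
redirect emb k (just q) = just (emb q)
redirect emb k nothing  = k

module _ {X : Set} where

  Run-weaken : ∀ {Q} {δ : Table X Q} {m n q tp tp′} → m ≤ n → Run δ m q tp tp′ → Run δ n q tp tp′
  Run-weaken (s≤s le) (exit e f)  = exit e f
  Run-weaken (s≤s le) (next e r) = next e (Run-weaken le r)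

  Run-from : ∀ {Q} {δ : Table X Q} {n q tp₁ tp₂ tp} → tp₁ ≡ tp₂ → Run δ n q tp₁ tp → Run δ n q tp₂ tp
  Run-from refl R = R

  Run-embed : ∀ {Q Q′} {δ : Table X Q} {δ′ : Table X Q′} (emb : Q → Q′) →
    (∀ q s → δ′ (emb q) s ≡ map₁ (redirect emb nothing) (δ q s)) →
    ∀ {n q tp tp′} → Run δ n q tp tp′ → Run δ′ n (emb q) tp tp′
  Run-embed emb eq {q = q} {tp = _ , h , _} (exit e f) =
    exit (trans (eq q h) (cong (map₁ (redirect emb nothing)) e)) f
  Run-embed emb eq {q = q} {tp = _ , h , _} (next e r) =
    next (trans (eq q h) (cong (map₁ (redirect emb nothing)) e)) (Run-embed emb eq r)

  -- The exiting step of the first run is reused as the step into `k`, so composition costs m + n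
  -- steps with no overhead; steps left over from m are given to the second run.
  Run-then : ∀ {Q Q′} {δ : Table X Q} {δ′ : Table X Q′} (emb : Q → Q′) (k : Q′) →
    (∀ q s → δ′ (emb q) s ≡ map₁ (redirect emb (just k)) (δ q s)) →
    ∀ {m n q tp tp′ tp″} → Run δ m q tp tp′ → Run δ′ n k tp′ tp″ → Run δ′ (m + n) (emb q) tp tp″
  Run-then emb k eq {q = q} {tp = _ , h , _} (exit {n} e refl) r′ =
    next (trans (eq q h) (cong (map₁ (redirect emb (just k))) e)) (Run-weaken (ℕₚ.m≤n+m _ n) r′)
  Run-then emb k eq {q = q} {tp = _ , h , _} (next e r) r′ =
    next (trans (eq q h) (cong (map₁ (redirect emb (just k))) e)) (Run-then emb k eq r r′)

  scanˡ : ∀ {Q} {δ : Table X Q} {q n tp} xs {ys r} →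
    All (λ s → δ q s ≡ (just q , s , left)) xs →
    Run δ n q (focusˡ ys (xs ʳ++ r)) tp → Run δ (length xs + n) q (focusˡ (xs ++ ys) r) tp
  scanˡ []       []       R = R
  scanˡ (x ∷ xs) (e ∷ es) R = next e (scanˡ xs es R)

  scanʳ : ∀ {Q} {δ : Table X Q} {q n tp} xs {l ys} →
    All (λ s → δ q s ≡ (just q , s , right)) xs →
    Run δ n q (focusʳ (xs ʳ++ l) ys) tp → Run δ (length xs + n) q (focusʳ l (xs ++ ys)) tp
  scanʳ []       []       R = R
  scanʳ (x ∷ xs) (e ∷ es) R = next e (scanʳ xs es R)

  -- For the way back: an earlier pass has left `xs` reversed on the far side of the head, and the
  -- return pass restores its order.
  scanʳ-back : ∀ {Q} {δ : Table X Q} {q n tp} xs {l ys} →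
    All (λ s → δ q s ≡ (just q , s , right)) xs →
    Run δ n q (focusʳ (xs ++ l) ys) tp → Run δ (length xs + n) q (focusʳ l (xs ʳ++ ys)) tp
  scanʳ-back []       []       R = R
  scanʳ-back {δ = δ} {q} {n} {tp} (x ∷ xs) {l} {ys} (e ∷ es) R =
    subst (λ k → Run δ k q (focusʳ l (xs ʳ++ (x ∷ ys))) tp) (ℕₚ.+-suc (length xs) n)
      (scanʳ-back xs {l} {x ∷ ys} es (next e R))

  scanˡ-back : ∀ {Q} {δ : Table X Q} {q n tp} xs {ys r} →
    All (λ s → δ q s ≡ (just q , s , left)) xs →
    Run δ n q (focusˡ ys (xs ++ r)) tp → Run δ (length xs + n) q (focusˡ (xs ʳ++ ys) r) tp
  scanˡ-back []       []       R = R
  scanˡ-back {δ = δ} {q} {n} {tp} (x ∷ xs) {ys} {r} (e ∷ es) R =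
    subst (λ k → Run δ k q (focusˡ (xs ʳ++ (x ∷ ys)) r) tp) (ℕₚ.+-suc (length xs) n)
      (scanˡ-back xs {x ∷ ys} {r} es (next e R))

  seqTable : (M M′ : Machine X) → Table X (State M ⊎ State M′)
  seqTable M M′ (inj₁ q) s = map₁ (redirect inj₁ (just (inj₂ (entry M′)))) (table M q s)
  seqTable M M′ (inj₂ q) s = map₁ (redirect inj₂ nothing) (table M′ q s)

  seqM : Machine X → Machine X → Machine X
  seqM M M′ .State  = State M ⊎ State M′
  seqM M M′ .finite = finite-⊎ (finite M) (finite M′)
  seqM M M′ .entry  = inj₁ (entry M)
  seqM M M′ .table  = seqTable M M′

  seqM-does : ∀ M M′ {m n tp tp′ tp″} → Does M m tp tp′ → Does M′ n tp′ tp″ →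
    Does (seqM M M′) (m + n) tp tp″
  seqM-does M M′ R R′ = Run-then inj₁ _ (λ _ _ → refl) R (Run-embed inj₂ (λ _ _ → refl) R′)

-- Realisation of machines as deterministic Turing machines

module Realise {X : Set} (F : Finite X) (M : Machine X) where

  encode : Symbol X → Fin (3 + size F)
  encode blank       = fz
  encode (bit false) = fs fz
  encode (bit true)  = fs (fs fz)
  encode (aux x)     = fs (fs (fs (index F x)))

  decode : Fin (3 + size F) → Symbol X
  decode fz               = blank
  decode (fs fz)          = bit false
  decode (fs (fs fz))     = bit true
  decode (fs (fs (fs i))) = aux (elem F i)

  decode-encode : ∀ s → decode (encode s) ≡ s
  decode-encode blank       = refl
  decode-encode (bit false) = refl
  decode-encode (bit true)  = refl
  decode-encode (aux x)     = cong aux (elem-index F x)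

  -- The non-state `nothing` becomes a state without transitions, so that handing over control is
  -- halting.
  FS : Finite (Maybe (State M))
  FS = finite-Maybe (finite M)

  move : Maybe (State M) → Symbol X → Maybe (Fin (size FS) × Fin (3 + size F) × Move)
  move nothing  s = nothing
  move (just q) s = let q′ , w , m = table M q s in just (index FS q′ , encode w , m)

  dtm : DTM
  dtm .DTM.nQ    = size FS
  dtm .DTM.g     = size F
  dtm .DTM.start = index FS (just (entry M))
  dtm .DTM.δ i a = move (elem FS i) (decode a)

  open TM (size FS) (size F) hiding (blank)
  open DTMRun dtm

  config : Maybe (State M) → Tape X → Config
  config q (l , h , r) = ⟨ index FS q , map encode l , encode h , map encode r ⟩

  δ-config : ∀ q h → DTM.δ dtm (index FS q) (encode h) ≡ move q h
  δ-config q h = cong₂ move (elem-index FS q) (decode-encode h)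

  apply-config : ∀ i q′ l h w r m →
    apply ⟨ i , map encode l , encode h , map encode r ⟩ (index FS q′ , encode w , m)
      ≡ config q′ (shift m l w r)
  apply-config i q′ []      h w r       left  = refl
  apply-config i q′ (x ∷ l) h w r       left  = refl
  apply-config i q′ l       h w []      right = refl
  apply-config i q′ l       h w (x ∷ r) right = refl
  apply-config i q′ l       h w r       stay  = refl

  stepD-just : ∀ c {t} → DTM.δ dtm (Config.state c) (Config.hd c) ≡ just t →
    stepD c ≡ just (apply c t)
  stepD-just c e rewrite e = refl

  stepD-nothing : ∀ c → Halted c → stepD c ≡ nothing
  stepD-nothing c e rewrite e = refl

  run-just : ∀ n c {c′} → stepD c ≡ just c′ → run (suc n) c ≡ run n c′
  run-just n c e rewrite e = refl

  run-halted : ∀ n c → Halted c → run n c ≡ c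
  run-halted zero    c e = refl
  run-halted (suc n) c e rewrite stepD-nothing c e = refl

  halted : ∀ tp → Halted (config nothing tp)
  halted (l , h , r) = δ-config nothing h

  run-step : ∀ n {q l h r q′ w m} → table M q h ≡ (q′ , w , m) →
    run (suc n) (config (just q) (l , h , r)) ≡ run n (config q′ (shift m l w r))
  run-step n {q} {l} {h} {r} {q′} {w} {m} e = begin
    run (suc n) (config (just q) (l , h , r))
      ≡⟨ run-just n (config (just q) (l , h , r)) (stepD-just (config (just q) (l , h , r)) (trans (δ-config (just q) h) eq)) ⟩
    run n (apply (config (just q) (l , h , r)) (index FS q′ , encode w , m))
      ≡⟨ cong (run n) (apply-config (index FS (just q)) q′ l h w r m) ⟩
    run n (config q′ (shift m l w r)) ∎
    where
    open ≡-Reasoning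
    eq : move (just q) h ≡ just (index FS q′ , encode w , m)
    eq rewrite e = refl

  run-realises : ∀ {n q tp tp′} → Run (table M) n q tp tp′ →
    run n (config (just q) tp) ≡ config nothing tp′
  run-realises {suc n} {tp = l , h , r} {tp′} (exit e refl) =
    trans (run-step n e) (run-halted n (config nothing tp′) (halted tp′))
  run-realises {suc n} (next e R) = trans (run-step n e) (run-realises R)

  initial-config : ∀ x →
    initial (index FS (just (entry M))) x ≡ config (just (entry M)) (focusʳ [] (map bit x))
  initial-config []      = refl
  initial-config (b ∷ x) = cong₂ (λ h r → ⟨ index FS (just (entry M)) , [] , h , r ⟩) (bitSym-encode b) (go x)
    where
    bitSym-encode : ∀ b → bitSym b ≡ encode (bit b)
    bitSym-encode false = refl
    bitSym-encode true  = refl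
    go : ∀ x → map bitSym x ≡ map encode (map bit x)
    go []      = refl
    go (b ∷ x) = cong₂ _∷_ (bitSym-encode b) (go x)

  output-config : ∀ l o → output (config nothing (focusʳ l (map bit o))) ≡ o
  output-config l []      = refl
  output-config l (b ∷ o) = go (b ∷ o)
    where
    go : ∀ o → readBits (map encode (map bit o)) ≡ o
    go []          = refl
    go (false ∷ o) = cong (false ∷_) (go o)
    go (true ∷ o)  = cong (true ∷_) (go o)

  poly-time : (f : List Bool → List Bool) (k : ℕ) →
    (∀ x → ∃ λ l → Does M ((2 + length x) ^ k) (focusʳ [] (map bit x)) (focusʳ l (map bit (f x)))) →
    PolyTimeComputable f
  poly-time f k runs = dtm , k , λ x →
    let l , R = runs x
        e = trans (cong (run ((2 + length x) ^ k)) (initial-config x)) (run-realises R)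
    in subst Halted (sym e) (halted (focusʳ l (map bit (f x)))) ,
       trans (cong output e) (output-config l (f x))

-- A language of nested loops over the input

collect : ∀ {A : Set} → (ℕ → List A) → ℕ → ℕ → List A
collect F i zero    = []
collect F i (suc r) = F i ++ collect F (suc i) r

data Ty : Set where
  ty  : Bool → Ty
  pad : Ty

finite-Ty : Finite Ty
finite-Ty = finite-retract (λ { (ty b) → just b ; pad → nothing })
  (λ { (just b) → ty b ; nothing → pad }) (λ { (ty b) → refl ; pad → refl })
  (finite-Maybe finite-Bool)

-- `loop nothing` visits all cells, `loop (just p)` only those before the cell at which the
-- enclosing loop `p` stands. The latter turns a loop index into that many repetitions without a
-- counter.
data Cmd (d : ℕ) : Set where
  skip   : Cmd d
  emit   : Bool → Cmd d
  _⨾_    : Cmd d → Cmd d → Cmd d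
  loop   : Maybe (Fin d) → Cmd (suc d) → Cmd d
  bycell : Fin d → (Ty → Cmd d) → Cmd d

infixr 5 _⨾_

nth : ∀ {A : Set} → A → List A → ℕ → A
nth a []       i       = a
nth a (x ∷ xs) zero    = x
nth a (x ∷ xs) (suc i) = nth a xs i

nth-≥ : ∀ {A : Set} (a : A) xs {i} → length xs ≤ i → nth a xs i ≡ a
nth-≥ a []       le       = refl
nth-≥ a (x ∷ xs) (s≤s le) = nth-≥ a xs le

module _ (ts : List Ty) where

  bound : ∀ {d} → Maybe (Fin d) → Vec ℕ d → ℕ
  bound nothing  ρ = length ts
  bound (just p) ρ = lookup ρ p

  out : ∀ {d} → Cmd d → Vec ℕ d → List Bool
  out skip         ρ = []
  out (emit b)     ρ = [ b ]
  out (c ⨾ c′)     ρ = out c ρ ++ out c′ ρ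
  out (loop l c)   ρ = collect (λ j → out c (j ∷ ρ)) 0 (bound l ρ)
  out (bycell p c) ρ = out (c (nth pad ts (lookup ρ p))) ρ

Fits : ℕ → ∀ {d} → Cmd d → Set
Fits K skip           = ⊤
Fits K (emit b)       = ⊤
Fits K (c ⨾ c′)       = Fits K c × Fits K c′
Fits K {d} (loop l c) = d < K × Fits K c
Fits K (bycell p c)   = ∀ t → Fits K (c t)

depth : ∀ {d} → Cmd d → ℕ
depth skip         = 0
depth (emit b)     = 0
depth (c ⨾ c′)     = depth c ⊔ depth c′
depth {d} (loop l c) = suc d ⊔ depth c
depth (bycell p c) = depth (c (ty false)) ⊔ (depth (c (ty true)) ⊔ depth (c pad))

depth-fits : ∀ {K d} (c : Cmd d) → depth c ≤ K → Fits K c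
depth-fits skip       le = tt
depth-fits (emit b)   le = tt
depth-fits (c ⨾ c′)   le = depth-fits c (ℕₚ.m⊔n≤o⇒m≤o (depth c) _ le) , depth-fits c′ (ℕₚ.m⊔n≤o⇒n≤o (depth c) _ le)
depth-fits (loop l c) le = ℕₚ.m⊔n≤o⇒m≤o _ (depth c) le , depth-fits c (ℕₚ.m⊔n≤o⇒n≤o _ (depth c) le)
depth-fits (bycell p c) le (ty false) = depth-fits (c (ty false)) (ℕₚ.m⊔n≤o⇒m≤o (depth (c (ty false))) _ le)
depth-fits (bycell p c) le (ty true)  = depth-fits (c (ty true))
  (ℕₚ.m⊔n≤o⇒m≤o (depth (c (ty true))) _ (ℕₚ.m⊔n≤o⇒n≤o (depth (c (ty false))) _ le))
depth-fits (bycell p c) le pad = depth-fits (c pad)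
  (ℕₚ.m⊔n≤o⇒n≤o (depth (c (ty true))) _ (ℕₚ.m⊔n≤o⇒n≤o (depth (c (ty false))) _ le))

get : ∀ {K} → ℕ → Vec Bool K → Bool
get ℓ       []      = false
get zero    (b ∷ v) = b
get (suc ℓ) (b ∷ v) = get ℓ v

put : ∀ {K} → ℕ → Bool → Vec Bool K → Vec Bool K
put ℓ       b []      = []
put zero    b (_ ∷ v) = b ∷ v
put (suc ℓ) b (a ∷ v) = a ∷ put ℓ b v

get-put : ∀ {K ℓ} b (v : Vec Bool K) → ℓ < K → get ℓ (put ℓ b v) ≡ b
get-put {ℓ = zero}  b (_ ∷ v) le       = refl
get-put {ℓ = suc ℓ} b (_ ∷ v) (s≤s le) = get-put b v le

get-put-other : ∀ {K} ℓ ℓ′ b (v : Vec Bool K) → ℓ ≢ ℓ′ → get ℓ (put ℓ′ b v) ≡ get ℓ v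
get-put-other ℓ       ℓ′       b []      ne = refl
get-put-other zero    zero     b (_ ∷ v) ne = ⊥-elim (ne refl)
get-put-other zero    (suc ℓ′) b (_ ∷ v) ne = refl
get-put-other (suc ℓ) zero     b (_ ∷ v) ne = refl
get-put-other (suc ℓ) (suc ℓ′) b (_ ∷ v) ne = get-put-other ℓ ℓ′ b v (ne ∘ cong suc)

put-put : ∀ {K} ℓ {b} b′ (v : Vec Bool K) → get ℓ v ≡ b → put ℓ b (put ℓ b′ v) ≡ v
put-put ℓ       b′ []      e = refl
put-put zero    b′ (_ ∷ v) refl = refl
put-put (suc ℓ) b′ (a ∷ v) e = cong (a ∷_) (put-put ℓ b′ v e)

-- Counted from the outermost loop, a loop keeps its number when further loops are entered inside
-- it, and so does its mark on the tape.
level : ∀ {d} → Fin d → ℕ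
level {suc d} fz     = d
level         (fs p) = level p

level<d : ∀ {d} (p : Fin d) → level p < d
level<d fz     = ℕₚ.≤-refl
level<d (fs p) = ℕₚ.m<n⇒m<1+n (level<d p)

-- Between commands the head rests on `hash`, with the cells of the workspace
-- (nearest first) and then `lend` to its left, and the output written so far to
-- its right.  The cell at which the loop of nesting depth ℓ currently stands
-- carries the mark ℓ.
module Compile (K : ℕ) where

  data Aux : Set where
    lend hash : Aux
    cell      : Ty → Vec Bool K → Aux

  finite-Aux : Finite Aux
  finite-Aux = finite-retract
    (λ { lend → nothing ; hash → just nothing ; (cell t v) → just (just (t , v)) })
    (λ { nothing → lend ; (just nothing) → hash ; (just (just (t , v))) → cell t v })
    (λ { lend → refl ; hash → refl ; (cell t v) → refl })
    (finite-Maybe (finite-Maybe (finite-× finite-Ty (finite-Vec K finite-Bool))))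

  Sy : Set
  Sy = Symbol Aux

  isHash : Sy → Bool
  isHash (aux hash) = true
  isHash _          = false

  hasMark : ℕ → Sy → Bool
  hasMark ℓ (aux (cell t v)) = get ℓ v
  hasMark ℓ _                = false

  setMark : ℕ → Bool → Sy → Sy
  setMark ℓ b (aux (cell t v)) = aux (cell t (put ℓ b v))
  setMark ℓ b s                = s

  stops : ∀ {d} → Sy → Maybe (Fin d) → Bool
  stops (aux lend) l        = true
  stops s          (just p) = hasMark (level p) s
  stops s          nothing  = false

  skipM : Machine Aux
  skipM .State     = Fin 1
  skipM .finite    = finite-Fin 1
  skipM .entry     = fz
  skipM .table q s = nothing , s , stay

  emitTable : Bool → Table Aux (Fin 2)
  emitTable b fz      blank      = just (fs fz) , bit b , left
  emitTable b fz      s          = just fz , s , right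
  emitTable b (fs fz) (aux hash) = nothing , aux hash , stay
  emitTable b (fs fz) s          = just (fs fz) , s , left

  emitM : Bool → Machine Aux
  emitM b .State  = Fin 2
  emitM b .finite = finite-Fin 2
  emitM b .entry  = fz
  emitM b .table  = emitTable b

  pattern enter  = inj₁ fz
  pattern arrive = inj₁ (fs fz)
  pattern carry  = inj₁ (fs (fs fz))
  pattern seek   = inj₁ (fs (fs (fs fz)))
  pattern return = inj₁ (fs (fs (fs (fs fz))))

  -- One round: `arrive` inspects the next cell and marks it, `carry` returns to `hash`, where the
  -- body runs, and `seek` finds the mark again, erases it and steps on. The mark is all that the
  -- loop remembers while its body runs. At the stopping cell `return` brings the head home.
  loopTable : ∀ {d} → Maybe (Fin d) → (B : Machine Aux) → Table Aux (Fin 5 ⊎ State B)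
  loopTable l B enter  s = just arrive , s , left
  loopTable {d} l B arrive s =
    if stops s l then (just return , s , right) else (just carry , setMark d true s , right)
  loopTable l B carry  s =
    if isHash s then (just (inj₂ (entry B)) , s , stay) else (just carry , s , right)
  loopTable {d} l B seek   s =
    if hasMark d s then (just arrive , setMark d false s , left) else (just seek , s , left)
  loopTable l B return s = if isHash s then (nothing , s , stay) else (just return , s , right)
  loopTable l B (inj₂ q) s = map₁ (redirect inj₂ (just seek)) (table B q s)

  loopM : ∀ {d} → Maybe (Fin d) → Machine Aux → Machine Aux
  loopM l B .State  = Fin 5 ⊎ State B
  loopM l B .finite = finite-⊎ (finite-Fin 5) (finite B)
  loopM l B .entry  = enter
  loopM l B .table  = loopTable l B

  Branches : (Ty → Machine Aux) → Set
  Branches B = State (B (ty false)) ⊎ (State (B (ty true)) ⊎ State (B pad))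

  branch : ∀ B t → State (B t) → Branches B
  branch B (ty false) q = inj₁ q
  branch B (ty true)  q = inj₂ (inj₁ q)
  branch B pad        q = inj₂ (inj₂ q)

  unbranch : ∀ B → Branches B → Σ Ty (State ∘ B)
  unbranch B (inj₁ q)        = ty false , q
  unbranch B (inj₂ (inj₁ q)) = ty true , q
  unbranch B (inj₂ (inj₂ q)) = pad , q

  unbranch-branch : ∀ B t q → unbranch B (branch B t q) ≡ (t , q)
  unbranch-branch B (ty false) q = refl
  unbranch-branch B (ty true)  q = refl
  unbranch-branch B pad        q = refl

  caseTable : ∀ {d} → Fin d → (B : Ty → Machine Aux) → Table Aux (Maybe Ty ⊎ Branches B)
  caseTable p B (inj₁ nothing) (aux (cell t v)) =
    if get (level p) v then (just (inj₁ (just t)) , aux (cell t v) , right)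
                       else (just (inj₁ nothing) , aux (cell t v) , left)
  caseTable p B (inj₁ nothing) s = just (inj₁ nothing) , s , left
  caseTable p B (inj₁ (just t)) s =
    if isHash s then (just (inj₂ (branch B t (entry (B t)))) , s , stay)
                else (just (inj₁ (just t)) , s , right)
  caseTable p B (inj₂ q) s = let t , q′ = unbranch B q in
    map₁ (redirect (inj₂ ∘ branch B t) nothing) (table (B t) q′ s)

  caseM : ∀ {d} → Fin d → (Ty → Machine Aux) → Machine Aux
  caseM p B .State  = Maybe Ty ⊎ Branches B
  caseM p B .finite = finite-⊎ (finite-Maybe finite-Ty)
    (finite-⊎ (finite (B (ty false))) (finite-⊎ (finite (B (ty true))) (finite (B pad))))
  caseM p B .entry  = inj₁ nothing
  caseM p B .table  = caseTable p B

  compile : ∀ {d} → Cmd d → Machine Aux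
  compile skip         = skipM
  compile (emit b)     = emitM b
  compile (c ⨾ c′)     = seqM (compile c) (compile c′)
  compile (loop l c)   = loopM l (compile c)
  compile (bycell p c) = caseM p (λ t → compile (c t))

  marks : ∀ {d} → Vec ℕ d → ℕ → Vec Bool K
  marks []              i = Data.Vec.replicate K false
  marks {suc d} (j ∷ ρ) i = if does (j ℕₚ.≟ i) then put d true (marks ρ i) else marks ρ i

  marks-hit : ∀ {d} (ρ : Vec ℕ d) i → marks (i ∷ ρ) i ≡ put d true (marks ρ i)
  marks-hit ρ i rewrite dec-true (i ℕₚ.≟ i) refl = refl

  marks-miss : ∀ {d} (ρ : Vec ℕ d) {i j} → j ≢ i → marks (j ∷ ρ) i ≡ marks ρ i
  marks-miss ρ {i} {j} ne rewrite dec-false (j ℕₚ.≟ i) ne = refl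

  get-marks-weaken : ∀ {d} (ρ : Vec ℕ d) j {ℓ} i → ℓ ≢ d → get ℓ (marks (j ∷ ρ) i) ≡ get ℓ (marks ρ i)
  get-marks-weaken {d} ρ j {ℓ} i ne with j ℕₚ.≟ i
  ... | yes refl = trans (cong (get ℓ) (marks-hit ρ i)) (get-put-other ℓ d true (marks ρ i) ne)
  ... | no j≢i   = cong (get ℓ) (marks-miss ρ j≢i)

  -- Levels from d on belong to loops not yet entered. Hence the first mark met by `seek` is the
  -- right one, and erasing it restores the cell.
  get-marks-high : ∀ {d} (ρ : Vec ℕ d) {ℓ} i → d ≤ ℓ → get ℓ (marks ρ i) ≡ false
  get-marks-high []      {ℓ} i le = go K ℓ
    where
    go : ∀ K ℓ → get ℓ (Data.Vec.replicate K false) ≡ false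
    go zero    ℓ       = refl
    go (suc K) zero    = refl
    go (suc K) (suc ℓ) = go K ℓ
  get-marks-high (j ∷ ρ) i le =
    trans (get-marks-weaken ρ j i (ℕₚ.<⇒≢ le ∘ sym)) (get-marks-high ρ i (ℕₚ.<⇒≤ le))

  get-marks-hit : ∀ {d} (ρ : Vec ℕ d) p {i} → d ≤ K → lookup ρ p ≡ i →
    get (level p) (marks ρ i) ≡ true
  get-marks-hit {suc d} (j ∷ ρ) fz le refl =
    trans (cong (get d) (marks-hit ρ j)) (get-put true (marks ρ j) le)
  get-marks-hit (j ∷ ρ) (fs p) {i} le e =
    trans (get-marks-weaken ρ j i (ℕₚ.<⇒≢ (level<d p))) (get-marks-hit ρ p (ℕₚ.<⇒≤ le) e)

  get-marks-miss : ∀ {d} (ρ : Vec ℕ d) p {i} → lookup ρ p ≢ i → get (level p) (marks ρ i) ≡ false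
  get-marks-miss {suc d} (j ∷ ρ) fz {i} ne =
    trans (cong (get d) (marks-miss ρ ne)) (get-marks-high ρ i ℕₚ.≤-refl)
  get-marks-miss (j ∷ ρ) (fs p) {i} ne =
    trans (get-marks-weaken ρ j i (ℕₚ.<⇒≢ (level<d p))) (get-marks-miss ρ p ne)

  cells : ∀ {d} → Vec ℕ d → ℕ → List Ty → List Sy
  cells ρ i []       = []
  cells ρ i (t ∷ ts) = aux (cell t (marks ρ i)) ∷ cells ρ (suc i) ts

  cells-++ : ∀ {d} (ρ : Vec ℕ d) i ts ts′ → cells ρ i (ts ++ ts′) ≡ cells ρ i ts ++ cells ρ (i + length ts) ts′
  cells-++ ρ i []       ts′ = cong (λ i → cells ρ i ts′) (sym (ℕₚ.+-identityʳ i))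
  cells-++ ρ i (t ∷ ts) ts′ = cong (_ ∷_)
    (trans (cells-++ ρ (suc i) ts ts′)
           (cong (λ k → cells ρ (suc i) ts ++ cells ρ k ts′) (sym (ℕₚ.+-suc i (length ts)))))

  length-cells : ∀ {d} (ρ : Vec ℕ d) i ts → length (cells ρ i ts) ≡ length ts
  length-cells ρ i []       = refl
  length-cells ρ i (t ∷ ts) = cong suc (length-cells ρ (suc i) ts)

  cells-below : ∀ {d} (ρ : Vec ℕ d) i ts {j} → i + length ts ≤ j → cells (j ∷ ρ) i ts ≡ cells ρ i ts
  cells-below ρ i []       le = refl
  cells-below ρ i (t ∷ ts) le rewrite ℕₚ.+-suc i (length ts) =
    cong₂ _∷_ (cong (aux ∘ cell t) (marks-miss ρ (ℕₚ.<⇒≢ (ℕₚ.≤-trans (s≤s (ℕₚ.m≤m+n i (length ts))) le) ∘ sym)))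
              (cells-below ρ (suc i) ts le)

  cells-above : ∀ {d} (ρ : Vec ℕ d) i ts {j} → j < i → cells (j ∷ ρ) i ts ≡ cells ρ i ts
  cells-above ρ i []       lt = refl
  cells-above ρ i (t ∷ ts) lt =
    cong₂ _∷_ (cong (aux ∘ cell t) (marks-miss ρ (ℕₚ.<⇒≢ lt)))
              (cells-above ρ (suc i) ts (ℕₚ.m<n⇒m<1+n lt))

  cells-All : ∀ {d} (P : Sy → Set) (ρ : Vec ℕ d) i ts →
    (∀ t {j} → i ≤ j → j < i + length ts → P (aux (cell t (marks ρ j)))) → All P (cells ρ i ts)
  cells-All P ρ i []       h = []
  cells-All P ρ i (t ∷ ts) h = h t ℕₚ.≤-refl (ℕₚ.m<m+n i (s≤s z≤n)) ∷
    cells-All P ρ (suc i) ts λ t′ {j} le lt → h t′ (ℕₚ.<⇒≤ le) (subst (j <_) (sym (ℕₚ.+-suc i (length ts))) lt)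

cost : ℕ → ℕ → ∀ {d} → Cmd d → ℕ
cost N L skip         = 1
cost N L (emit b)     = L + L + 3
cost N L (c ⨾ c′)     = cost N L c + cost N L c′
cost N L (loop l c)   = 1 + (N * (cost N L c + (N + N + 4)) + (N + 2))
cost N L (bycell p c) =
  N + N + 3 + (cost N L (c (ty false)) + (cost N L (c (ty true)) + cost N L (c pad)))

cost-branch : ∀ N L {d} (c : Ty → Cmd d) t →
  cost N L (c t) ≤ cost N L (c (ty false)) + (cost N L (c (ty true)) + cost N L (c pad))
cost-branch N L c (ty false) = ℕₚ.m≤m+n _ _
cost-branch N L c (ty true)  = ℕₚ.≤-trans (ℕₚ.m≤m+n _ _) (ℕₚ.m≤n+m _ (cost N L (c (ty false))))
cost-branch N L c pad        =
  ℕₚ.≤-trans (ℕₚ.m≤n+m _ (cost N L (c (ty true)))) (ℕₚ.m≤n+m _ (cost N L (c (ty false))))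

split-at : ∀ {A : Set} a (xs : List A) {i} → i < length xs →
  ∃ λ ys → ∃ λ zs → xs ≡ ys ++ nth a xs i ∷ zs × length ys ≡ i
split-at a (x ∷ xs) {zero}  lt       = [] , xs , refl , refl
split-at a (x ∷ xs) {suc i} (s≤s lt) =
  let ys , zs , e , f = split-at a xs lt in x ∷ ys , zs , cong (x ∷_) e , cong suc f

-- Correctness and running time of compiled commands

module Correct (K : ℕ) (ts : List Ty) (L : ℕ) where
  open Compile K

  N : ℕ
  N = length ts

  home : ∀ {d} → Vec ℕ d → List Bool → Tape Aux
  home ρ o = cells ρ 0 ts ++ [ aux lend ] , aux hash , map bit o

  Does′ : ∀ {d} → Cmd d → Vec ℕ d → List Bool → Set
  Does′ c ρ o = Does (compile c) (cost N L c) (home ρ o) (home ρ (o ++ out ts c ρ))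

  emit-does : ∀ {d} b (ρ : Vec ℕ d) o → length o + 1 ≤ L → Does′ (emit b) ρ o
  emit-does b ρ o le = Run-weaken bound-le
    (next refl
      (Run-from (cong (focusʳ (aux hash ∷ l)) (Listₚ.++-identityʳ (map bit o)))
        (scanʳ (map bit o) {aux hash ∷ l} {[]} (bits o)
          (next refl (scanˡ-back (map bit o) {aux hash ∷ l} {[ bit b ]} (bits′ o)
            (exit refl (cong (λ r → l , aux hash , r) (sym (Listₚ.map-++ bit o [ b ])))))))))
    where
    δ = emitTable b
    l = cells ρ 0 ts ++ [ aux lend ]
    bits : ∀ o → All (λ s → δ fz s ≡ (just fz , s , right)) (map bit o)
    bits []      = []
    bits (_ ∷ o) = refl ∷ bits o
    bits′ : ∀ o → All (λ s → δ (fs fz) s ≡ (just (fs fz) , s , left)) (map bit o)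
    bits′ []      = []
    bits′ (_ ∷ o) = refl ∷ bits′ o
    len≤L : length (map bit o) ≤ L
    len≤L = ℕₚ.≤-trans (ℕₚ.≤-reflexive (Listₚ.length-map bit o)) (ℕₚ.≤-trans (ℕₚ.m≤m+n _ 1) le)
    arith : ∀ a → suc (a + (1 + (a + 1))) ≡ a + a + 3
    arith = solve-∀
    bound-le : suc (length (map bit o) + (1 + (length (map bit o) + 1))) ≤ L + L + 3
    bound-le = ℕₚ.≤-trans (ℕₚ.≤-reflexive (arith (length (map bit o))))
      (ℕₚ.+-monoˡ-≤ 3 (ℕₚ.+-mono-≤ len≤L len≤L))

  cells-split : ∀ {d} (ρ : Vec ℕ d) ts₁ ts₂ → ts ≡ ts₁ ++ ts₂ →
    cells ρ 0 ts₁ ++ (cells ρ (length ts₁) ts₂ ++ [ aux lend ]) ≡ cells ρ 0 ts ++ [ aux lend ]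
  cells-split ρ ts₁ ts₂ refl =
    trans (sym (Listₚ.++-assoc (cells ρ 0 ts₁) _ _)) (cong (_++ [ aux lend ]) (sym (cells-++ ρ 0 ts₁ ts₂)))

  cells-marked : ∀ {d} (ρ : Vec ℕ d) ts₁ t ts₂ → let i = length ts₁ in ts ≡ ts₁ ++ t ∷ ts₂ →
    cells ρ 0 ts₁ ++ (aux (cell t (put d true (marks ρ i))) ∷ cells ρ (suc i) ts₂ ++ [ aux lend ])
      ≡ cells (i ∷ ρ) 0 ts ++ [ aux lend ]
  cells-marked ρ ts₁ t ts₂ e = trans
    (cong₂ _++_ (sym (cells-below ρ 0 ts₁ ℕₚ.≤-refl))
      (cong₂ _∷_ (cong (aux ∘ cell t) (sym (marks-hit ρ (length ts₁))))
        (cong (_++ [ aux lend ]) (sym (cells-above ρ (suc (length ts₁)) ts₂ ℕₚ.≤-refl)))))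
    (cells-split (length ts₁ ∷ ρ) ts₁ (t ∷ ts₂) e)

  length-prefix : ∀ ts₁ ts₂ → ts ≡ ts₁ ++ ts₂ → length ts₁ ≤ N
  length-prefix ts₁ ts₂ refl rewrite Listₚ.length-++ ts₁ {ts₂} = ℕₚ.m≤m+n _ _

  bound≤N : ∀ {d} (l : Maybe (Fin d)) (ρ : Vec ℕ d) → (∀ p → lookup ρ p < N) → bound ts l ρ ≤ N
  bound≤N nothing  ρ active = ℕₚ.≤-refl
  bound≤N (just p) ρ active = ℕₚ.<⇒≤ (active p)

  stop-at : ∀ {d} (l : Maybe (Fin d)) (ρ : Vec ℕ d) → d ≤ K → ∀ ts₁ t ts₂ → ts ≡ ts₁ ++ t ∷ ts₂ →
    length ts₁ + 0 ≡ bound ts l ρ → stops (aux (cell t (marks ρ (length ts₁)))) l ≡ true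
  stop-at (just p) ρ d≤K ts₁ t ts₂ e f = get-marks-hit ρ p d≤K (trans (sym f) (ℕₚ.+-identityʳ _))
  stop-at nothing  ρ d≤K ts₁ t ts₂ e f = ⊥-elim (ℕₚ.m≢1+m+n (length ts₁) (trans (sym (ℕₚ.+-identityʳ _))
    (trans f (trans (cong length e) (trans (Listₚ.length-++ ts₁) (ℕₚ.+-suc (length ts₁) (length ts₂)))))))

  go-at : ∀ {d} (l : Maybe (Fin d)) (ρ : Vec ℕ d) → ∀ (ts₁ : List Ty) t r → length ts₁ + suc r ≡ bound ts l ρ →
    stops (aux (cell t (marks ρ (length ts₁)))) l ≡ false
  go-at (just p) ρ ts₁ t r f = get-marks-miss ρ p λ e →
    ℕₚ.m≢1+m+n (length ts₁) (trans (sym e) (trans (sym f) (ℕₚ.+-suc _ r)))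
  go-at nothing  ρ ts₁ t r f = refl

  module _ {d} (l : Maybe (Fin d)) (c : Cmd (suc d)) (ρ : Vec ℕ d)
           (d<K : d < K) (active : ∀ p → lookup ρ p < N)
           (body : ∀ j o → j < N → length o + length (out ts c (j ∷ ρ)) ≤ L → Does′ c (j ∷ ρ) o)
    where

    private
      B = compile c
      δ = loopTable l B
      F : ℕ → List Bool
      F j = out ts c (j ∷ ρ)

    iteration : ℕ
    iteration = cost N L c + (N + N + 4)

    view : List Ty → List Ty → List Bool → Tape Aux
    view ts₁ ts₂ o =
      focusˡ (cells ρ (length ts₁) ts₂ ++ [ aux lend ]) (cells ρ 0 ts₁ ʳ++ (aux hash ∷ map bit o))

    carry-pass : ∀ {d′} (ρ : Vec ℕ d′) us → All (λ s → δ carry s ≡ (just carry , s , right)) (cells ρ 0 us)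
    carry-pass ρ us = cells-All _ ρ 0 us λ _ _ _ → refl

    return-pass : ∀ {d′} (ρ : Vec ℕ d′) us → All (λ s → δ return s ≡ (just return , s , right)) (cells ρ 0 us)
    return-pass ρ us = cells-All _ ρ 0 us λ _ _ _ → refl

    seek-unmarked : ∀ s → hasMark d s ≡ false → δ seek s ≡ (just seek , s , left)
    seek-unmarked s e rewrite e = refl

    seek-marked : ∀ t v → get d v ≡ true →
      δ seek (aux (cell t v)) ≡ (just arrive , aux (cell t (put d false v)) , left)
    seek-marked t v e rewrite e = refl

    arrive-stop : ∀ s → stops s l ≡ true → δ arrive s ≡ (just return , s , right)
    arrive-stop s e rewrite e = refl

    arrive-go : ∀ s → stops s l ≡ false → δ arrive s ≡ (just carry , setMark d true s , right)
    arrive-go s e rewrite e = refl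

    finish : ∀ ts₁ ts₂ o s us → ts ≡ ts₁ ++ ts₂ → stops s l ≡ true →
      cells ρ (length ts₁) ts₂ ++ [ aux lend ] ≡ s ∷ us →
      Run δ (N + 2) arrive (us , s , cells ρ 0 ts₁ ʳ++ (aux hash ∷ map bit o)) (home ρ o)
    finish ts₁ ts₂ o s us e st f = Run-weaken le
      (next (arrive-stop s st)
        (scanʳ-back (cells ρ 0 ts₁) {s ∷ us} {aux hash ∷ map bit o} (return-pass ρ ts₁)
          (exit refl (cong (λ l → l , aux hash , map bit o)
            (trans (cong (cells ρ 0 ts₁ ++_) (sym f)) (cells-split ρ ts₁ ts₂ e))))))
      where
      le : suc (length (cells ρ 0 ts₁) + 1) ≤ N + 2
      le rewrite length-cells ρ 0 ts₁ | sym (ℕₚ.+-suc (length ts₁) 1) =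
        ℕₚ.+-monoˡ-≤ 2 (length-prefix ts₁ ts₂ e)

    iterate : ∀ ts₁ ts₂ r o → ts ≡ ts₁ ++ ts₂ → length ts₁ + r ≡ bound ts l ρ →
      length o + length (collect F (length ts₁) r) ≤ L →
      Run δ (r * iteration + (N + 2)) arrive (view ts₁ ts₂ o) (home ρ (o ++ collect F (length ts₁) r))
    iterate ts₁ [] zero o e f le rewrite Listₚ.++-identityʳ o =
      finish ts₁ [] o (aux lend) [] e refl refl
    iterate ts₁ (t ∷ ts₂) zero o e f le rewrite Listₚ.++-identityʳ o =
      finish ts₁ (t ∷ ts₂) o _ _ e (stop-at l ρ (ℕₚ.<⇒≤ d<K) ts₁ t ts₂ e f) refl
    -- No round can be left once all cells are visited, because the bound of a loop is at most N.
    iterate ts₁ [] (suc r) o e f le = ⊥-elim (ℕₚ.<⇒≱ {length ts₁} {length ts₁ + suc r}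
      (ℕₚ.m<m+n _ (s≤s z≤n))
      (ℕₚ.≤-trans (ℕₚ.≤-reflexive f) (ℕₚ.≤-trans (bound≤N l ρ active)
        (ℕₚ.≤-reflexive (trans (cong length e) (cong length (Listₚ.++-identityʳ ts₁)))))))
    iterate ts₁ (t ∷ ts₂) (suc r) o e f le =
      subst (λ z → Run δ (suc r * iteration + (N + 2)) arrive (view ts₁ (t ∷ ts₂) o) (home ρ z))
        (Listₚ.++-assoc o (F i) (collect F (suc i) r))
        (Run-weaken time
          (next (arrive-go (aux (cell t (marks ρ i))) (go-at l ρ ts₁ t r f))
            (scanʳ-back (cells ρ 0 ts₁) {mk ∷ rest} {aux hash ∷ map bit o} (carry-pass ρ ts₁)
              (next refl
                (Run-from (cong (λ lft → lft , aux hash , map bit o) (sym (cells-marked ρ ts₁ t ts₂ e)))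
                  (Run-then inj₂ seek (λ _ _ → refl) (body i o i<N le₁) back))))))
      where
      i = length ts₁
      o′ = o ++ F i
      mk : Sy
      mk = aux (cell t (put d true (marks ρ i)))
      rest = cells ρ (suc i) ts₂ ++ [ aux lend ]
      i<N : i < N
      i<N = subst (i <_) (sym (trans (cong length e) (Listₚ.length-++ ts₁))) (ℕₚ.m<m+n i (s≤s z≤n))
      le₁ : length o + length (F i) ≤ L
      le₁ = ℕₚ.≤-trans (ℕₚ.+-monoʳ-≤ (length o)
        (ℕₚ.≤-trans (ℕₚ.m≤m+n _ _) (ℕₚ.≤-reflexive (sym (Listₚ.length-++ (F i)))))) le
      le₂ : length o′ + length (collect F (suc i) r) ≤ L
      le₂ = ℕₚ.≤-trans (ℕₚ.≤-reflexive (trans (cong (_+ length (collect F (suc i) r)) (Listₚ.length-++ o))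
        (trans (ℕₚ.+-assoc (length o) (length (F i)) (length (collect F (suc i) r)))
          (cong (length o +_) (sym (Listₚ.length-++ (F i))))))) le
      e′ : ts ≡ (ts₁ ++ [ t ]) ++ ts₂
      e′ = trans e (sym (Listₚ.++-assoc ts₁ [ t ] ts₂))
      leneq : length (ts₁ ++ [ t ]) ≡ suc i
      leneq = trans (Listₚ.length-++ ts₁) (ℕₚ.+-comm i 1)
      later : Run δ (r * iteration + (N + 2)) arrive (view (ts₁ ++ [ t ]) ts₂ o′) (home ρ (o′ ++ collect F (suc i) r))
      later = subst (λ k → Run δ (r * iteration + (N + 2)) arrive (view (ts₁ ++ [ t ]) ts₂ o′) (home ρ (o′ ++ collect F k r))) leneq
        (iterate (ts₁ ++ [ t ]) ts₂ r o′ e′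
          (trans (cong (_+ r) leneq) (trans (sym (ℕₚ.+-suc i r)) f))
          (subst (λ k → length o′ + length (collect F k r) ≤ L) (sym leneq) le₂))
      view-eq : focusˡ rest (aux (cell t (marks ρ i)) ∷ (cells ρ 0 ts₁ ʳ++ (aux hash ∷ map bit o′)))
                  ≡ view (ts₁ ++ [ t ]) ts₂ o′
      view-eq = cong₂ focusˡ
        (cong (λ k → cells ρ k ts₂ ++ [ aux lend ]) (sym leneq))
        (sym (trans (cong (_ʳ++ (aux hash ∷ map bit o′)) (cells-++ ρ 0 ts₁ [ t ])) (Listₚ.++-ʳ++ (cells ρ 0 ts₁))))
      marked : get d (put d true (marks ρ i)) ≡ true
      marked = get-put true (marks ρ i) d<K
      after-seek : δ seek mk ≡ (just arrive , aux (cell t (marks ρ i)) , left)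
      after-seek = trans (seek-marked t _ marked)
        (cong (λ v → just arrive , aux (cell t v) , left)
          (put-put d true (marks ρ i) (get-marks-high ρ i ℕₚ.≤-refl)))
      back : Run δ (length (aux hash ∷ cells ρ 0 ts₁) + (1 + (r * iteration + (N + 2)))) seek
               (home (i ∷ ρ) o′) (home ρ (o′ ++ collect F (suc i) r))
      back = Run-from (cong (λ lft → lft , aux hash , map bit o′) (cells-marked ρ ts₁ t ts₂ e))
        (scanˡ (aux hash ∷ cells ρ 0 ts₁) {mk ∷ rest} {map bit o′}
          (refl ∷ cells-All _ ρ 0 ts₁ λ t′ {j} _ _ → seek-unmarked _ (get-marks-high ρ j ℕₚ.≤-refl))
          (next after-seek (Run-from (sym view-eq) later)))
      arith : ∀ a b x → suc (a + suc (b + (suc a + (1 + x)))) ≡ (b + (a + a + 4)) + x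
      arith = solve-∀
      time : suc (length (cells ρ 0 ts₁) + suc (cost N L c + (length (aux hash ∷ cells ρ 0 ts₁) + (1 + (r * iteration + (N + 2))))))
               ≤ suc r * iteration + (N + 2)
      time rewrite length-cells ρ 0 ts₁ | arith i (cost N L c) (r * iteration + (N + 2))
                 | ℕₚ.+-assoc iteration (r * iteration) (N + 2) =
        ℕₚ.+-monoˡ-≤ (r * iteration + (N + 2)) (ℕₚ.+-monoʳ-≤ (cost N L c)
          (ℕₚ.+-monoˡ-≤ 4 (ℕₚ.+-mono-≤ (ℕₚ.<⇒≤ i<N) (ℕₚ.<⇒≤ i<N))))

    loop-does : ∀ o → length o + length (out ts (loop l c) ρ) ≤ L → Does′ (loop l c) ρ o
    loop-does o le = next refl (Run-weaken
      (ℕₚ.+-monoˡ-≤ (N + 2) (ℕₚ.*-monoˡ-≤ iteration (bound≤N l ρ active)))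
      (iterate [] ts (bound ts l ρ) o refl refl le))

  module _ {d} (p : Fin d) (c : Ty → Cmd d) (ρ : Vec ℕ d) (d≤K : d ≤ K) (p<N : lookup ρ p < N) where

    private
      B : Ty → Machine Aux
      B t = compile (c t)
      δ = caseTable p B
      i = lookup ρ p
      t = nth pad ts i

    look-pass : ∀ t v → get (level p) v ≡ false →
      δ (inj₁ nothing) (aux (cell t v)) ≡ (just (inj₁ nothing) , aux (cell t v) , left)
    look-pass t v e rewrite e = refl

    look-stop : ∀ t v → get (level p) v ≡ true →
      δ (inj₁ nothing) (aux (cell t v)) ≡ (just (inj₁ (just t)) , aux (cell t v) , right)
    look-stop t v e rewrite e = refl

    branch-embed : ∀ t q s → δ (inj₂ (branch B t q)) s
      ≡ map₁ (redirect (inj₂ ∘ branch B t) nothing) (table (B t) q s)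
    branch-embed t q s rewrite unbranch-branch B t q = refl

    bycell-does : ∀ o → Does′ (c t) ρ o → Does′ (bycell p c) ρ o
    bycell-does o R with split-at pad ts p<N
    ... | ts₁ , ts₂ , e , f = Run-weaken time
      (Run-from (cong (λ lft → lft , aux hash , map bit o) (cells-split ρ ts₁ (t ∷ ts₂) e))
        (scanˡ (aux hash ∷ cells ρ 0 ts₁) {_} {map bit o}
          (refl ∷ cells-All _ ρ 0 ts₁ λ t′ {j} _ j<i → look-pass t′ _
            (get-marks-miss ρ p (λ e′ → ℕₚ.<⇒≢ (subst (j <_) f j<i) (sym e′))))
          (next (look-stop t _ (get-marks-hit ρ p d≤K (sym f)))
            (scanʳ-back (cells ρ 0 ts₁) {_} {aux hash ∷ map bit o}
              (cells-All _ ρ 0 ts₁ λ _ _ _ → refl)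
              (next refl
                (Run-from (cong (λ lft → lft , aux hash , map bit o) (sym (cells-split ρ ts₁ (t ∷ ts₂) e)))
                  (Run-embed (inj₂ ∘ branch B t) (branch-embed t) R)))))))
      where
      arith : ∀ a b → suc (a + suc (a + suc b)) ≡ a + a + 3 + b
      arith = solve-∀
      i≤N : length ts₁ ≤ N
      i≤N = length-prefix ts₁ _ e
      time : suc (length (cells ρ 0 ts₁) + suc (length (cells ρ 0 ts₁) + suc (cost N L (c t)))) ≤ cost N L (bycell p c)
      time rewrite length-cells ρ 0 ts₁ | arith (length ts₁) (cost N L (c t)) =
        ℕₚ.+-mono-≤ (ℕₚ.+-monoˡ-≤ 3 (ℕₚ.+-mono-≤ i≤N i≤N)) (cost-branch N L c t)

  cmd-does : ∀ {d} (c : Cmd d) (ρ : Vec ℕ d) o → d ≤ K → Fits K c → (∀ p → lookup ρ p < N) →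
    length o + length (out ts c ρ) ≤ L → Does′ c ρ o
  cmd-does skip ρ o d≤K fit act le rewrite Listₚ.++-identityʳ o = exit refl refl
  cmd-does (emit b) ρ o d≤K fit act le = emit-does b ρ o le
  cmd-does (c ⨾ c′) ρ o d≤K (fit , fit′) act le =
    subst (λ z → Does (compile (c ⨾ c′)) _ (home ρ o) (home ρ z)) (Listₚ.++-assoc o (out ts c ρ) (out ts c′ ρ))
      (seqM-does (compile c) (compile c′)
        (cmd-does c ρ o d≤K fit act (ℕₚ.≤-trans (ℕₚ.+-monoʳ-≤ (length o) (ℕₚ.m≤m+n _ _)) le′))
        (cmd-does c′ ρ (o ++ out ts c ρ) d≤K fit′ act
          (ℕₚ.≤-trans (ℕₚ.≤-reflexive (trans (cong (_+ _) (Listₚ.length-++ o)) (ℕₚ.+-assoc (length o) _ _))) le′)))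
    where
    le′ : length o + (length (out ts c ρ) + length (out ts c′ ρ)) ≤ L
    le′ = subst (λ k → length o + k ≤ L) (Listₚ.length-++ (out ts c ρ)) le
  cmd-does (loop l c) ρ o d≤K (d<K , fit) act le =
    loop-does l c ρ d<K act
      (λ j o′ j<N → cmd-does c (j ∷ ρ) o′ d<K fit λ { fz → j<N ; (fs p) → act p }) o le
  cmd-does (bycell p c) ρ o d≤K fit act le =
    bycell-does p c ρ d≤K (act p) o (cmd-does (c _) ρ o d≤K (fit _) act le)

-- Polynomial bounds

Polynomial : (ℕ → ℕ) → Set
Polynomial F = ∃ λ k → ∀ N → 2 ≤ N → F N ≤ N ^ k

n≤2^n : ∀ n → n ≤ 2 ^ n
n≤2^n zero    = z≤n
n≤2^n (suc n) = ℕₚ.+-mono-≤ {1} {2 ^ n} (ℕₚ.m^n>0 2 n) (ℕₚ.≤-trans (n≤2^n n) (ℕₚ.m≤m+n _ 0))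

module _ {N : ℕ} (2≤N : 2 ≤ N) where

  N≢0 : Data.Nat.NonZero N
  N≢0 = Data.Nat.>-nonZero (ℕₚ.<-trans (s≤s z≤n) 2≤N)

  pow-mono : ∀ {a b} → a ≤ b → N ^ a ≤ N ^ b
  pow-mono = ℕₚ.^-monoʳ-≤ N {{N≢0}}

  pow-double : ∀ k → N ^ k + N ^ k ≤ N ^ suc k
  pow-double k = ℕₚ.≤-trans (ℕₚ.≤-reflexive (cong (N ^ k +_) (sym (ℕₚ.+-identityʳ (N ^ k)))))
    (ℕₚ.*-monoˡ-≤ (N ^ k) 2≤N)

-- With N ≥ 2 a constant is absorbed as c ≤ 2^c ≤ N^c, and a sum by one more factor N. A bare power,
-- as in the time bound of `PolyTimeComputable`, is therefore enough.
poly-const : ∀ c → Polynomial (λ _ → c)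
poly-const c = c , λ N 2≤N → ℕₚ.≤-trans (n≤2^n c) (ℕₚ.^-monoˡ-≤ c 2≤N)

poly-id : Polynomial (λ N → N)
poly-id = 1 , λ N _ → ℕₚ.≤-reflexive (sym (ℕₚ.*-identityʳ N))

poly-+ : ∀ {F G} → Polynomial F → Polynomial G → Polynomial (λ N → F N + G N)
poly-+ (k , f) (l , g) = suc (k + l) , λ N 2≤N → ℕₚ.≤-trans
  (ℕₚ.+-mono-≤ (ℕₚ.≤-trans (f N 2≤N) (pow-mono 2≤N (ℕₚ.m≤m+n k l)))
               (ℕₚ.≤-trans (g N 2≤N) (pow-mono 2≤N (ℕₚ.m≤n+m l k))))
  (pow-double 2≤N (k + l))

poly-* : ∀ {F G} → Polynomial F → Polynomial G → Polynomial (λ N → F N * G N)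
poly-* (k , f) (l , g) = k + l , λ N 2≤N → ℕₚ.≤-trans (ℕₚ.*-mono-≤ (f N 2≤N) (g N 2≤N))
  (ℕₚ.≤-reflexive (sym (ℕₚ.^-distribˡ-+-* N k l)))

-- Adding up the three branches instead of taking their maximum keeps the bound within sums and
-- products of polynomials.
outLength : ℕ → ∀ {d} → Cmd d → ℕ
outLength N skip         = 0
outLength N (emit b)     = 1
outLength N (c ⨾ c′)     = outLength N c + outLength N c′
outLength N (loop l c)   = N * outLength N c
outLength N (bycell p c) = outLength N (c (ty false)) + (outLength N (c (ty true)) + outLength N (c pad))

length-collect : ∀ {A : Set} (F : ℕ → List A) b i r →
  (∀ j → j < i + r → length (F j) ≤ b) → length (collect F i r) ≤ r * b
length-collect F b i zero    h = z≤n
length-collect F b i (suc r) h = ℕₚ.≤-trans (ℕₚ.≤-reflexive (Listₚ.length-++ (F i)))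
  (ℕₚ.+-mono-≤ (h i (ℕₚ.m<m+n i (s≤s z≤n)))
    (length-collect F b (suc i) r λ j lt → h j (subst (j <_) (sym (ℕₚ.+-suc i r)) lt)))

length-out : ∀ ts {d} (c : Cmd d) (ρ : Vec ℕ d) → (∀ p → lookup ρ p < length ts) →
  length (out ts c ρ) ≤ outLength (length ts) c
length-out ts skip       ρ act = z≤n
length-out ts (emit b)   ρ act = ℕₚ.≤-refl
length-out ts (c ⨾ c′)   ρ act = ℕₚ.≤-trans (ℕₚ.≤-reflexive (Listₚ.length-++ (out ts c ρ)))
  (ℕₚ.+-mono-≤ (length-out ts c ρ act) (length-out ts c′ ρ act))
length-out ts (loop l c) ρ act = ℕₚ.≤-trans
  (length-collect _ (outLength (length ts) c) 0 (bound ts l ρ) λ j j<b → length-out ts c (j ∷ ρ)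
    λ { fz → ℕₚ.<-≤-trans j<b le ; (fs p) → act p })
  (ℕₚ.*-monoˡ-≤ (outLength (length ts) c) le)
  where
  le : bound ts l ρ ≤ length ts
  le = Correct.bound≤N 0 ts 0 l ρ act
length-out ts (bycell p c) ρ act = ℕₚ.≤-trans (length-out ts (c _) ρ act) (go (nth pad ts (lookup ρ p)))
  where
  ℓ : Ty → ℕ
  ℓ t = outLength (length ts) (c t)
  go : ∀ t → ℓ t ≤ ℓ (ty false) + (ℓ (ty true) + ℓ pad)
  go (ty false) = ℕₚ.m≤m+n _ _
  go (ty true)  = ℕₚ.≤-trans (ℕₚ.m≤m+n _ _) (ℕₚ.m≤n+m _ (ℓ (ty false)))
  go pad        = ℕₚ.≤-trans (ℕₚ.m≤n+m _ (ℓ (ty true))) (ℕₚ.m≤n+m _ (ℓ (ty false)))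

poly-outLength : ∀ {d} (c : Cmd d) → Polynomial (λ N → outLength N c)
poly-outLength skip         = poly-const 0
poly-outLength (emit b)     = poly-const 1
poly-outLength (c ⨾ c′)     = poly-+ (poly-outLength c) (poly-outLength c′)
poly-outLength (loop l c)   = poly-* poly-id (poly-outLength c)
poly-outLength (bycell p c) = poly-+ (poly-outLength (c (ty false)))
  (poly-+ (poly-outLength (c (ty true))) (poly-outLength (c pad)))

poly-cost : ∀ {L} → Polynomial L → ∀ {d} (c : Cmd d) → Polynomial (λ N → cost N (L N) c)
poly-cost PL skip       = poly-const 1
poly-cost PL (emit b)   = poly-+ (poly-+ PL PL) (poly-const 3)
poly-cost PL (c ⨾ c′)   = poly-+ (poly-cost PL c) (poly-cost PL c′)
poly-cost PL (loop l c) = poly-+ (poly-const 1) (poly-+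
  (poly-* poly-id (poly-+ (poly-cost PL c) (poly-+ (poly-+ poly-id poly-id) (poly-const 4))))
  (poly-+ poly-id (poly-const 2)))
poly-cost PL (bycell p c) = poly-+ (poly-+ (poly-+ poly-id poly-id) (poly-const 3))
  (poly-+ (poly-cost PL (c (ty false))) (poly-+ (poly-cost PL (c (ty true))) (poly-cost PL (c pad))))

-- Two cells of padding make the number of cells equal to 2 + n, the base N of the time bounds, so
-- that e nested full loops make exactly N^e rounds. The input is reversed because cells are listed
-- from `hash` leftwards.
workspace : List Bool → List Ty
workspace x = pad ∷ pad ∷ reverse (map ty x)

length-workspace : ∀ x → length (workspace x) ≡ 2 + length x
length-workspace x = cong (2 +_) (trans (Listₚ.length-reverse (map ty x)) (Listₚ.length-map ty x))

module Whole (c : Cmd 0) where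
  K = depth c
  open Compile K

  fresh : Ty → Sy
  fresh t = aux (cell t (marks [] 0))

  setupTable : Table Aux (Fin 5)
  setupTable fz                     s       = just (fs fz) , s , left
  setupTable (fs fz)                s       = just (fs (fs fz)) , aux lend , right
  setupTable (fs (fs fz))           (bit b) = just (fs (fs fz)) , fresh (ty b) , right
  setupTable (fs (fs fz))           s       = just (fs (fs (fs fz))) , fresh pad , right
  setupTable (fs (fs (fs fz)))      s       = just (fs (fs (fs (fs fz)))) , fresh pad , right
  setupTable (fs (fs (fs (fs fz)))) s       = nothing , aux hash , stay

  setupM : Machine Aux
  setupM .State  = Fin 5
  setupM .finite = finite-Fin 5
  setupM .entry  = fz
  setupM .table  = setupTable

  -- Output is read from the head onwards, so the head must finally leave `hash` for the first
  -- output symbol.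
  haltM : Machine Aux
  haltM .State     = Fin 1
  haltM .finite    = finite-Fin 1
  haltM .entry     = fz
  haltM .table q s = nothing , s , right

  whole : Machine Aux
  whole = seqM setupM (seqM (compile c) haltM)

  cells-fresh : ∀ i ts → cells [] i ts ≡ map fresh ts
  cells-fresh i []       = refl
  cells-fresh i (t ∷ ts) = cong (fresh t ∷_) (cells-fresh (suc i) ts)

  convert : ∀ x l {tp} n → Run setupTable n (fs (fs fz)) (focusʳ (map (fresh ∘ ty) x ʳ++ l) []) tp →
    Run setupTable (length x + n) (fs (fs fz)) (focusʳ l (map bit x)) tp
  convert []      l n R = R
  convert (b ∷ x) l n R = next refl (convert x (fresh (ty b) ∷ l) n R)

  setup-does : ∀ x L → Does setupM (2 + (length x + 3)) (focusʳ [] (map bit x)) (Correct.home K (workspace x) L [] [])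
  setup-does x L = start x (convert x [ aux lend ] 3
    (next refl (next refl (exit refl (cong (λ l → fresh pad ∷ fresh pad ∷ l , aux hash , []) tape)))))
    where
    start : ∀ x {n tp} → Run setupTable n (fs (fs fz)) (focusʳ [ aux lend ] (map bit x)) tp →
      Run setupTable (2 + n) fz (focusʳ [] (map bit x)) tp
    start []      R = next refl (next refl R)
    start (b ∷ x) R = next refl (next refl R)
    tape : map (fresh ∘ ty) x ʳ++ [ aux lend ] ≡ cells [] 2 (reverse (map ty x)) ++ [ aux lend ]
    tape = begin
      map (fresh ∘ ty) x ʳ++ [ aux lend ]             ≡⟨ Listₚ.ʳ++-defn (map (fresh ∘ ty) x) ⟩
      reverse (map (fresh ∘ ty) x) ++ [ aux lend ]    ≡⟨ cong (λ z → reverse z ++ [ aux lend ]) (Listₚ.map-∘ x) ⟩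
      reverse (map fresh (map ty x)) ++ [ aux lend ]  ≡⟨ cong (_++ [ aux lend ]) (Listₚ.reverse-map fresh (map ty x)) ⟨
      map fresh (reverse (map ty x)) ++ [ aux lend ]  ≡⟨ cong (_++ [ aux lend ]) (cells-fresh 2 (reverse (map ty x))) ⟨
      cells [] 2 (reverse (map ty x)) ++ [ aux lend ] ∎
      where open ≡-Reasoning

  time : ℕ → ℕ
  time N = (N + 3) + (cost N (outLength N c) c + 1)

  poly-whole : Polynomial time
  poly-whole = poly-+ (poly-+ poly-id (poly-const 3)) (poly-+ (poly-cost (poly-outLength c) c) (poly-const 1))

  whole-does : ∀ x → ∃ λ l → Does whole (time (2 + length x)) (focusʳ [] (map bit x))
    (focusʳ l (map bit (out (workspace x) c [])))
  whole-does x = _ , seqM-does setupM (seqM (compile c) haltM) (setup-does x L)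
    (seqM-does (compile c) haltM
      (subst (λ N → Does (compile c) (cost N L c) (C.home [] []) (C.home [] (out (workspace x) c []))) (length-workspace x)
        (C.cmd-does c [] [] z≤n (depth-fits c ℕₚ.≤-refl) (λ ())
          (subst (λ N → length (out (workspace x) c []) ≤ outLength N c) (length-workspace x)
            (length-out (workspace x) c [] (λ ())))))
      (exit refl refl))
    where
    L = outLength (2 + length x) c
    module C = Correct K (workspace x) L

  cmd-poly-time : PolyTimeComputable (λ x → out (workspace x) c [])
  cmd-poly-time = Realise.poly-time finite-Aux whole (λ x → out (workspace x) c []) (proj₁ poly-whole)
    λ x → let l , R = whole-does x in
      l , Run-weaken (proj₂ poly-whole (2 + length x) (s≤s (s≤s z≤n))) R

-- Emitting formula sets

fromDigits : List Bool → ℕᵇ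
fromDigits []           = zeroᵇ
fromDigits (true ∷ ds)  = 2[1+ fromDigits ds ]
fromDigits (false ∷ ds) = 1+[2 fromDigits ds ]

digits-fromDigits : ∀ ds → digitsᵇ (fromDigits ds) ≡ ds
digits-fromDigits []           = refl
digits-fromDigits (true ∷ ds)  = cong (true ∷_) (digits-fromDigits ds)
digits-fromDigits (false ∷ ds) = cong (false ∷_) (digits-fromDigits ds)

number : List Bool → ℕ
number ds = fromℕᵇ (fromDigits ds)

digits-number : ∀ ds → digitsᵇ (toℕᵇ (number ds)) ≡ ds
digits-number ds = trans (cong digitsᵇ (ℕᵇₚ.fromℕ-toℕ (fromDigits ds))) (digits-fromDigits ds)

spread : List Bool → List Bool
spread = concatMap (λ b → true ∷ b ∷ [])

end : List Bool
end = false ∷ false ∷ []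

encNat-number : ∀ ds → encNat (number ds) ≡ spread ds ++ end
encNat-number ds = cong (λ z → spread z ++ end) (digits-number ds)

-- In bijective base 2, least significant digit first, a digits 1 denote 2^a - 1, and the digit 2
-- before them yields 2 · (1 + (2^a - 1)). Exponentially large subscripts thus have digit strings
-- that a loop can print.
number-2^ : ∀ a → number (true ∷ replicate a false) ≡ 2 ^ suc a
number-2^ a = cong (2 *_) (go a)
  where
  go : ∀ a → suc (number (replicate a false)) ≡ 2 ^ a
  go zero    = refl
  go (suc a) = trans (arith (number (replicate a false))) (cong (2 *_) (go a))
    where
    arith : ∀ y → suc (suc (2 * y)) ≡ 2 * suc y
    arith = solve-∀

-- The digit string is the kind in unary, a separator and the index in unary. Unary parts can be
-- printed by loops, and the first digit `false` shows where the kind ends.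
name : ℕ → ℕ → ℕ
name κ i = number (replicate κ true ++ false ∷ replicate i false)

name-injective : ∀ κ i κ′ i′ → name κ i ≡ name κ′ i′ → κ ≡ κ′ × i ≡ i′
name-injective κ i κ′ i′ e =
  go κ κ′ (trans (sym (digits-number _)) (trans (cong (digitsᵇ ∘ toℕᵇ) e) (digits-number _)))
  where
  go : ∀ κ κ′ → replicate κ true ++ false ∷ replicate i false ≡ replicate κ′ true ++ false ∷ replicate i′ false →
    κ ≡ κ′ × i ≡ i′
  go zero    zero     e = refl , trans (sym (Listₚ.length-replicate i))
    (trans (cong length (Listₚ.∷-injectiveʳ e)) (Listₚ.length-replicate i′))
  go (suc κ) (suc κ′) e = map₁ (cong suc) (go κ κ′ (Listₚ.∷-injectiveʳ e))

rep : ℕ → List Bool → List Bool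
rep zero    w = []
rep (suc n) w = w ++ rep n w

rep-+ : ∀ m n w → rep m w ++ rep n w ≡ rep (m + n) w
rep-+ zero    n w = refl
rep-+ (suc m) n w = trans (Listₚ.++-assoc w (rep m w) (rep n w)) (cong (w ++_) (rep-+ m n w))

spread-++ : ∀ ds ds′ → spread (ds ++ ds′) ≡ spread ds ++ spread ds′
spread-++ = Listₚ.concatMap-++ (λ b → true ∷ b ∷ [])

spread-replicate : ∀ n b → spread (replicate n b) ≡ rep n (true ∷ b ∷ [])
spread-replicate zero    b = refl
spread-replicate (suc n) b = cong (λ z → true ∷ b ∷ z) (spread-replicate n b)

-- The parts of a formula set that vary with the input: an index is a constant,
-- an offset from the current loop index or from N ^ e, and a quantifier
-- subscript is a constant or 2 ^ (1 + c + N ^ e₁ + ... + N ^ eₙ).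

data Ix : Set where
  abs cur : ℕ → Ix
  pow     : ℕ → ℕ → Ix

data Subscript : Set where
  lit : ℕ → Subscript
  big : ℕ → List ℕ → Subscript

Name : Set
Name = ℕ × Ix

data Formula : Set where
  pos  : Cmp → Subscript → Name → Name → Formula
  neg  : Cmp → Subscript → Name → Name → Formula
  nest : Cmp → Subscript → Name → Cmp → Subscript → Name → Name → Formula

module _ (N i : ℕ) where

  evalIx : Ix → ℕ
  evalIx (abs c)   = c
  evalIx (cur c)   = c + i
  evalIx (pow e c) = c + N ^ e

  powers : List ℕ → ℕ
  powers []       = 0
  powers (e ∷ es) = N ^ e + powers es

  evalSubscript : Subscript → ℕ
  evalSubscript (lit c)    = c
  evalSubscript (big c es) = number (true ∷ replicate (c + powers es) false)

  evalName : Name → ℕ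
  evalName (κ , ix) = name κ (evalIx ix)

  eval : Formula → N2
  eval (pos ⋈ C p q)         = cntPos ⋈ (evalSubscript C) (evalName p) (evalName q)
  eval (neg ⋈ C p q)         = cntNeg ⋈ (evalSubscript C) (evalName p) (evalName q)
  eval (nest ⋈ C p ⋈′ D q r) =
    cntNest ⋈ (evalSubscript C) (evalName p) ⋈′ (evalSubscript D) (evalName q) (evalName r)

emits : ∀ {d} → List Bool → Cmd d
emits []      = skip
emits (b ∷ w) = emit b ⨾ emits w

emits-power : ∀ {d} → ℕ → List Bool → Cmd d
emits-power zero    w = emits w
emits-power (suc e) w = loop nothing (emits-power e w)

emits-powers : ∀ {d} → List ℕ → List Bool → Cmd d
emits-powers []       w = skip
emits-powers (e ∷ es) w = emits-power e w ⨾ emits-powers es w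

-- Prints in unary the number whose base-N digits are the indices of the loops `ps`, least
-- significant first: a loop at index j, with weight N^e, contributes j · N^e copies of `w`.
emits-rank : ∀ {d} → List (Fin d) → ℕ → List Bool → Cmd d
emits-rank []       e w = skip
emits-rank (p ∷ ps) e w = emits-rank ps (suc e) w ⨾ loop (just p) (emits-power e w)

module _ {d} (ps : List (Fin d)) where

  emits-ix : Ix → List Bool → Cmd d
  emits-ix (abs c)   w = emits (rep c w)
  emits-ix (cur c)   w = emits (rep c w) ⨾ emits-rank ps 0 w
  emits-ix (pow e c) w = emits (rep c w) ⨾ emits-power e w

  emits-name : Name → Cmd d
  emits-name (κ , ix) =
    emits (spread (replicate κ true) ++ true ∷ false ∷ []) ⨾ emits-ix ix (true ∷ false ∷ []) ⨾ emits end

  emits-subscript : Subscript → Cmd d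
  emits-subscript (lit c)    = emits (encNat c)
  emits-subscript (big c es) =
    emits (true ∷ true ∷ rep c (true ∷ false ∷ [])) ⨾ emits-powers es (true ∷ false ∷ []) ⨾ emits end

  emits-formula : Formula → Cmd d
  emits-formula (pos ⋈ C p q) =
    emits (encNat 0) ⨾ emits (encCmp ⋈) ⨾ emits-subscript C ⨾ emits-name p ⨾ emits-name q
  emits-formula (neg ⋈ C p q) =
    emits (encNat 1) ⨾ emits (encCmp ⋈) ⨾ emits-subscript C ⨾ emits-name p ⨾ emits-name q
  emits-formula (nest ⋈ C p ⋈′ D q r) =
    emits (encNat 2) ⨾ emits (encCmp ⋈) ⨾ emits-subscript C ⨾ emits-name p ⨾
    emits (encCmp ⋈′) ⨾ emits-subscript D ⨾ emits-name q ⨾ emits-name r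

  emits-formulas : List Formula → Cmd d
  emits-formulas []      = skip
  emits-formulas (φ ∷ Φ) = emits-formula φ ⨾ emits-formulas Φ

collect-rep : ∀ a w i r → collect (λ _ → rep a w) i r ≡ rep (r * a) w
collect-rep a w i zero    = refl
collect-rep a w i (suc r) = trans (cong (rep a w ++_) (collect-rep a w (suc i) r)) (rep-+ a (r * a) w)

collect-cong : ∀ {A : Set} {F G : ℕ → List A} → (∀ j → F j ≡ G j) → ∀ i r → collect F i r ≡ collect G i r
collect-cong h i zero    = refl
collect-cong h i (suc r) = cong₂ _++_ (h i) (collect-cong h (suc i) r)

collect-+ : ∀ {A : Set} (F : ℕ → List A) i a b → collect F i (a + b) ≡ collect F i a ++ collect F (i + a) b
collect-+ F i zero    b = cong (λ k → collect F k b) (sym (ℕₚ.+-identityʳ i))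
collect-+ F i (suc a) b = trans (cong (F i ++_) (collect-+ F (suc i) a b))
  (trans (sym (Listₚ.++-assoc (F i) _ _))
         (cong (λ k → (F i ++ collect F (suc i) a) ++ collect F k b) (sym (ℕₚ.+-suc i a))))

-- Each block of P values continues where the previous one stops, so a loop over r blocks is one
-- loop over r · P values; `a` accounts for the digits of the loops further out.
collect-* : ∀ {A : Set} (F : ℕ → List A) P a i r →
  collect (λ j → collect F ((a + j) * P) P) i r ≡ collect F ((a + i) * P) (r * P)
collect-* F P a i zero    = refl
collect-* F P a i (suc r) = trans
  (cong (collect F ((a + i) * P) P ++_)
    (trans (collect-* F P a (suc i) r) (cong (λ k → collect F k (r * P)) (arith a i P))))
  (sym (collect-+ F ((a + i) * P) P (r * P)))
  where
  arith : ∀ a i P → (a + suc i) * P ≡ (a + i) * P + P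
  arith = solve-∀

module _ (ts : List Ty) where

  private
    N = length ts

  out-emits : ∀ {d} w (ρ : Vec ℕ d) → out ts (emits w) ρ ≡ w
  out-emits []      ρ = refl
  out-emits (b ∷ w) ρ = cong (b ∷_) (out-emits w ρ)

  out-emits-power : ∀ {d} e w (ρ : Vec ℕ d) → out ts (emits-power e w) ρ ≡ rep (N ^ e) w
  out-emits-power zero    w ρ = trans (out-emits w ρ) (sym (Listₚ.++-identityʳ w))
  out-emits-power (suc e) w ρ =
    trans (collect-cong (λ j → out-emits-power e w (j ∷ ρ)) 0 N) (collect-rep (N ^ e) w 0 N)

  rank : ∀ {d} → Vec ℕ d → List (Fin d) → ℕ
  rank ρ []       = 0
  rank ρ (p ∷ ps) = rank ρ ps * N + lookup ρ p

  out-emits-rank : ∀ {d} ps e w (ρ : Vec ℕ d) → out ts (emits-rank ps e w) ρ ≡ rep (rank ρ ps * N ^ e) w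
  out-emits-rank []       e w ρ = refl
  out-emits-rank (p ∷ ps) e w ρ = trans
    (cong₂ _++_ (out-emits-rank ps (suc e) w ρ)
      (trans (collect-cong (λ j → out-emits-power e w (j ∷ ρ)) 0 (lookup ρ p))
             (collect-rep (N ^ e) w 0 (lookup ρ p))))
    (trans (rep-+ (rank ρ ps * N ^ suc e) _ w)
           (cong (λ k → rep k w) (arith (rank ρ ps) N (N ^ e) (lookup ρ p))))
    where
    arith : ∀ r N P l → r * (N * P) + l * P ≡ (r * N + l) * P
    arith = solve-∀

  out-emits-powers : ∀ {d} i es w (ρ : Vec ℕ d) → out ts (emits-powers es w) ρ ≡ rep (powers N i es) w
  out-emits-powers i []       w ρ = refl
  out-emits-powers i (e ∷ es) w ρ =
    trans (cong₂ _++_ (out-emits-power e w ρ) (out-emits-powers i es w ρ)) (rep-+ (N ^ e) _ w)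

  module _ {d} (ps : List (Fin d)) (ρ : Vec ℕ d) where

    private
      i = rank ρ ps

    out-emits-ix : ∀ ix w → out ts (emits-ix ps ix w) ρ ≡ rep (evalIx N i ix) w
    out-emits-ix (abs c)   w = out-emits (rep c w) ρ
    out-emits-ix (cur c)   w = trans (cong₂ _++_ (out-emits (rep c w) ρ) (out-emits-rank ps 0 w ρ))
      (trans (rep-+ c (i * 1) w) (cong (λ k → rep (c + k) w) (ℕₚ.*-identityʳ i)))
    out-emits-ix (pow e c) w = trans (cong₂ _++_ (out-emits (rep c w) ρ) (out-emits-power e w ρ))
      (rep-+ c (N ^ e) w)

    out-emits-name : ∀ n → out ts (emits-name ps n) ρ ≡ encNat (evalName N i n)
    out-emits-name (κ , ix) = begin
      out ts (emits u) ρ ++ (out ts (emits-ix ps ix tf) ρ ++ out ts (emits end) ρ)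
        ≡⟨ cong₂ _++_ (out-emits u ρ) (cong₂ _++_ (out-emits-ix ix tf) (out-emits end ρ)) ⟩
      u ++ (rep j tf ++ end)
        ≡⟨ cong (λ z → u ++ (z ++ end)) (spread-replicate j false) ⟨
      u ++ (spread (replicate j false) ++ end)
        ≡⟨ Listₚ.++-assoc (spread (replicate κ true)) tf _ ⟩
      spread (replicate κ true) ++ (spread (false ∷ replicate j false) ++ end)
        ≡⟨ Listₚ.++-assoc (spread (replicate κ true)) _ end ⟨
      (spread (replicate κ true) ++ spread (false ∷ replicate j false)) ++ end
        ≡⟨ cong (_++ end) (spread-++ (replicate κ true) _) ⟨
      spread (replicate κ true ++ false ∷ replicate j false) ++ end
        ≡⟨ encNat-number (replicate κ true ++ false ∷ replicate j false) ⟨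
      encNat (name κ j) ∎
      where
      open ≡-Reasoning
      j = evalIx N i ix
      tf = true ∷ false ∷ []
      u = spread (replicate κ true) ++ tf

    out-emits-subscript : ∀ C → out ts (emits-subscript ps C) ρ ≡ encNat (evalSubscript N i C)
    out-emits-subscript (lit c) = out-emits (encNat c) ρ
    out-emits-subscript (big c es) = begin
      out ts (emits (true ∷ true ∷ rep c tf)) ρ ++ (out ts (emits-powers es tf) ρ ++ out ts (emits end) ρ)
        ≡⟨ cong₂ _++_ (out-emits (true ∷ true ∷ rep c tf) ρ)
             (cong₂ _++_ (out-emits-powers i es tf ρ) (out-emits end ρ)) ⟩
      (true ∷ true ∷ rep c tf) ++ (rep (powers N i es) tf ++ end)
        ≡⟨ Listₚ.++-assoc (true ∷ true ∷ rep c tf) (rep (powers N i es) tf) end ⟨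
      true ∷ true ∷ ((rep c tf ++ rep (powers N i es) tf) ++ end)
        ≡⟨ cong (λ z → true ∷ true ∷ (z ++ end))
             (trans (rep-+ c (powers N i es) tf) (sym (spread-replicate (c + powers N i es) false))) ⟩
      spread (true ∷ replicate (c + powers N i es) false) ++ end
        ≡⟨ encNat-number (true ∷ replicate (c + powers N i es) false) ⟨
      encNat (evalSubscript N i (big c es)) ∎
      where
      open ≡-Reasoning
      tf = true ∷ false ∷ []

    out-emits-formula : ∀ φ → out ts (emits-formula ps φ) ρ ≡ encN2 (eval N i φ)
    out-emits-formula (pos ⋈ C p q) = cong₂ _++_ (out-emits (encNat 0) ρ) (cong₂ _++_ (out-emits (encCmp ⋈) ρ)
      (cong₂ _++_ (out-emits-subscript C) (cong₂ _++_ (out-emits-name p) (out-emits-name q))))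
    out-emits-formula (neg ⋈ C p q) = cong₂ _++_ (out-emits (encNat 1) ρ) (cong₂ _++_ (out-emits (encCmp ⋈) ρ)
      (cong₂ _++_ (out-emits-subscript C) (cong₂ _++_ (out-emits-name p) (out-emits-name q))))
    out-emits-formula (nest ⋈ C p ⋈′ D q r) = cong₂ _++_ (out-emits (encNat 2) ρ) (cong₂ _++_ (out-emits (encCmp ⋈) ρ)
      (cong₂ _++_ (out-emits-subscript C) (cong₂ _++_ (out-emits-name p) (cong₂ _++_ (out-emits (encCmp ⋈′) ρ)
        (cong₂ _++_ (out-emits-subscript D) (cong₂ _++_ (out-emits-name q) (out-emits-name r)))))))

    out-emits-formulas : ∀ Φ → out ts (emits-formulas ps Φ) ρ ≡ encSet (map (eval N i) Φ)
    out-emits-formulas []      = refl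
    out-emits-formulas (φ ∷ Φ) = cong₂ _++_ (out-emits-formula φ) (out-emits-formulas Φ)

-- Families of formulas and their emission

data Tree : Set where
  leaf  : Formula → Tree
  _&_   : Tree → Tree → Tree
  every : (n : ℕ) → (Fin n → Tree) → Tree
  when  : Bool → Tree → Tree

infixr 4 _&_

flatten : Tree → List Formula
flatten (leaf φ)       = [ φ ]
flatten (t & u)        = flatten t ++ flatten u
flatten (every n F)    = Data.List.concat (Data.List.tabulate (λ i → flatten (F i)))
flatten (when true t)  = flatten t
flatten (when false t) = []

-- The input enters only here: a `Tree` is expanded into a fixed list of formulas before emission,
-- while `loops e` repeats it for all indices below N^e and `input` for each cell that holds a bit.
data Section : Set where
  once  : Tree → Section
  loops : ℕ → Tree → Section
  input : (Bool → Tree) → Section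

byTy : ∀ {A : Set} → A → (Bool → A) → Ty → A
byTy a f (ty b) = f b
byTy a f pad    = a

emits-loops : ∀ {d} → ℕ → List (Fin d) → List Formula → Cmd d
emits-loops zero    ps Φ = emits-formulas ps Φ
emits-loops (suc e) ps Φ = loop nothing (emits-loops e (fz ∷ map fs ps) Φ)

emits-section : Section → Cmd 0
emits-section (once t)    = emits-formulas [] (flatten t)
emits-section (loops e t) = emits-loops e [] (flatten t)
emits-section (input F)   =
  loop nothing (bycell fz (byTy skip λ b → emits-formulas [ fz ] (flatten (F b))))

emits-sections : List Section → Cmd 0
emits-sections []       = skip
emits-sections (s ∷ ss) = emits-section s ⨾ emits-sections ss

encSet-++ : ∀ Γ Δ → encSet (Γ ++ Δ) ≡ encSet Γ ++ encSet Δ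
encSet-++ = Listₚ.concatMap-++ encN2

encSet-collect : ∀ F i r → encSet (collect F i r) ≡ collect (encSet ∘ F) i r
encSet-collect F i zero    = refl
encSet-collect F i (suc r) = trans (encSet-++ (F i) _) (cong (encSet (F i) ++_) (encSet-collect F (suc i) r))

module _ (ts : List Ty) where

  private
    N = length ts

  sectionFormulas : Section → List N2
  sectionFormulas (once t)    = map (eval N 0) (flatten t)
  sectionFormulas (loops e t) = collect (λ i → map (eval N i) (flatten t)) 0 (N ^ e)
  sectionFormulas (input F)   =
    collect (λ j → byTy [] (λ b → map (eval N j) (flatten (F b))) (nth pad ts j)) 0 N

  formulas : List Section → List N2
  formulas []       = []
  formulas (s ∷ ss) = sectionFormulas s ++ formulas ss

  rank-weaken : ∀ {d} j (ρ : Vec ℕ d) ps → rank ts (j ∷ ρ) (map fs ps) ≡ rank ts ρ ps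
  rank-weaken j ρ []       = refl
  rank-weaken j ρ (p ∷ ps) = cong (λ r → r * N + lookup ρ p) (rank-weaken j ρ ps)

  -- The index of each new loop becomes the least significant digit of the rank, so the nested loops
  -- enumerate N^e consecutive indices in order.
  out-emits-loops : ∀ {d} e ps Φ (ρ : Vec ℕ d) → out ts (emits-loops e ps Φ) ρ
    ≡ collect (λ i → encSet (map (eval N i) Φ)) (rank ts ρ ps * N ^ e) (N ^ e)
  out-emits-loops zero ps Φ ρ = trans (out-emits-formulas ts ps ρ Φ) (trans
    (cong (λ i → encSet (map (eval N i) Φ)) (sym (ℕₚ.*-identityʳ (rank ts ρ ps))))
    (sym (Listₚ.++-identityʳ _)))
  out-emits-loops (suc e) ps Φ ρ = trans
    (collect-cong (λ j → trans (out-emits-loops e (fz ∷ map fs ps) Φ (j ∷ ρ))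
      (cong (λ r → collect G ((r * N + j) * N ^ e) (N ^ e)) (rank-weaken j ρ ps))) 0 N)
    (trans (collect-* G (N ^ e) (r * N) 0 N) (cong (λ k → collect G k (N * N ^ e)) (arith r N (N ^ e))))
    where
    G : ℕ → List Bool
    G i = encSet (map (eval N i) Φ)
    r = rank ts ρ ps
    arith : ∀ r N P → (r * N + 0) * P ≡ r * (N * P)
    arith = solve-∀

  out-emits-section : ∀ s → out ts (emits-section s) [] ≡ encSet (sectionFormulas s)
  out-emits-section (once t)    = out-emits-formulas ts [] [] (flatten t)
  out-emits-section (loops e t) = trans (out-emits-loops e [] (flatten t) [])
    (sym (encSet-collect (λ i → map (eval N i) (flatten t)) 0 (N ^ e)))
  out-emits-section (input F) = trans (collect-cong (λ j → go j (nth pad ts j)) 0 N)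
    (sym (encSet-collect _ 0 N))
    where
    go : ∀ j t → out ts (byTy skip (λ b → emits-formulas [ fz ] (flatten (F b))) t) (j ∷ [])
      ≡ encSet (byTy [] (λ b → map (eval N j) (flatten (F b))) t)
    go j (ty b) = out-emits-formulas ts [ fz ] (j ∷ []) (flatten (F b))
    go j pad    = refl

  out-emits-sections : ∀ ss → out ts (emits-sections ss) [] ≡ encSet (formulas ss)
  out-emits-sections []       = refl
  out-emits-sections (s ∷ ss) = trans (cong₂ _++_ (out-emits-section s) (out-emits-sections ss))
    (sym (encSet-++ (sectionFormulas s) (formulas ss)))

sections-poly-time : ∀ ss → PolyTimeComputable (λ x → encSet (formulas (workspace x) ss))
sections-poly-time ss =
  let M , k , runs = Whole.cmd-poly-time (emits-sections ss) in
  M , k , λ x → let h , e = runs x in h , trans e (out-emits-sections (workspace x) ss)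

-- Satisfaction of an emitted family

module Semantics (𝔄 : Structure) where

  Holds : ℕ → ℕ → Tree → Set
  Holds N i (leaf φ)    = 𝔄 ⊨ eval N i φ
  Holds N i (t & u)     = Holds N i t × Holds N i u
  Holds N i (every n F) = ∀ a → Holds N i (F a)
  Holds N i (when b t)  = b ≡ true → Holds N i t

  HoldsS : List Ty → Section → Set
  HoldsS ts (once t)    = Holds (length ts) 0 t
  HoldsS ts (loops e t) = ∀ i → i < length ts ^ e → Holds (length ts) i t
  HoldsS ts (input F)   = ∀ j b → j < length ts → nth pad ts j ≡ ty b → Holds (length ts) j (F b)

  flatten⁻ : ∀ N i t → All (λ φ → 𝔄 ⊨ eval N i φ) (flatten t) → Holds N i t
  flatten⁻ N i (leaf φ) (h ∷ [])  = h
  flatten⁻ N i (t & u) h          =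
    let h₁ , h₂ = Allₚ.++⁻ (flatten t) h in flatten⁻ N i t h₁ , flatten⁻ N i u h₂
  flatten⁻ N i (every n F) h a    = flatten⁻ N i (F a) (Allₚ.tabulate⁻ (Allₚ.concat⁻ h) a)
  flatten⁻ N i (when true t) h _  = flatten⁻ N i t h

  flatten⁺ : ∀ N i t → Holds N i t → All (λ φ → 𝔄 ⊨ eval N i φ) (flatten t)
  flatten⁺ N i (leaf φ) h         = h ∷ []
  flatten⁺ N i (t & u) (h , h′)   = Allₚ.++⁺ (flatten⁺ N i t h) (flatten⁺ N i u h′)
  flatten⁺ N i (every n F) h      = Allₚ.concat⁺ (Allₚ.tabulate⁺ (λ a → flatten⁺ N i (F a) (h a)))
  flatten⁺ N i (when true t) h    = flatten⁺ N i t (h refl)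
  flatten⁺ N i (when false t) h   = []

  collect⁻ : ∀ {P : N2 → Set} F i r → All P (collect F i r) → ∀ j → i ≤ j → j < i + r → All P (F j)
  collect⁻ F i zero    h j i≤j j<i = ⊥-elim (ℕₚ.<⇒≱ (subst (j <_) (ℕₚ.+-identityʳ i) j<i) i≤j)
  collect⁻ F i (suc r) h j i≤j j<i with Allₚ.++⁻ (F i) h | i ℕₚ.≟ j
  ... | h₁ , h₂ | yes refl = h₁
  ... | h₁ , h₂ | no i≢j   =
    collect⁻ F (suc i) r h₂ j (ℕₚ.≤∧≢⇒< i≤j i≢j) (subst (j <_) (ℕₚ.+-suc i r) j<i)

  collect⁺ : ∀ {P : N2 → Set} F i r → (∀ j → j < i + r → All P (F j)) → All P (collect F i r)
  collect⁺ F i zero    h = []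
  collect⁺ F i (suc r) h = Allₚ.++⁺ (h i (ℕₚ.m<m+n i (s≤s z≤n)))
    (collect⁺ F (suc i) r λ j lt → h j (subst (j <_) (sym (ℕₚ.+-suc i r)) lt))

  section⁻ : ∀ ts s → All (𝔄 ⊨_) (sectionFormulas ts s) → HoldsS ts s
  section⁻ ts (once t)    h         = flatten⁻ (length ts) 0 t (Allₚ.map⁻ h)
  section⁻ ts (loops e t) h i lt    =
    flatten⁻ (length ts) i t (Allₚ.map⁻ (collect⁻ _ 0 (length ts ^ e) h i z≤n lt))
  section⁻ ts (input F) h j b lt eq = flatten⁻ (length ts) j (F b) (Allₚ.map⁻
    (subst (λ t → All (𝔄 ⊨_) (byTy [] (λ b → map (eval (length ts) j) (flatten (F b))) t)) eq
      (collect⁻ _ 0 (length ts) h j z≤n lt)))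

  section⁺ : ∀ ts s → HoldsS ts s → All (𝔄 ⊨_) (sectionFormulas ts s)
  section⁺ ts (once t)    h = Allₚ.map⁺ (flatten⁺ (length ts) 0 t h)
  section⁺ ts (loops e t) h =
    collect⁺ _ 0 (length ts ^ e) λ i lt → Allₚ.map⁺ (flatten⁺ (length ts) i t (h i lt))
  section⁺ ts (input F) h = collect⁺ _ 0 (length ts) λ j lt → go j lt (nth pad ts j) refl
    where
    go : ∀ j → j < length ts → ∀ t → nth pad ts j ≡ t →
      All (𝔄 ⊨_) (byTy [] (λ b → map (eval (length ts) j) (flatten (F b))) t)
    go j lt (ty b) e = Allₚ.map⁺ (flatten⁺ (length ts) j (F b) (h j b lt e))
    go j lt pad    e = []

  sections⁻ : ∀ ts ss → All (𝔄 ⊨_) (formulas ts ss) → All (HoldsS ts) ss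
  sections⁻ ts []       h = []
  sections⁻ ts (s ∷ ss) h =
    let h₁ , h₂ = Allₚ.++⁻ (sectionFormulas ts s) h in section⁻ ts s h₁ ∷ sections⁻ ts ss h₂

  sections⁺ : ∀ ts ss → All (HoldsS ts) ss → All (𝔄 ⊨_) (formulas ts ss)
  sections⁺ ts []       []      = []
  sections⁺ ts (s ∷ ss) (h ∷ hs) = Allₚ.++⁺ (section⁺ ts s h) (sections⁺ ts ss hs)

-- Tableaux

isZero : ℕ → Bool
isZero zero    = true
isZero (suc _) = false

cyc : ℕ → ℕ → ℕ
cyc top j = if does (j ℕₚ.≟ top) then 0 else suc j

cyc-top : ∀ top → cyc top top ≡ 0
cyc-top top rewrite dec-true (top ℕₚ.≟ top) refl = refl

cyc-suc : ∀ {top j} → j < top → cyc top j ≡ suc j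
cyc-suc {top} {j} lt rewrite dec-false (j ℕₚ.≟ top) (ℕₚ.<⇒≢ lt) = refl

finite-Move : Finite Move
finite-Move = finite-retract to from from-to (finite-Fin 3)
  where
  to : Move → Fin 3
  to left  = fz
  to right = fs fz
  to stay  = fs (fs fz)
  from : Fin 3 → Move
  from fz           = left
  from (fs fz)      = right
  from (fs (fs fz)) = stay
  from-to : ∀ m → from (to m) ≡ m
  from-to left  = refl
  from-to right = refl
  from-to stay  = refl

index-injective : ∀ {A} (F : Finite A) {a b} → index F a ≡ index F b → a ≡ b
index-injective F {a} {b} e = trans (sym (elem-index F a)) (trans (cong (elem F) e) (elem-index F b))

finite-≟ : ∀ {A} → Finite A → (a b : A) → Dec (a ≡ b)
finite-≟ F a b = map′ (index-injective F) (cong (index F)) (index F a Finₚ.≟ index F b)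

module Tiles (M : NTM) where
  open NTM M
  open TM nQ g renaming (blank to ␣)
  open NTMRun M

  Action : Set
  Action = Fin nQ × Sym × Move

  _≟ᵃ_ : (a b : Action) → Dec (a ≡ b)
  _≟ᵃ_ = Productₚ.≡-dec Finₚ._≟_ (Productₚ.≡-dec Finₚ._≟_ (finite-≟ finite-Move))

  -- The added idle action lets a run that stops early fill all rows; it is sound because acceptance
  -- is required only within the time bound.
  Allowed : Fin nQ → Sym → Action → Set
  Allowed q s a = a ≡ (q , s , stay) ⊎ a ∈ δ q s

  allowed? : ∀ q s a → Dec (Allowed q s a)
  allowed? q s a = (a ≟ᵃ (q , s , stay)) ⊎-dec (a ∈? δ q s)
    where open DecMembership _≟ᵃ_ using (_∈?_)

  -- The tile at time t and distance j holds the state, the scanned symbol and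
  -- the action taken at time t, and the symbols at distance j from the head:
  -- lc, rc are the (1+j)-th symbols to the left and to the right of the head,
  -- lp, rp those of the tile at distance j - 1, and ln, rn those of the tile at
  -- distance j + 1; at distance 0, rp is the scanned symbol, so that the rp of
  -- row 0 spell the input.  The flags z and f mark distance 0 and time 0, and d marks
  -- the cells of row 0 beyond the input.
  record Tile : Set where
    constructor mkTile
    field
      st          : Fin nQ
      hd          : Sym
      ac          : Action
      lc lp ln    : Sym
      rc rp rn    : Sym
      z f d       : Bool

  open Tile public

  finite-Tile′ : Finite Tile
  finite-Tile′ = finite-retract
    (λ { (mkTile st hd ac lc lp ln rc rp rn z f d) →
         (st , hd , ac) , (lc , lp , ln) , (rc , rp , rn) , (z , f , d) })
    (λ { ((st , hd , ac) , (lc , lp , ln) , (rc , rp , rn) , (z , f , d)) →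
         mkTile st hd ac lc lp ln rc rp rn z f d })
    (λ _ → refl)
    (finite-× (finite-× finQ (finite-× finS (finite-× finQ (finite-× finS finite-Move))))
      (finite-× triple (finite-× triple (finite-× finite-Bool (finite-× finite-Bool finite-Bool)))))
    where
    finQ   = finite-Fin nQ
    finS   = finite-Fin (3 + g)
    triple = finite-× finS (finite-× finS finS)

  opaque
    finite-Tile : Finite Tile
    finite-Tile = finite-Tile′

  Valid : Tile → Set
  Valid a = Allowed (st a) (hd a) (ac a)
          × (z a ≡ true → rp a ≡ hd a)
          × (f a ≡ true → st a ≡ start × lc a ≡ ␣)
          × (d a ≡ true → rp a ≡ ␣)

  -- State, scanned symbol and action are compared even across the seam from the last column to
  -- column 0, and so are constant on a row. The copies are compared only off the seam, which `z b`
  -- reveals.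
  Hor : Tile → Tile → Set
  Hor a b = Valid a
          × (st a ≡ st b × hd a ≡ hd b × ac a ≡ ac b)
          × (z b ≡ false → ln a ≡ lc b × rn a ≡ rc b × lp b ≡ lc a × rp b ≡ rc a × (d a ≡ true → d b ≡ true))

  -- A move to the right pushes the left half of the tape away from the head: distance j now shows
  -- what was at distance j - 1, kept as `lp`, or at distance 0 the symbol just written. The right
  -- half comes nearer, hence `rn`. Moves to the left are symmetric.
  Shifted : Move → Sym → Tile → Tile → Set
  Shifted right w a b = lc b ≡ (if z a then w else lp a) × rc b ≡ rn a × (z a ≡ true → hd b ≡ rc a)
  Shifted left  w a b = lc b ≡ ln a × rc b ≡ (if z a then w else rp a) × (z a ≡ true → hd b ≡ lc a)
  Shifted stay  w a b = lc b ≡ lc a × rc b ≡ rc a × (z a ≡ true → hd b ≡ w)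

  -- `f b` reveals the seam from the last row to row 0. There the state entered by the last action
  -- must accept; elsewhere `b` must result from that action.
  Ver : Tile → Tile → Set
  Ver a b = (f b ≡ true → proj₁ (ac a) ≡ accept)
          × (f b ≡ false → st b ≡ proj₁ (ac a) × Shifted (proj₂ (proj₂ (ac a))) (proj₁ (proj₂ (ac a))) a b)

  hor? : ∀ a b → Dec (Hor a b)
  hor? a b =
    (allowed? (st a) (hd a) (ac a)
      ×-dec ((z a Boolₚ.≟ true) →-dec (rp a Finₚ.≟ hd a))
      ×-dec ((f a Boolₚ.≟ true) →-dec ((st a Finₚ.≟ start) ×-dec (lc a Finₚ.≟ ␣)))
      ×-dec ((d a Boolₚ.≟ true) →-dec (rp a Finₚ.≟ ␣)))
    ×-dec ((st a Finₚ.≟ st b) ×-dec (hd a Finₚ.≟ hd b) ×-dec (ac a ≟ᵃ ac b))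
    ×-dec ((z b Boolₚ.≟ false) →-dec
      ((ln a Finₚ.≟ lc b) ×-dec (rn a Finₚ.≟ rc b) ×-dec (lp b Finₚ.≟ lc a) ×-dec (rp b Finₚ.≟ rc a)
        ×-dec ((d a Boolₚ.≟ true) →-dec (d b Boolₚ.≟ true))))

  shifted? : ∀ m w a b → Dec (Shifted m w a b)
  shifted? right w a b = (lc b Finₚ.≟ _) ×-dec (rc b Finₚ.≟ rn a) ×-dec ((z a Boolₚ.≟ true) →-dec (hd b Finₚ.≟ rc a))
  shifted? left  w a b = (lc b Finₚ.≟ ln a) ×-dec (rc b Finₚ.≟ _) ×-dec ((z a Boolₚ.≟ true) →-dec (hd b Finₚ.≟ lc a))
  shifted? stay  w a b = (lc b Finₚ.≟ lc a) ×-dec (rc b Finₚ.≟ rc a) ×-dec ((z a Boolₚ.≟ true) →-dec (hd b Finₚ.≟ w))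

  ver? : ∀ a b → Dec (Ver a b)
  ver? a b = ((f b Boolₚ.≟ true) →-dec (proj₁ (ac a) Finₚ.≟ accept))
    ×-dec ((f b Boolₚ.≟ false) →-dec ((st b Finₚ.≟ proj₁ (ac a)) ×-dec shifted? _ _ a b))

  record Tableau (T W : ℕ) (x : List Bool) : Set where
    field
      tileAt : ℕ → ℕ → Tile
      z-at   : ∀ {t j} → t ≤ T → j ≤ W → z (tileAt t j) ≡ isZero j
      f-at   : ∀ {t j} → t ≤ T → j ≤ W → f (tileAt t j) ≡ isZero t
      hor-at : ∀ {t j} → t ≤ T → j ≤ W → Hor (tileAt t j) (tileAt t (cyc W j))
      ver-at : ∀ {t j} → t ≤ T → j ≤ W → Ver (tileAt t j) (tileAt (cyc T t) j)
      inp-at : ∀ {j} → j < length x → rp (tileAt 0 j) ≡ nth ␣ (map bitSym x) j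
      end-at : d (tileAt 0 (length x)) ≡ true

  lefts rights : Config → ℕ → Sym
  lefts  c = nth ␣ (Config.lft c)
  rights c = nth ␣ (Config.rgt c)

  apply-stay : ∀ c → apply c (Config.state c , Config.hd c , stay) ≡ c
  apply-stay ⟨ q , l , h , r ⟩ = refl

  Reach-weaken : ∀ {t c c′} → Reach t c c′ → Reach (suc t) c c′
  Reach-weaken done       = done
  Reach-weaken (more s R) = more s (Reach-weaken R)

  Reach-snoc : ∀ {t c c′ c″} → Reach t c c′ → Step c′ c″ → Reach (suc t) c c″
  Reach-snoc done       s = more s done
  Reach-snoc (more s R) s′ = more s (Reach-snoc R s′)

  Reach-allowed : ∀ {t c c′} a → Reach t c c′ → Allowed (Config.state c′) (Config.hd c′) a →
    Reach (suc t) c (apply c′ a)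
  Reach-allowed {t} {c} {c′} a R (inj₁ refl) = subst (Reach (suc t) c) (sym (apply-stay c′)) (Reach-weaken R)
  Reach-allowed a R (inj₂ m) = Reach-snoc R (step m)

  state-apply : ∀ c a → Config.state (apply c a) ≡ proj₁ a
  state-apply ⟨ q , l , h , r ⟩ (q′ , w , m) = refl

  -- Accepting runs from tableaux

  module FromTableau {T W x} (tab : Tableau T W x) (T+2<W : 2 + T ≤ W) (n≤W : length x ≤ W) where
    open Tableau tab

    xs : List Sym
    xs = map bitSym x

    hor-next : ∀ {t j} → t ≤ T → j < W → Hor (tileAt t j) (tileAt t (suc j))
    hor-next {t} {j} t≤ j< = subst (λ k → Hor (tileAt t j) (tileAt t k)) (cyc-suc j<) (hor-at t≤ (ℕₚ.<⇒≤ j<))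

    links : ∀ {t j} → t ≤ T → j < W → let a = tileAt t j ; b = tileAt t (suc j) in
      ln a ≡ lc b × rn a ≡ rc b × lp b ≡ lc a × rp b ≡ rc a × (d a ≡ true → d b ≡ true)
    links t≤ j< = proj₂ (proj₂ (hor-next t≤ j<)) (z-at t≤ j<)

    ver-next : ∀ {t j} → t < T → j ≤ W → Ver (tileAt t j) (tileAt (suc t) j)
    ver-next {t} {j} t< j≤ = subst (λ k → Ver (tileAt t j) (tileAt k j)) (cyc-suc t<) (ver-at (ℕₚ.<⇒≤ t<) j≤)

    ac-const : ∀ {t} → t ≤ T → ∀ j → j ≤ W → ac (tileAt t j) ≡ ac (tileAt t 0)
    ac-const t≤ zero    j≤ = refl
    ac-const t≤ (suc j) j≤ =
      trans (sym (proj₂ (proj₂ (proj₁ (proj₂ (hor-next t≤ j≤)))))) (ac-const t≤ j (ℕₚ.<⇒≤ j≤))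

    done-from : ∀ k → length x + k ≤ W → d (tileAt 0 (length x + k)) ≡ true
    done-from zero    le = subst (λ k → d (tileAt 0 k) ≡ true) (sym (ℕₚ.+-identityʳ _)) end-at
    done-from (suc k) le rewrite ℕₚ.+-suc (length x) k =
      proj₂ (proj₂ (proj₂ (proj₂ (links z≤n le)))) (done-from k (ℕₚ.<⇒≤ le))

    -- Up to the end of the input the symbols are given. From there on the flag `d` travels right
    -- along the row and forces blanks.
    row0-rp : ∀ j → j < W → rp (tileAt 0 j) ≡ nth ␣ xs j
    row0-rp j j<W with j ℕₚ.<? length x
    ... | yes j<n = inp-at j<n
    ... | no j≮n  = trans (proj₂ (proj₂ (proj₂ (proj₁ (hor-next z≤n j<W))))
                      (subst (λ k → d (tileAt 0 k) ≡ true) e (done-from k (subst (_≤ W) (sym e) (ℕₚ.<⇒≤ j<W)))))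
                    (sym (nth-≥ ␣ xs (subst (_≤ j) (sym (Listₚ.length-map bitSym x)) (ℕₚ.≮⇒≥ j≮n))))
      where
      k = j ∸ length x
      e : length x + k ≡ j
      e = ℕₚ.m+[n∸m]≡n (ℕₚ.≮⇒≥ j≮n)

    -- Copies in the last column are unchecked, and every step lets this spread one column inwards,
    -- so at time t only distances up to W - t - 2 are trusted. The 2 stems from row 0, where the
    -- symbol at distance j is read from `rp` in column j + 1, which must lie before W.
    record Agree (t : ℕ) (c : Config) : Set where
      field
        same-st : Config.state c ≡ st (tileAt t 0)
        same-hd : Config.hd c ≡ hd (tileAt t 0)
        same-l  : ∀ j → t + (2 + j) ≤ W → lefts c j ≡ lc (tileAt t j)
        same-r  : ∀ j → t + (2 + j) ≤ W → rights c j ≡ rc (tileAt t j)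

    open Agree

    0<W : 0 < W
    0<W = ℕₚ.<-≤-trans (s≤s z≤n) T+2<W

    agree-initial : Agree 0 (initial start x)
    agree-initial .same-st = trans (state-initial x) (sym (proj₁ (row0-valid 0 0<W)))
      where
      state-initial : ∀ x → Config.state (initial start x) ≡ start
      state-initial []      = refl
      state-initial (_ ∷ _) = refl
      row0-valid : ∀ j → j < W → st (tileAt 0 j) ≡ start × lc (tileAt 0 j) ≡ ␣
      row0-valid j j<W = proj₁ (proj₂ (proj₂ (proj₁ (hor-next z≤n j<W)))) (f-at z≤n (ℕₚ.<⇒≤ j<W))
    agree-initial .same-hd = trans (hd-initial x)
      (trans (sym (row0-rp 0 0<W)) (proj₁ (proj₂ (proj₁ (hor-next z≤n 0<W))) (z-at z≤n z≤n)))
      where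
      hd-initial : ∀ x → Config.hd (initial start x) ≡ nth ␣ (map bitSym x) 0
      hd-initial []      = refl
      hd-initial (_ ∷ _) = refl
    agree-initial .same-l j le = trans (lft-initial x j)
      (sym (proj₂ (proj₁ (proj₂ (proj₂ (proj₁ (hor-next z≤n j<W)))) (f-at z≤n (ℕₚ.<⇒≤ j<W)))))
      where
      j<W : j < W
      j<W = ℕₚ.<⇒≤ le
      lft-initial : ∀ x j → lefts (initial start x) j ≡ ␣
      lft-initial []      j = refl
      lft-initial (_ ∷ _) j = refl
    agree-initial .same-r j le = trans (rgt-initial x j)
      (trans (sym (row0-rp (suc j) le)) (proj₁ (proj₂ (proj₂ (proj₂ (links z≤n (ℕₚ.<⇒≤ le)))))))
      where
      rgt-initial : ∀ x j → rights (initial start x) j ≡ nth ␣ (map bitSym x) (suc j)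
      rgt-initial []      j = refl
      rgt-initial (_ ∷ _) j = refl

    actionAt : ℕ → Action
    actionAt t = ac (tileAt t 0)

    ver-act : ∀ {t} → t < T → ∀ j → j ≤ W →
      st (tileAt (suc t) j) ≡ proj₁ (actionAt t) ×
      Shifted (proj₂ (proj₂ (actionAt t))) (proj₁ (proj₂ (actionAt t))) (tileAt t j) (tileAt (suc t) j)
    ver-act {t} t< j j≤ = subst
      (λ a → st (tileAt (suc t) j) ≡ proj₁ a × Shifted (proj₂ (proj₂ a)) (proj₁ (proj₂ a)) (tileAt t j) (tileAt (suc t) j))
      (ac-const (ℕₚ.<⇒≤ t<) j j≤) (proj₂ (ver-next t< j≤) (f-at t< j≤))

    module _ {t} (t<T : t < T) where

      private
        t≤T = ℕₚ.<⇒≤ t<T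
        bd : ∀ {j} → suc t + (2 + j) ≤ W → j < W
        bd {j} le = ℕₚ.≤-trans (ℕₚ.m≤n+m (suc j) (suc (suc t)))
          (subst (_≤ W) (cong suc (ℕₚ.+-suc t (suc j))) le)
        bd₁ : ∀ {j} → suc t + (2 + suc j) ≤ W → suc t + (2 + j) ≤ W
        bd₁ {j} = ℕₚ.≤-trans (ℕₚ.+-monoʳ-≤ (suc t) (ℕₚ.n≤1+n (2 + j)))
        bd₂ : ∀ {j} → suc t + (2 + j) ≤ W → t + (2 + j) ≤ W
        bd₂ = ℕₚ.<⇒≤
        bd₃ : ∀ {j} → suc t + (2 + j) ≤ W → t + (2 + suc j) ≤ W
        bd₃ {j} = subst (_≤ W) (sym (ℕₚ.+-suc t (suc (suc j))))
        bd₀ : t + 2 ≤ W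
        bd₀ = ℕₚ.≤-trans (ℕₚ.≤-reflexive (ℕₚ.+-comm t 2)) (ℕₚ.≤-trans (s≤s (s≤s t≤T)) T+2<W)

      -- `Shifted` gives the new symbol as a copy in the old tile, and `links` identifies the copy
      -- with the neighbour's own symbol. Looking at a neighbour is what costs one column.
      agree-step : ∀ c (m : Move) q′ w → Agree t c → actionAt t ≡ (q′ , w , m) →
        Agree (suc t) (apply c (q′ , w , m))
      agree-step c m q′ w A e = go m e
        where
        l = Config.lft c
        r = Config.rgt c
        V : ∀ m → actionAt t ≡ (q′ , w , m) → ∀ j → j ≤ W →
          st (tileAt (suc t) j) ≡ q′ × Shifted m w (tileAt t j) (tileAt (suc t) j)
        V m e j j≤ = subst
          (λ a → st (tileAt (suc t) j) ≡ proj₁ a × Shifted (proj₂ (proj₂ a)) (proj₁ (proj₂ a)) (tileAt t j) (tileAt (suc t) j))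
          e (ver-act t<T j j≤)
        if-z : ∀ {j} {s u v : Sym} b → j ≤ W → isZero j ≡ b → s ≡ (if z (tileAt t j) then u else v) →
          s ≡ (if b then u else v)
        if-z {u = u} {v} b j≤ ze eq =
          trans eq (cong (λ b → if b then u else v) (trans (z-at t≤T j≤) ze))
        hd-right : ∀ l w r → Config.hd (apply ⟨ q′ , l , w , r ⟩ (q′ , w , right)) ≡ nth ␣ r 0
        hd-right l w []      = refl
        hd-right l w (_ ∷ _) = refl
        lft-right : ∀ l h r → Config.lft (apply ⟨ q′ , l , h , r ⟩ (q′ , w , right)) ≡ w ∷ l
        lft-right l h []      = refl
        lft-right l h (_ ∷ _) = refl
        rgt-right : ∀ l h r j → rights (apply ⟨ q′ , l , h , r ⟩ (q′ , w , right)) j ≡ nth ␣ r (suc j)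
        rgt-right l h []      j = refl
        rgt-right l h (_ ∷ _) j = refl
        hd-left : ∀ l w r → Config.hd (apply ⟨ q′ , l , w , r ⟩ (q′ , w , left)) ≡ nth ␣ l 0
        hd-left []      w r = refl
        hd-left (_ ∷ _) w r = refl
        rgt-left : ∀ l h r → Config.rgt (apply ⟨ q′ , l , h , r ⟩ (q′ , w , left)) ≡ w ∷ r
        rgt-left []      h r = refl
        rgt-left (_ ∷ _) h r = refl
        lft-left : ∀ l h r j → lefts (apply ⟨ q′ , l , h , r ⟩ (q′ , w , left)) j ≡ nth ␣ l (suc j)
        lft-left []      h r j = refl
        lft-left (_ ∷ _) h r j = refl
        go : ∀ m → actionAt t ≡ (q′ , w , m) → Agree (suc t) (apply c (q′ , w , m))
        go m e .same-st = sym (proj₁ (V m e 0 z≤n))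
        go stay e .same-hd = sym (proj₂ (proj₂ (proj₂ (V stay e 0 z≤n))) (z-at t≤T z≤n))
        go stay e .same-l j le = trans (same-l A j (bd₂ {j} le)) (sym (proj₁ (proj₂ (V stay e j (ℕₚ.<⇒≤ (bd le))))))
        go stay e .same-r j le = trans (same-r A j (bd₂ {j} le)) (sym (proj₁ (proj₂ (proj₂ (V stay e j (ℕₚ.<⇒≤ (bd le)))))))
        go right e .same-hd = trans (hd-right l w r) (trans (same-r A 0 bd₀)
          (sym (proj₂ (proj₂ (proj₂ (V right e 0 z≤n))) (z-at t≤T z≤n))))
        go right e .same-l j le = trans (cong (λ l → nth ␣ l j) (lft-right l w r)) (lem j le)
          where
          lem : ∀ j → suc t + (2 + j) ≤ W → nth ␣ (w ∷ l) j ≡ lc (tileAt (suc t) j)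
          lem zero    le = sym (if-z true z≤n refl (proj₁ (proj₂ (V right e 0 z≤n))))
          lem (suc j) le = trans (same-l A j (bd₂ {j} (bd₁ {j} le)))
            (trans (sym (proj₁ (proj₂ (proj₂ (links t≤T (bd (bd₁ {j} le)))))))
              (sym (if-z false (bd (bd₁ {j} le)) refl (proj₁ (proj₂ (V right e (suc j) (bd (bd₁ {j} le))))))))
        go right e .same-r j le = trans (rgt-right l w r j) (trans (same-r A (suc j) (bd₃ {j} le))
          (trans (sym (proj₁ (proj₂ (links t≤T (bd le))))) (sym (proj₁ (proj₂ (proj₂ (V right e j (ℕₚ.<⇒≤ (bd le)))))))))
        go left e .same-hd = trans (hd-left l w r) (trans (same-l A 0 bd₀)
          (sym (proj₂ (proj₂ (proj₂ (V left e 0 z≤n))) (z-at t≤T z≤n))))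
        go left e .same-r j le = trans (cong (λ r → nth ␣ r j) (rgt-left l w r)) (lem j le)
          where
          lem : ∀ j → suc t + (2 + j) ≤ W → nth ␣ (w ∷ r) j ≡ rc (tileAt (suc t) j)
          lem zero    le = sym (if-z true z≤n refl (proj₁ (proj₂ (proj₂ (V left e 0 z≤n)))))
          lem (suc j) le = trans (same-r A j (bd₂ {j} (bd₁ {j} le)))
            (trans (sym (proj₁ (proj₂ (proj₂ (proj₂ (links t≤T (bd (bd₁ {j} le))))))))
              (sym (if-z false (bd (bd₁ {j} le)) refl (proj₁ (proj₂ (proj₂ (V left e (suc j) (bd (bd₁ {j} le)))))))))
        go left e .same-l j le = trans (lft-left l w r j) (trans (same-l A (suc j) (bd₃ {j} le))
          (trans (sym (proj₁ (links t≤T (bd le)))) (sym (proj₁ (proj₂ (V left e j (ℕₚ.<⇒≤ (bd le))))))))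

    act-allowed : ∀ {t c} → t ≤ T → Agree t c → Allowed (Config.state c) (Config.hd c) (actionAt t)
    act-allowed {t} t≤ A = subst₂ (λ q s → Allowed q s (actionAt t)) (sym (same-st A)) (sym (same-hd A))
      (proj₁ (proj₁ (hor-next t≤ 0<W)))

    configAt : ∀ t → t ≤ T → ∃ λ c → Reach t (initial start x) c × Agree t c
    configAt zero    t≤ = initial start x , done , agree-initial
    configAt (suc t) t< =
      let c , R , A = configAt t (ℕₚ.<⇒≤ t<) in
      apply c (actionAt t) , Reach-allowed (actionAt t) R (act-allowed (ℕₚ.<⇒≤ t<) A) ,
      agree-step t< c _ _ _ A refl

    -- The action of row T is performed as well, which makes T + 1 steps; the seam to row 0
    -- guarantees that it enters the accepting state.
    accepts : AcceptsWithin (suc T) x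
    accepts =
      let c , R , A = configAt T ℕₚ.≤-refl in
      apply c (actionAt T) , Reach-allowed (actionAt T) R (act-allowed ℕₚ.≤-refl A) ,
      trans (state-apply c (actionAt T))
        (proj₁ (subst (λ t → Ver (tileAt T 0) (tileAt t 0)) (cyc-top T) (ver-at ℕₚ.≤-refl z≤n)) (f-at z≤n z≤n))

  -- Tableaux from accepting runs

  module ToTableau where

    -- Past its end the run idles in its last configuration, so every row has a configuration and an
    -- action.
    trace : ∀ {t c c′} → Reach t c c′ → ℕ → Config × Action
    trace (done {c = c})           i       = c , (Config.state c , Config.hd c , stay)
    trace (more {c = c} (step {a} _) R) zero    = c , a
    trace (more _ R)               (suc i) = trace R i

    trace-start : ∀ {t c c′} (R : Reach t c c′) → proj₁ (trace R 0) ≡ c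
    trace-start done              = refl
    trace-start (more (step _) R) = refl

    trace-step : ∀ {t c c′} (R : Reach t c c′) i →
      proj₁ (trace R (suc i)) ≡ apply (proj₁ (trace R i)) (proj₂ (trace R i))
    trace-step (done {c = c})    i       = sym (apply-stay c)
    trace-step (more (step _) R) zero    = trace-start R
    trace-step (more (step _) R) (suc i) = trace-step R i

    trace-allowed : ∀ {t c c′} (R : Reach t c c′) i → let c , a = trace R i in
      Allowed (Config.state c) (Config.hd c) a
    trace-allowed done              i       = inj₁ refl
    trace-allowed (more (step m) R) zero    = inj₂ m
    trace-allowed (more (step _) R) (suc i) = trace-allowed R i

    trace-end : ∀ {t c c′} (R : Reach t c c′) → proj₁ (trace R t) ≡ c′
    trace-end done              = refl
    trace-end (more (step _) R) = trace-end R

    before : Sym → (ℕ → Sym) → ℕ → Sym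
    before s u zero    = s
    before s u (suc j) = u j

    module _ {T W : ℕ} {x : List Bool} {c : Config}
             (R : Reach (suc T) (initial start x) c) (acc : Config.state c ≡ accept) where

      cfg : ℕ → Config
      cfg t = proj₁ (trace R t)

      act : ℕ → Action
      act t = proj₂ (trace R t)

      beyond : ℕ → ℕ → Bool
      beyond zero    j = does (length x ℕₚ.≤? j)
      beyond (suc _) j = false

      tileFor : ℕ → ℕ → Config → Action → Tile
      tileFor t j c a .st = Config.state c
      tileFor t j c a .hd = Config.hd c
      tileFor t j c a .ac = a
      tileFor t j c a .lc = lefts c j
      tileFor t j c a .lp = before ␣ (lefts c) j
      tileFor t j c a .ln = lefts c (suc j)
      tileFor t j c a .rc = rights c j
      tileFor t j c a .rp = before (Config.hd c) (rights c) j
      tileFor t j c a .rn = rights c (suc j)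
      tileFor t j c a .z  = isZero j
      tileFor t j c a .f  = isZero t
      tileFor t j c a .d  = beyond t j

      tl : ℕ → ℕ → Tile
      tl t j = tileFor t j (cfg t) (act t)

      beyond⇒ : ∀ {j} → beyond 0 j ≡ true → length x ≤ j
      beyond⇒ {j} e with length x ℕₚ.≤? j
      ... | yes le = le
      ... | no nle with () ← trans (sym e) (dec-false (length x ℕₚ.≤? j) nle)

      row0 : ∀ j → rp (tl 0 j) ≡ nth ␣ (map bitSym x) j
      row0 j rewrite trace-start R = go x j
        where
        go : ∀ x j → before (Config.hd (initial start x)) (rights (initial start x)) j ≡ nth ␣ (map bitSym x) j
        go []      zero    = refl
        go []      (suc j) = refl
        go (b ∷ x) zero    = refl
        go (b ∷ x) (suc j) = refl

      valid : ∀ t j → Valid (tl t j)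
      valid t j = trace-allowed R t , z-rp j , f-st t , d-rp t
        where
        z-rp : ∀ j → isZero j ≡ true → rp (tl t j) ≡ hd (tl t j)
        z-rp zero e = refl
        f-st : ∀ t → isZero t ≡ true → st (tl t j) ≡ start × lc (tl t j) ≡ ␣
        f-st zero e rewrite trace-start R = go x
          where
          go : ∀ x → Config.state (initial start x) ≡ start × lefts (initial start x) j ≡ ␣
          go []      = refl , refl
          go (_ ∷ _) = refl , refl
        d-rp : ∀ t → beyond t j ≡ true → rp (tl t j) ≡ ␣
        d-rp zero e = trans (row0 j) (nth-≥ ␣ (map bitSym x)
          (subst (_≤ j) (sym (Listₚ.length-map bitSym x)) (beyond⇒ e)))

      horiz : ∀ t j j′ → j′ ≡ 0 ⊎ j′ ≡ suc j → Hor (tl t j) (tl t j′)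
      horiz t j j′ nx = valid t j , (refl , refl , refl) , link nx
        where
        link : ∀ {j′} → j′ ≡ 0 ⊎ j′ ≡ suc j → isZero j′ ≡ false → let a = tl t j ; b = tl t j′ in
          ln a ≡ lc b × rn a ≡ rc b × lp b ≡ lc a × rp b ≡ rc a × (d a ≡ true → d b ≡ true)
        link (inj₁ refl) ()
        link (inj₂ refl) e = refl , refl , refl , refl , mono t
          where
          mono : ∀ t → beyond t j ≡ true → beyond t (suc j) ≡ true
          mono zero e = dec-true (length x ℕₚ.≤? suc j) (ℕₚ.m≤n⇒m≤1+n (beyond⇒ {j} e))

      shifted : ∀ t j c q′ w m a′ →
        Shifted m w (tileFor t j c (q′ , w , m)) (tileFor (suc t) j (apply c (q′ , w , m)) a′)
      shifted t zero    ⟨ _ , l , _ , [] ⟩    q′ w right a′ = refl , refl , λ _ → refl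
      shifted t zero    ⟨ _ , l , _ , _ ∷ r ⟩ q′ w right a′ = refl , refl , λ _ → refl
      shifted t (suc j) ⟨ _ , l , _ , [] ⟩    q′ w right a′ = refl , refl , λ ()
      shifted t (suc j) ⟨ _ , l , _ , _ ∷ r ⟩ q′ w right a′ = refl , refl , λ ()
      shifted t zero    ⟨ _ , [] , _ , r ⟩    q′ w left  a′ = refl , refl , λ _ → refl
      shifted t zero    ⟨ _ , _ ∷ l , _ , r ⟩ q′ w left  a′ = refl , refl , λ _ → refl
      shifted t (suc j) ⟨ _ , [] , _ , r ⟩    q′ w left  a′ = refl , refl , λ ()
      shifted t (suc j) ⟨ _ , _ ∷ l , _ , r ⟩ q′ w left  a′ = refl , refl , λ ()
      shifted t j       ⟨ _ , l , _ , r ⟩     q′ w stay  a′ = refl , refl , λ _ → refl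

      vert : ∀ t j → Ver (tl t j) (tl (suc t) j)
      vert t j = subst (λ c → Ver (tl t j) (tileFor (suc t) j c (act (suc t)))) (sym (trace-step R t))
        ((λ ()) , λ _ → state-apply (cfg t) (act t) , shifted t j (cfg t) _ _ _ (act (suc t)))

      vert-wrap : ∀ j → Ver (tl T j) (tl 0 j)
      vert-wrap j = (λ _ → trans (sym (state-apply (cfg T) (act T)))
        (trans (cong Config.state (trans (sym (trace-step R T)) (trace-end R))) acc)) , λ ()

      cyc-cases : ∀ top j → cyc top j ≡ 0 × j ≡ top ⊎ cyc top j ≡ suc j
      cyc-cases top j with j ℕₚ.≟ top
      ... | yes refl = inj₁ (cyc-top j , refl)
      ... | no j≢    = inj₂ (cong (λ b → if b then 0 else suc j) (dec-false (j ℕₚ.≟ top) j≢))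

      tableau : Tableau T W x
      tableau .Tableau.tileAt = tl
      tableau .Tableau.z-at _ _ = refl
      tableau .Tableau.f-at _ _ = refl
      tableau .Tableau.hor-at {t} {j} _ _ = horiz t j _ (Data.Sum.map₁ proj₁ (cyc-cases W j))
      tableau .Tableau.ver-at {t} {j} _ _ with cyc-cases T t
      ... | inj₁ (e , refl) = subst (λ k → Ver (tl t j) (tl k j)) (sym e) (vert-wrap j)
      ... | inj₂ e          = subst (λ k → Ver (tl t j) (tl k j)) (sym e) (vert t j)
      tableau .Tableau.inp-at {j} _ = row0 j
      tableau .Tableau.end-at = dec-true (length x ℕₚ.≤? length x) ℕₚ.≤-refl

-- The reduction

data Axis : Set where
  space time : Axis

other : Axis → Axis
other space = time
other time  = space

-- Every pair kind has an index; `cell` uses index 0 only.  bit, car and sum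
-- are the bits of a coordinate, the carries of its increment and the bits of
-- the incremented coordinate; inp i marks the cell of row 0 that holds the
-- input bit followed by i - 3 others, and inp 2 the cell after the input; til a says that the cell has tile a.
data PairKind : Set where
  cell inp til : PairKind
  bit car sum  : Axis → PairKind

data Menu : Set where
  tiles adder : Menu

-- menu m is covered by the singletons item m 0, item m 1, ...
data UKind : Set where
  dom       : UKind
  menu item : Menu → UKind
  sgn       : Bool → PairKind → UKind

data BKind : Set where
  move add : Axis → BKind
  label    : BKind

finite-Axis : Finite Axis
finite-Axis = finite-retract (λ { space → false ; time → true }) (λ { false → space ; true → time })
  (λ { space → refl ; time → refl }) finite-Bool

finite-Menu : Finite Menu
finite-Menu = finite-retract (λ { tiles → false ; adder → true }) (λ { false → tiles ; true → adder })
  (λ { tiles → refl ; adder → refl }) finite-Bool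

finite-Trio : Finite (Maybe Bool)
finite-Trio = finite-Maybe finite-Bool

finite-PairKind : Finite PairKind
finite-PairKind = finite-retract
  (λ { cell → inj₁ nothing ; inp → inj₁ (just false) ; til → inj₁ (just true)
     ; (bit a) → inj₂ (a , nothing) ; (car a) → inj₂ (a , just false) ; (sum a) → inj₂ (a , just true) })
  (λ { (inj₁ nothing) → cell ; (inj₁ (just false)) → inp ; (inj₁ (just true)) → til
     ; (inj₂ (a , nothing)) → bit a ; (inj₂ (a , just false)) → car a ; (inj₂ (a , just true)) → sum a })
  (λ { cell → refl ; inp → refl ; til → refl ; (bit a) → refl ; (car a) → refl ; (sum a) → refl })
  (finite-⊎ finite-Trio (finite-× finite-Axis finite-Trio))

finite-UKind : Finite UKind
finite-UKind = finite-retract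
  (λ { dom → nothing ; (menu m) → just (inj₁ (false , m)) ; (item m) → just (inj₁ (true , m))
     ; (sgn b π) → just (inj₂ (b , π)) })
  (λ { nothing → dom ; (just (inj₁ (false , m))) → menu m ; (just (inj₁ (true , m))) → item m
     ; (just (inj₂ (b , π))) → sgn b π })
  (λ { dom → refl ; (menu m) → refl ; (item m) → refl ; (sgn b π) → refl })
  (finite-Maybe (finite-⊎ (finite-× finite-Bool finite-Menu) (finite-× finite-Bool finite-PairKind)))

finite-BKind : Finite BKind
finite-BKind = finite-retract
  (λ { label → nothing ; (move a) → just (false , a) ; (add a) → just (true , a) })
  (λ { nothing → label ; (just (false , a)) → move a ; (just (true , a)) → add a })
  (λ { label → refl ; (move a) → refl ; (add a) → refl })
  (finite-Maybe (finite-× finite-Bool finite-Axis))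

opaque

  codeU : UKind → ℕ
  codeU κ = toℕ (index finite-UKind κ)

  codeB : BKind → ℕ
  codeB κ = toℕ (index finite-BKind κ)

  codeU-injective : ∀ {κ κ′} → codeU κ ≡ codeU κ′ → κ ≡ κ′
  codeU-injective = index-injective finite-UKind ∘ Finₚ.toℕ-injective

  codeB-injective : ∀ {κ κ′} → codeB κ ≡ codeB κ′ → κ ≡ κ′
  codeB-injective = index-injective finite-BKind ∘ Finₚ.toℕ-injective

nameU : UKind → ℕ → ℕ
nameU κ = name (codeU κ)

nameB : BKind → ℕ → ℕ
nameB κ = name (codeB κ)

nameU-injective : ∀ {κ i κ′ i′} → nameU κ i ≡ nameU κ′ i′ → κ ≡ κ′ × i ≡ i′
nameU-injective {κ} {i} {κ′} {i′} e = map₁ codeU-injective (name-injective (codeU κ) i (codeU κ′) i′ e)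

nameB-injective : ∀ {κ i κ′ i′} → nameB κ i ≡ nameB κ′ i′ → κ ≡ κ′ × i ≡ i′
nameB-injective {κ} {i} {κ′} {i′} e = map₁ codeB-injective (name-injective (codeB κ) i (codeB κ′) i′ e)

infix 6 _at_ _atᵇ_
_at_ : UKind → Ix → Name
κ at ix = codeU κ , ix

_atᵇ_ : BKind → Ix → Name
κ atᵇ ix = codeB κ , ix

-- p ⊆ q;  p ∩ q = ∅;  |p ∩ q| ≥ C;  every p has an r-successor in q;  no p
-- has an r-successor in q
sub dis : Name → Name → Tree
sub p q = leaf (neg atMost (lit 0) p q)
dis p q = leaf (pos atMost (lit 0) p q)

has : Subscript → Name → Name → Tree
has C p q = leaf (pos atLeast C p q)

total ban : Name → Name → Name → Tree
total p r q = leaf (nest atMost (lit 0) p atMost (lit 0) q r)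
ban   p r q = leaf (nest atMost (lit 0) p atLeast (lit 1) q r)

finite-Row : Finite (Bool × Bool)
finite-Row = finite-× finite-Bool finite-Bool

-- Besides the cells, the domain `dom` contains equally many dummies, so that
-- both signs of every pair kind can be required to have exactly #cells elements
-- without fixing how many of these are cells.  Apart from `pair`, constraints
-- must not touch the dummies: they are stated through binary predicates that
-- need only hold between cells, or between cells and menu items.
module Reduction (M : NTM) (k : ℕ) where
  open Tiles M
  open NTM M using (nQ; g)
  open TM nQ g using (bitSym)

  #tiles : ℕ
  #tiles = size finite-Tile

  tileOf : Fin #tiles → Tile
  tileOf = elem finite-Tile

  menuSize : Menu → ℕ
  menuSize tiles = #tiles
  menuSize adder = size finite-Row

  -- `cells#` is 2^(1 + N^(k+1) + N^k), the number of coordinate pairs; `doubled#` also makes room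
  -- for the dummies.
  cells# doubled# : Subscript
  cells#   = big 0 (suc k ∷ k ∷ [])
  doubled# = big 1 (suc k ∷ k ∷ [])

  cellN : Name
  cellN = sgn true cell at abs 0

  pair : PairKind → Ix → Tree
  pair π ix = sub (sgn true π at ix) (dom at abs 0)
            & sub (sgn false π at ix) (dom at abs 0)
            & dis (sgn true π at ix) (sgn false π at ix)
            & has cells# (sgn true π at ix) (sgn true π at ix)
            & has cells# (sgn false π at ix) (sgn false π at ix)

  -- At most `menuSize m` elements, yet that many pairwise disjoint nonempty pieces: each piece is a
  -- single element, and together they exhaust the menu. A required successor in the menu thus
  -- expresses a disjunction over the pieces.
  menuTree : Menu → Tree
  menuTree m = leaf (pos atMost (lit (menuSize m)) (menu m at abs 0) (menu m at abs 0))
    & every (menuSize m) λ j →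
        sub (item m at abs (toℕ j)) (menu m at abs 0)
      & has (lit 1) (item m at abs (toℕ j)) (item m at abs (toℕ j))
      & every (menuSize m) λ i → when (not (does (i Finₚ.≟ j)))
          (dis (item m at abs (toℕ i)) (item m at abs (toℕ j)))

  -- The `add` successor of a cell names a row (b, c) of the truth table of a half adder. A cell
  -- that chose the row may not carry the opposite signs, so its bit and incoming carry match the
  -- row, and its sum and outgoing carry are dictated by it.
  rowTree : Axis → (ℕ → Ix) → Fin (menuSize adder) → Tree
  rowTree a ix j = let b , c = elem finite-Row j in
      ban (sgn (not b) (bit a) at ix 0) (add a atᵇ ix 0) (item adder at abs (toℕ j))
    & ban (sgn (not c) (car a) at ix 0) (add a atᵇ ix 0) (item adder at abs (toℕ j))
    & ban (sgn (not (b xor c)) (sum a) at ix 0) (add a atᵇ ix 0) (item adder at abs (toℕ j))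
    & ban (sgn (not (b ∧ c)) (car a) at ix 1) (add a atᵇ ix 0) (item adder at abs (toℕ j))

  -- A move along `a` turns the sum bits into the bits of the target; a move along the other axis
  -- copies the bits. The last bans deny the origin every row with bit 1, which gives it coordinate
  -- 0.
  block : Axis → (ℕ → Ix) → Tree
  block a ix =
      pair (bit a) (ix 0) & pair (sum a) (ix 0) & pair (car a) (ix 1)
    & total cellN (add a atᵇ ix 0) (menu adder at abs 0)
    & every (menuSize adder) (rowTree a ix)
    & ban (sgn true (sum a) at ix 0) (move a atᵇ abs 0) (sgn false (bit a) at ix 0)
    & ban (sgn false (sum a) at ix 0) (move a atᵇ abs 0) (sgn true (bit a) at ix 0)
    & ban (sgn true (bit a) at ix 0) (move (other a) atᵇ abs 0) (sgn false (bit a) at ix 0)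
    & ban (sgn false (bit a) at ix 0) (move (other a) atᵇ abs 0) (sgn true (bit a) at ix 0)
    -- `pow 1 0` is the index N: the first of N - 2 input bits is followed by N - 3 others. If the
    -- input is empty, N = 2 marks the cell after it, again column 0.
    & every (menuSize adder) λ j → when (proj₁ (elem finite-Row j))
        (ban (sgn true inp at pow 1 0) (add a atᵇ ix 0) (item adder at abs (toℕ j)))

  -- The index of the carry out of the highest bit. That carry is set exactly when a move leads back
  -- to coordinate 0, so `axisTree` uses it to fix the flag `z` or `f` of the tile that is reached.
  topIx : Axis → Ix
  topIx space = pow (suc k) 1
  topIx time  = pow k 0

  flag : Axis → Tile → Bool
  flag space = z
  flag time  = f

  axisTree : Axis → Tree
  axisTree a = pair (car a) (abs 0) & sub cellN (sgn true (car a) at abs 0)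
    & total cellN (move a atᵇ abs 0) cellN
    & every #tiles λ s →
        ban (sgn (not (flag a (tileOf s))) (car a) at topIx a) (move a atᵇ abs 0) (sgn true til at abs (toℕ s))

  tileTree : Tree
  tileTree = total cellN (label atᵇ abs 0) (menu tiles at abs 0)
    & every #tiles λ s → let a = tileOf s in
        pair til (abs (toℕ s))
      & ban (sgn false til at abs (toℕ s)) (label atᵇ abs 0) (item tiles at abs (toℕ s))
      & when (not (d a)) (ban (sgn true inp at abs 2) (label atᵇ abs 0) (item tiles at abs (toℕ s)))
      & every #tiles λ s′ → let b = tileOf s′ in
          when (not (does (hor? a b)))
            (ban (sgn true til at abs (toℕ s)) (move space atᵇ abs 0) (sgn true til at abs (toℕ s′)))
        & when (not (does (ver? a b)))
            (ban (sgn true til at abs (toℕ s)) (move time atᵇ abs 0) (sgn true til at abs (toℕ s′)))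

  fixedTree : Tree
  fixedTree = leaf (pos atMost doubled# (dom at abs 0) (dom at abs 0))
    & pair cell (abs 0) & menuTree tiles & menuTree adder
    & axisTree space & axisTree time & tileTree
    & pair inp (pow 1 0) & has (lit 1) (sgn true inp at pow 1 0) cellN

  inputTree : Bool → Tree
  inputTree b = pair inp (cur 0)
    & ban (sgn true inp at cur 1) (move space atᵇ abs 0) (sgn false inp at cur 0)
    & every #tiles λ s → when (not (does (rp (tileOf s) Finₚ.≟ bitSym b)))
        (ban (sgn true inp at cur 1) (label atᵇ abs 0) (item tiles at abs (toℕ s)))

  sections : List Section
  sections = once fixedTree ∷ loops k (block time cur) ∷ loops (suc k) (block space cur)
    -- The loop yields bits 0 to N^(k+1) - 1; this is the remaining one, matching the leading 1 in
    -- the exponent of a `big` subscript.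
    ∷ once (block space (pow (suc k))) ∷ input inputTree ∷ []

  reduction : List Bool → List N2
  reduction x = formulas (workspace x) sections

  reduction-poly-time : PolyTimeComputable (λ x → encSet (reduction x))
  reduction-poly-time = sections-poly-time sections

  width : ℕ → Axis → ℕ
  width N space = suc (N ^ suc k)
  width N time  = N ^ k

  record Facts (𝔄 : Structure) (x : List Bool) : Set where
    open Semantics 𝔄
    N = length (workspace x)
    field
      fixed  : Holds N 0 fixedTree
      blocks : ∀ a i → i < width N a → Holds N i (block a cur)
      inputs : ∀ j b → j < N → nth pad (workspace x) j ≡ ty b → Holds N j (inputTree b)

  module _ (𝔄 : Structure) (x : List Bool) where
    open Semantics 𝔄

    private
      ts = workspace x
      N = length ts

    last-block⁻ : Holds N 0 (block space (pow (suc k))) → Holds N (N ^ suc k) (block space cur)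
    last-block⁻ h = h

    last-block⁺ : Holds N (N ^ suc k) (block space cur) → Holds N 0 (block space (pow (suc k)))
    last-block⁺ h = h

    facts⁻ : All (HoldsS ts) sections → Facts 𝔄 x
    facts⁻ (fx ∷ bt ∷ bs ∷ be ∷ ip ∷ []) = record { fixed = fx ; blocks = blocks ; inputs = ip }
      where
      blocks : ∀ a i → i < width N a → Holds N i (block a cur)
      blocks time  i lt = bt i lt
      blocks space i lt = Data.Sum.[ bs i , (λ e → subst (λ i → Holds N i (block space cur)) (sym e) (last-block⁻ be)) ]′
        (ℕₚ.m≤n⇒m<n∨m≡n (ℕₚ.<⇒≤pred lt))

    facts⁺ : Facts 𝔄 x → All (HoldsS ts) sections
    facts⁺ F = fixed ∷ blocks time ∷ (λ i lt → blocks space i (ℕₚ.m<n⇒m<1+n lt))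
        ∷ last-block⁺ (blocks space (N ^ suc k) ℕₚ.≤-refl) ∷ inputs ∷ []
      where open Facts F hiding (N)

    reduction⁻ : All (𝔄 ⊨_) (reduction x) → Facts 𝔄 x
    reduction⁻ h = facts⁻ (sections⁻ ts sections h)

    reduction⁺ : Facts 𝔄 x → All (𝔄 ⊨_) (reduction x)
    reduction⁺ F = sections⁺ ts sections (facts⁺ F)

-- Binary counting

-- bitOf v i is the i-th binary digit of v, and carry v i says that the digits
-- of v below i are all 1.
bitOf carry : ℕ → ℕ → Bool
bitOf zero    i       = false
bitOf (suc v) i       = bitOf v i xor carry v i
carry v       zero    = true
carry v       (suc i) = bitOf v i ∧ carry v i

double : ℕ → ℕ
double zero    = zero
double (suc v) = suc (suc (double v))

xor-false : ∀ b → b xor false ≡ b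
xor-false false = refl
xor-false true  = refl

mutual
  bit-even-0 : ∀ v → bitOf (double v) 0 ≡ false
  bit-even-0 zero    = refl
  bit-even-0 (suc v) rewrite bit-even-0 v = refl

  -- Doubling shifts the digits. As `bitOf` is defined by increments, the induction takes two at a
  -- time: the first sets digit 0, the second clears it and carries into digit 1 just as an
  -- increment of v would.
  bit-even : ∀ v i → bitOf (double v) (suc i) ≡ bitOf v i
  bit-even zero    i = refl
  bit-even (suc v) i = cong₂ _xor_ (bit-odd v i) (carry-odd v i)

  carry-even : ∀ v i → carry (double v) (suc i) ≡ false
  carry-even v zero    rewrite bit-even-0 v = refl
  carry-even v (suc i) rewrite carry-even v i = ∧-false (bitOf (double v) (suc i))
    where
    ∧-false : ∀ b → b ∧ false ≡ false
    ∧-false false = refl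
    ∧-false true  = refl

  bit-odd-0 : ∀ v → bitOf (suc (double v)) 0 ≡ true
  bit-odd-0 v rewrite bit-even-0 v = refl

  bit-odd : ∀ v i → bitOf (suc (double v)) (suc i) ≡ bitOf v i
  bit-odd v i = trans (cong₂ _xor_ (bit-even v i) (carry-even v i)) (xor-false (bitOf v i))

  carry-odd : ∀ v i → carry (suc (double v)) (suc i) ≡ carry v i
  carry-odd v zero    rewrite bit-odd-0 v = refl
  carry-odd v (suc i) = cong₂ _∧_ (bit-odd v i) (carry-odd v i)

data Parity : ℕ → Set where
  even : ∀ v → Parity (double v)
  odd  : ∀ v → Parity (suc (double v))

parity : ∀ v → Parity v
parity zero    = even 0
parity (suc v) with parity v
... | even u = odd u
... | odd u  = even (suc u)

double≡2* : ∀ v → double v ≡ 2 * v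
double≡2* zero    = refl
double≡2* (suc v) = trans (cong (λ k → suc (suc k)) (double≡2* v)) (arith v)
  where
  arith : ∀ v → suc (suc (2 * v)) ≡ 2 * suc v
  arith = solve-∀

double-cancel-< : ∀ {v u} → double v < double u → v < u
double-cancel-< {v} {u} lt = ℕₚ.*-cancelˡ-< 2 v u (subst₂ _<_ (double≡2* v) (double≡2* u) lt)

half-bound : ∀ {v} w → double v < 2 ^ suc w → v < 2 ^ w
half-bound w lt = double-cancel-< (subst (_ <_) (sym (double≡2* (2 ^ w))) lt)

-- Digit 0 settles the parity, and the other digits are those of the half.
bits-injective : ∀ w {u v} → u < 2 ^ w → v < 2 ^ w → (∀ i → i < w → bitOf u i ≡ bitOf v i) → u ≡ v
bits-injective zero (s≤s z≤n) (s≤s z≤n) h = refl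
bits-injective (suc w) {u} {v} u< v< h with parity u | parity v
... | even u′ | even v′ = cong double (bits-injective w (half-bound w u<) (half-bound w v<) λ i lt →
  trans (sym (bit-even u′ i)) (trans (h (suc i) (s≤s lt)) (bit-even v′ i)))
... | odd u′  | odd v′  = cong (suc ∘ double) (bits-injective w
  (half-bound w (ℕₚ.<-trans ℕₚ.≤-refl u<)) (half-bound w (ℕₚ.<-trans ℕₚ.≤-refl v<)) λ i lt →
  trans (sym (bit-odd u′ i)) (trans (h (suc i) (s≤s lt)) (bit-odd v′ i)))
... | even u′ | odd v′
  with () ← trans (sym (bit-even-0 u′)) (trans (h 0 (s≤s z≤n)) (bit-odd-0 v′))
... | odd u′  | even v′
  with () ← trans (sym (bit-odd-0 u′)) (trans (h 0 (s≤s z≤n)) (bit-even-0 v′))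

bits-2^ : ∀ w i → i < w → bitOf (2 ^ w) i ≡ false
bits-2^ (suc w) i lt = trans (cong (λ v → bitOf v i) (sym (double≡2* (2 ^ w)))) (go i lt)
  where
  go : ∀ i → i < suc w → bitOf (double (2 ^ w)) i ≡ false
  go zero    lt       = bit-even-0 (2 ^ w)
  go (suc i) (s≤s lt) = trans (bit-even (2 ^ w) i) (bits-2^ w i lt)

carry-top : ∀ w {v} → suc v ≡ 2 ^ w → carry v w ≡ true
carry-top zero    e = refl
carry-top (suc w) {v} e with parity v
... | odd u  = trans (carry-odd u w) (carry-top w (ℕₚ.*-cancelˡ-≡ (suc u) (2 ^ w) 2 (trans (sym (double≡2* (suc u))) e)))
... | even u = ⊥-elim (odd≢even u (2 ^ w) (trans e (sym (double≡2* (2 ^ w)))))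
  where
  odd≢even : ∀ u v → suc (double u) ≢ double v
  odd≢even (suc u) (suc v) e = odd≢even u v (ℕₚ.suc-injective (ℕₚ.suc-injective e))

carry-below : ∀ w {v} → suc v < 2 ^ w → carry v w ≡ false
carry-below zero (s≤s ())
carry-below (suc w) {v} lt with parity v
... | even u = carry-even u w
... | odd u  = trans (carry-odd u w) (carry-below w (half-bound w lt))

cyc-≤ : ∀ {top v} → v ≤ top → cyc top v ≤ top
cyc-≤ {top} {v} le with ℕₚ.m≤n⇒m<n∨m≡n le
... | inj₁ v<   rewrite cyc-suc v<  = v<
... | inj₂ refl rewrite cyc-top top = z≤n

cyc-pred : ∀ {top v} → v ≤ top → ∃ λ v₀ → v₀ ≤ top × cyc top v₀ ≡ v
cyc-pred {top} {zero}  le = top , ℕₚ.≤-refl , cyc-top top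
cyc-pred {top} {suc v} le = v , ℕₚ.<⇒≤ le , cyc-suc le

module _ {w top : ℕ} (top-eq : suc top ≡ 2 ^ w) where

  carry-cyc : ∀ {v} → v ≤ top → carry v w ≡ isZero (cyc top v)
  carry-cyc {v} le with ℕₚ.m≤n⇒m<n∨m≡n le
  ... | inj₁ lt   rewrite cyc-suc lt  = carry-below w (subst (suc v <_) top-eq (s≤s lt))
  ... | inj₂ refl rewrite cyc-top top = carry-top w top-eq

  -- At the top, 2^w and 0 agree on all digits below w, so the adder needs no case for the wrap.
  bits-cyc : ∀ {v} → v ≤ top → ∀ i → i < w → bitOf (cyc top v) i ≡ bitOf (suc v) i
  bits-cyc {v} le i lt with ℕₚ.m≤n⇒m<n∨m≡n le
  ... | inj₁ v<   rewrite cyc-suc v<  = refl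
  ... | inj₂ refl rewrite cyc-top top = sym (trans (cong (λ u → bitOf u i) top-eq) (bits-2^ w i lt))

-- Counting quantifiers, and classical reasoning under double negation

infixl 1 _>>=_
_>>=_ : ∀ {A B : Set} → ¬ ¬ A → (A → ¬ ¬ B) → ¬ ¬ B
(m >>= f) k = m λ a → f a k

pure : ∀ {A : Set} → A → ¬ ¬ A
pure a k = k a

¬¬-all : ∀ n {P : Fin n → Set} → (∀ i → ¬ ¬ P i) → ¬ ¬ (∀ i → P i)
¬¬-all zero    h = pure λ ()
¬¬-all (suc n) h = do
  p ← h fz
  q ← ¬¬-all n (λ i → h (fs i))
  pure λ { fz → p ; (fs i) → q i }

¬¬-below : ∀ n {P : ℕ → Set} → (∀ i → i < n → ¬ ¬ P i) → ¬ ¬ (∀ i → i < n → P i)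
¬¬-below zero    h = pure λ i ()
¬¬-below (suc n) {P} h = do
  p ← h n ℕₚ.≤-refl
  q ← ¬¬-below n (λ i lt → h i (ℕₚ.m<n⇒m<1+n lt))
  pure λ i lt → [ q i , (λ e → subst P (sym e) p) ]′ (ℕₚ.m≤n⇒m<n∨m≡n (ℕₚ.<⇒≤pred lt))

-- Double negation commutes with quantification over a finite range, so a whole family can be picked
-- although each member exists only up to double negation. Outside the range the default `a` is
-- used.
¬¬-choice : ∀ n {A : Set} {P : ℕ → A → Set} → A → (∀ i → i < n → ¬ ¬ ∃ (P i)) →
  ¬ ¬ (∃ λ g → ∀ i → i < n → P i (g i))
¬¬-choice n {A} {P} a h = do
  q ← ¬¬-below n h
  pure ((λ i → pick i (i ℕₚ.<? n) q) , λ i lt → ok i lt (i ℕₚ.<? n) q)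
  where
  pick : ∀ i → Dec (i < n) → (∀ i → i < n → ∃ (P i)) → A
  pick i (yes lt) q = proj₁ (q i lt)
  pick i (no _)   q = a
  ok : ∀ i → i < n → (dec : Dec (i < n)) → (q : ∀ i → i < n → ∃ (P i)) → P i (pick i dec q)
  ok i lt (yes lt′) q = proj₂ (q i lt′)
  ok i lt (no nlt)  q = ⊥-elim (nlt lt)

-- A y missed by `G` would be element number C + 1.
atMost-cover : ∀ {D : Set} {P : D → Set} {C} → AtMost C P →
  (G : Fin C → D) → Injective _≡_ _≡_ G → (∀ i → P (G i)) → ∀ y → P y → ¬ ¬ ∃ λ i → G i ≡ y
atMost-cover {D} {P} {C} most G inj all y Py none = most (G′ , inj′ , all′)
  where
  G′ : Fin (suc C) → D
  G′ fz     = y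
  G′ (fs i) = G i
  inj′ : Injective _≡_ _≡_ G′
  inj′ {fz}   {fz}   e = refl
  inj′ {fz}   {fs j} e = ⊥-elim (none (j , sym e))
  inj′ {fs i} {fz}   e = ⊥-elim (none (i , e))
  inj′ {fs i} {fs j} e = cong fs (inj e)
  all′ : ∀ i → P (G′ i)
  all′ fz     = Py
  all′ (fs i) = all i

atMost-cover-⊎ : ∀ {D : Set} {P : D → Set} {B C} → AtMost (B + C) P →
  (G : Fin B → D) (G′ : Fin C → D) → Injective _≡_ _≡_ G → Injective _≡_ _≡_ G′ → (∀ i j → G i ≢ G′ j) →
  (∀ i → P (G i)) → (∀ j → P (G′ j)) → ∀ y → P y → ¬ ¬ ((∃ λ i → G i ≡ y) ⊎ (∃ λ j → G′ j ≡ y))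
atMost-cover-⊎ {D} {P} {B} {C} most G G′ inj inj′ apart all all′ y Py = do
  i , e ← atMost-cover most both both-inj both-all y Py
  pure (split (Fin.splitAt B i) e)
  where
  choose : Fin B ⊎ Fin C → D
  choose = [ G , G′ ]′
  both : Fin (B + C) → D
  both i = choose (Fin.splitAt B i)
  choose-inj : ∀ s s′ → choose s ≡ choose s′ → s ≡ s′
  choose-inj (inj₁ i) (inj₁ j) e = cong inj₁ (inj e)
  choose-inj (inj₁ i) (inj₂ j) e = ⊥-elim (apart i j e)
  choose-inj (inj₂ i) (inj₁ j) e = ⊥-elim (apart j i (sym e))
  choose-inj (inj₂ i) (inj₂ j) e = cong inj₂ (inj′ e)
  both-inj : Injective _≡_ _≡_ both
  both-inj {i} {j} e = trans (sym (Finₚ.join-splitAt B C i))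
    (trans (cong (Fin.join B C) (choose-inj (Fin.splitAt B i) (Fin.splitAt B j) e)) (Finₚ.join-splitAt B C j))
  choose-all : ∀ s → P (choose s)
  choose-all (inj₁ i) = all i
  choose-all (inj₂ j) = all′ j
  both-all : ∀ i → P (both i)
  both-all i = choose-all (Fin.splitAt B i)
  split : ∀ s → choose s ≡ y → (∃ λ i → G i ≡ y) ⊎ (∃ λ j → G′ j ≡ y)
  split (inj₁ i) e = inj₁ (i , e)
  split (inj₂ j) e = inj₂ (j , e)

atLeast-one : ∀ {D : Set} (P : D → Set) {x} → P x → AtLeast 1 P
atLeast-one P {x} p = (λ _ → x) , (λ { {fz} {fz} _ → refl }) , λ _ → p

module Meaning (𝔄 : Structure) where
  open Structure 𝔄

  sub⁻ : ∀ p q → 𝔄 ⊨ cntNeg atMost 0 p q → ∀ {x} → U p x → ¬ ¬ U q x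
  sub⁻ p q h px nqx = h (atLeast-one (λ x → U p x × ¬ U q x) (px , nqx))

  dis⁻ : ∀ p q → 𝔄 ⊨ cntPos atMost 0 p q → ∀ {x} → U p x → U q x → ⊥
  dis⁻ p q h px qx = h (atLeast-one (λ x → U p x × U q x) (px , qx))

  -- The formula says that no x lacks a successor, hence only a doubly negated witness is available.
  total⁻ : ∀ p r q → 𝔄 ⊨ cntNest atMost 0 p atMost 0 q r → ∀ {x} → U p x → ¬ ¬ ∃ λ y → U q y × B r x y
  total⁻ p r q h px none = h (atLeast-one (λ x → U p x × AtMost 0 (λ y → U q y × B r x y)) (px , λ { (G , _ , all) → none (G fz , all fz) }))

  ban⁻ : ∀ p r q → 𝔄 ⊨ cntNest atMost 0 p atLeast 1 q r → ∀ {x y} → U p x → U q y → B r x y → ⊥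
  ban⁻ p r q h px qy rxy = 
    h (atLeast-one (λ x → U p x × AtLeast 1 (λ y → U q y × B r x y)) (px , atLeast-one (λ y → U q y × B r _ y) (qy , rxy)))

  sub⁺ : ∀ p q → (∀ x → U p x → U q x) → 𝔄 ⊨ cntNeg atMost 0 p q
  sub⁺ p q h (G , _ , all) = proj₂ (all fz) (h _ (proj₁ (all fz)))

  dis⁺ : ∀ p q → (∀ x → U p x → U q x → ⊥) → 𝔄 ⊨ cntPos atMost 0 p q
  dis⁺ p q h (G , _ , all) = h _ (proj₁ (all fz)) (proj₂ (all fz))

  total⁺ : ∀ p r q → (∀ x → U p x → ∃ λ y → U q y × B r x y) → 𝔄 ⊨ cntNest atMost 0 p atMost 0 q r
  total⁺ p r q h (G , _ , all) = proj₂ (all fz) (atLeast-one (λ y → U q y × B r _ y) (proj₂ (h _ (proj₁ (all fz)))))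

  ban⁺ : ∀ p r q → (∀ x y → U p x → U q y → B r x y → ⊥) → 𝔄 ⊨ cntNest atMost 0 p atLeast 1 q r
  ban⁺ p r q h (G , _ , all) =
    let px , (G′ , _ , all′) = all fz in h _ _ px (proj₁ (all′ fz)) (proj₂ (all′ fz))

-- From models to tableaux

not-not-≡ : ∀ b b′ → b′ ≢ not b → b ≡ b′
not-not-≡ false false h = refl
not-not-≡ false true  h = ⊥-elim (h refl)
not-not-≡ true  false h = ⊥-elim (h refl)
not-not-≡ true  true  h = refl

nth-++ : ∀ {A : Set} (a : A) xs y {zs} → nth a (xs ++ y ∷ zs) (length xs) ≡ y
nth-++ a []       y = refl
nth-++ a (x ∷ xs) y = nth-++ a xs y

nth-map : ∀ {A B : Set} (h : A → B) a b xs {p} → p < length xs → nth b (map h xs) p ≡ h (nth a xs p)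
nth-map h a b (x ∷ xs) {zero}  lt       = refl
nth-map h a b (x ∷ xs) {suc p} (s≤s lt) = nth-map h a b xs lt

-- Bit p precedes n - 1 - p others in x and follows as many in the reversed list; the two pads move
-- it to position N - 1 - p.
workspace-bit : ∀ x p → p < length x →
  nth pad (workspace x) (length (workspace x) ∸ suc p) ≡ ty (nth false x p)
workspace-bit x p lt with split-at false x lt
... | ys , zs , e , f = begin
  nth pad (workspace x) (length (workspace x) ∸ suc p)
    ≡⟨ cong (nth pad (workspace x)) idx ⟩
  nth pad (reverse (map ty x)) (length (reverse (map ty zs)))
    ≡⟨ cong (λ w → nth pad w (length (reverse (map ty zs)))) shape ⟩
  nth pad (reverse (map ty zs) ++ ty b ∷ reverse (map ty ys)) (length (reverse (map ty zs)))
    ≡⟨ nth-++ pad (reverse (map ty zs)) (ty b) ⟩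
  ty b ∎
  where
  open ≡-Reasoning
  b = nth false x p
  len-rev : ∀ v → length (reverse (map ty v)) ≡ length v
  len-rev v = trans (Listₚ.length-reverse (map ty v)) (Listₚ.length-map ty v)
  idx : length (workspace x) ∸ suc p ≡ 2 + length (reverse (map ty zs))
  idx = begin
    length (workspace x) ∸ suc p
      ≡⟨ cong (λ l → 2 + l ∸ suc p) (trans (len-rev x) (trans (cong length e) (Listₚ.length-++ ys))) ⟩
    2 + (length ys + suc (length zs)) ∸ suc p
      ≡⟨ cong (λ l → 2 + (l + suc (length zs)) ∸ suc p) f ⟩
    2 + (p + suc (length zs)) ∸ suc p
      ≡⟨ cong (_∸ suc p) (arith p (length zs)) ⟩
    suc p + (2 + length zs) ∸ suc p
      ≡⟨ ℕₚ.m+n∸m≡n (suc p) (2 + length zs) ⟩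
    2 + length zs
      ≡⟨ cong (2 +_) (len-rev zs) ⟨
    2 + length (reverse (map ty zs)) ∎
    where
    arith : ∀ p l → 2 + (p + suc l) ≡ suc p + (2 + l)
    arith = solve-∀
  shape : reverse (map ty x) ≡ reverse (map ty zs) ++ ty b ∷ reverse (map ty ys)
  shape = begin
    reverse (map ty x)                             ≡⟨ cong (reverse ∘ map ty) e ⟩
    reverse (map ty (ys ++ b ∷ zs))                ≡⟨ cong reverse (Listₚ.map-++ ty ys (b ∷ zs)) ⟩
    reverse (map ty ys ++ ty b ∷ map ty zs)        ≡⟨ Listₚ.reverse-++ (map ty ys) (ty b ∷ map ty zs) ⟩
    reverse (ty b ∷ map ty zs) ++ reverse (map ty ys)
      ≡⟨ cong (_++ reverse (map ty ys)) (Listₚ.unfold-reverse (ty b) (map ty zs)) ⟩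
    (reverse (map ty zs) ++ [ ty b ]) ++ reverse (map ty ys)
      ≡⟨ Listₚ.++-assoc (reverse (map ty zs)) [ ty b ] (reverse (map ty ys)) ⟩
    reverse (map ty zs) ++ ty b ∷ reverse (map ty ys) ∎

module Counts (M : NTM) (k N : ℕ) where
  open Reduction M k

  #cells : ℕ
  #cells = evalSubscript N 0 cells#

  #cells-eq : #cells ≡ 2 ^ width N space * 2 ^ width N time
  #cells-eq = trans (number-2^ (N ^ suc k + (N ^ k + 0)))
    (trans (cong (λ e → 2 ^ suc (N ^ suc k + e)) (ℕₚ.+-identityʳ (N ^ k)))
      (ℕₚ.^-distribˡ-+-* 2 (suc (N ^ suc k)) (N ^ k)))

  doubled-eq : evalSubscript N 0 doubled# ≡ #cells + #cells
  doubled-eq = trans (number-2^ (suc (N ^ suc k + (N ^ k + 0))))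
    (trans (cong (2 ^ suc (N ^ suc k + (N ^ k + 0)) +_) (ℕₚ.+-identityʳ _))
      (sym (cong₂ _+_ (number-2^ (N ^ suc k + (N ^ k + 0))) (number-2^ (N ^ suc k + (N ^ k + 0))))))

  topOf : Axis → ℕ
  topOf a = Data.Nat.pred (2 ^ width N a)

  top-eq : ∀ a → suc (topOf a) ≡ 2 ^ width N a
  top-eq a = ℕₚ.suc-pred (2 ^ width N a) {{ℕₚ.m^n≢0 2 (width N a)}}

  module _ (2≤N : 2 ≤ N) where

    width-gap : 2 + width N time ≤ width N space
    width-gap = s≤s (ℕₚ.≤-trans (ℕₚ.+-monoˡ-≤ (N ^ k) (ℕₚ.m^n>0 N {{N≢0 2≤N}} k))
      (ℕₚ.≤-trans (ℕₚ.≤-reflexive (cong (N ^ k +_) (sym (ℕₚ.+-identityʳ (N ^ k))))) (ℕₚ.*-monoˡ-≤ (N ^ k) 2≤N)))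

    space-exceeds-time : 2 + topOf time ≤ topOf space
    space-exceeds-time = ℕₚ.≤-pred (begin
      3 + topOf time            ≡⟨ cong (2 +_) (top-eq time) ⟩
      2 + T                     ≤⟨ ℕₚ.+-monoˡ-≤ T (ℕₚ.*-monoʳ-≤ 2 (ℕₚ.m^n>0 2 (width N time))) ⟩
      2 * T + T                 ≤⟨ ℕₚ.+-monoʳ-≤ (2 * T) (ℕₚ.m≤m+n T (T + 0)) ⟩
      2 * T + 2 * T             ≡⟨ arith T ⟩
      2 ^ (2 + width N time)    ≤⟨ ℕₚ.^-monoʳ-≤ 2 width-gap ⟩
      2 ^ width N space         ≡⟨ top-eq space ⟨
      suc (topOf space)         ∎)
      where
      open ℕₚ.≤-Reasoning
      T = 2 ^ width N time
      arith : ∀ T → 2 * T + 2 * T ≡ 2 * (2 * T)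
      arith = solve-∀

    space-exceeds-N : N ≤ topOf space
    space-exceeds-N = ℕₚ.≤-pred (begin
      suc N                 ≤⟨ s≤s (ℕₚ.m≤m*n N (N ^ k) {{ℕₚ.m^n≢0 N k {{N≢0 2≤N}}}}) ⟩
      width N space         ≤⟨ n≤2^n (width N space) ⟩
      2 ^ width N space     ≡⟨ top-eq space ⟨
      suc (topOf space)     ∎)
      where open ℕₚ.≤-Reasoning

module Extract (M : NTM) (k : ℕ) (x : List Bool) (𝔄 : Structure) (F : Reduction.Facts M k 𝔄 x) where
  open Tiles M
  open Reduction M k
  open Structure 𝔄
  open Semantics 𝔄
  open Meaning 𝔄
  open Facts F
  open Counts M k N
  open NTM M using (nQ; g)
  open TM nQ g using (bitSym) renaming (blank to ␣)

  u : UKind → ℕ → Dom → Set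
  u κ i = U (nameU κ i)

  r : BKind → ℕ → Dom → Dom → Set
  r κ i = B (nameB κ i)

  Pair : PairKind → ℕ → Set
  Pair π i = Holds N 0 (pair π (abs i))

  Cell Dm : Dom → Set
  Cell = u (sgn true cell) 0
  Dm   = u dom 0

  pair-dom : ∀ {π i} → Pair π i → ∀ b {y} → u (sgn b π) i y → ¬ ¬ Dm y
  pair-dom {π} {i} (h , _) true  = sub⁻ (nameU (sgn true π) i) (nameU dom 0) h
  pair-dom {π} {i} (_ , h , _) false = sub⁻ (nameU (sgn false π) i) (nameU dom 0) h

  pair-excl : ∀ {π i} → Pair π i → ∀ b b′ {y} → u (sgn b π) i y → u (sgn b′ π) i y → b ≡ b′
  pair-excl P false false p q = refl
  pair-excl P true  true  p q = refl
  pair-excl {π} {i} (_ , _ , h , _) true  false p q =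
    ⊥-elim (dis⁻ (nameU (sgn true π) i) (nameU (sgn false π) i) h p q)
  pair-excl {π} {i} (_ , _ , h , _) false true  p q =
    ⊥-elim (dis⁻ (nameU (sgn true π) i) (nameU (sgn false π) i) h q p)

  dom-most : AtMost (#cells + #cells) Dm
  dom-most (G , inj , all) = subst (λ c → AtMost c (λ y → Dm y × Dm y)) doubled-eq (proj₁ fixed)
    (G , inj , λ i → all i , all i)

  -- The two signs are disjoint and supply `#cells` elements each, which uses up all of `dom`.
  halves : ∀ {π i} → Pair π i → (G G′ : Fin #cells → Dom) → Injective _≡_ _≡_ G → Injective _≡_ _≡_ G′ →
    (∀ j → u (sgn true π) i (G j)) → (∀ j → u (sgn false π) i (G′ j)) → ∀ {y} → Dm y →
    ¬ ¬ ((∃ λ j → G j ≡ y) ⊎ (∃ λ j → G′ j ≡ y))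
  halves {π} {i} P G G′ inj inj′ all all′ {y} Dy = do
    D₁ ← ¬¬-all #cells (λ j → pair-dom P true (all j))
    D₂ ← ¬¬-all #cells (λ j → pair-dom P false (all′ j))
    atMost-cover-⊎ dom-most G G′ inj inj′ apart D₁ D₂ y Dy
    where
    apart : ∀ j j′ → G j ≢ G′ j′
    apart j j′ e with () ← pair-excl P true false (all j) (subst (u (sgn false π) i) (sym e) (all′ j′))

  pair-cover : ∀ {π i} → Pair π i → ∀ {y} → Dm y → ¬ ¬ ∃ λ b → u (sgn b π) i y
  pair-cover {π} {i} P@(_ , _ , _ , (G , inj , all) , (G′ , inj′ , all′)) Dy = do
    inj₁ (j , refl) ← halves P G G′ inj inj′ (λ j → proj₁ (all j)) (λ j → proj₁ (all′ j)) Dy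
      where inj₂ (j , refl) → pure (false , proj₁ (all′ j))
    pure (true , proj₁ (all j))

  -- Here counting replaces negation: bans can only forbid a sign, and since the pair exhausts
  -- `dom`, forbidding one sign yields the other.
  force : ∀ {π i} → Pair π i → ∀ b {y} → Dm y → ¬ u (sgn (not b) π) i y → ¬ ¬ u (sgn b π) i y
  force {π} {i} P b {y} Dy no-b = do
    b′ , h ← pair-cover P Dy
    pure (subst (λ b → u (sgn b π) i y) (sym (not-not-≡ b b′ λ { refl → no-b h })) h)

  force-≡ : ∀ {π i b′} b {y} → u (sgn b′ π) i y → ¬ u (sgn (not b) π) i y → b ≡ b′
  force-≡ {b′ = b′} b h no-b = not-not-≡ b b′ λ { refl → no-b h }

  pair-cell : Pair cell 0
  pair-cell = proj₁ (proj₂ fixed)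

  cell-dom : ∀ {y} → Cell y → ¬ ¬ Dm y
  cell-dom = pair-dom pair-cell true

  menus : ∀ m → Holds N 0 (menuTree m)
  menus tiles = proj₁ (proj₂ (proj₂ fixed))
  menus adder = proj₁ (proj₂ (proj₂ (proj₂ fixed)))

  axes : ∀ a → Holds N 0 (axisTree a)
  axes space = proj₁ (proj₂ (proj₂ (proj₂ (proj₂ fixed))))
  axes time  = proj₁ (proj₂ (proj₂ (proj₂ (proj₂ (proj₂ fixed)))))

  tiling : Holds N 0 tileTree
  tiling = proj₁ (proj₂ (proj₂ (proj₂ (proj₂ (proj₂ (proj₂ fixed))))))

  start-exists : AtLeast 1 (λ y → u (sgn true inp) (N ^ 1) y × Cell y)
  start-exists = proj₂ (proj₂ (proj₂ (proj₂ (proj₂ (proj₂ (proj₂ (proj₂ fixed)))))))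

  -- One witness is taken from each item. Disjoint items have distinct witnesses, so these are as
  -- many as the menu may have elements.
  menu-cover : ∀ m {y} → u (menu m) 0 y → ¬ ¬ ∃ λ j → u (item m) (toℕ j) y
  menu-cover m {y} My = do
    inMenu ← ¬¬-all (menuSize m) λ j →
      sub⁻ (nameU (item m) (toℕ j)) (nameU (menu m) 0) (proj₁ (items j)) (it j)
    j , refl ← atMost-cover (proj₁ (menus m)) w w-inj (λ j → inMenu j , inMenu j) y (My , My)
    pure (j , it j)
    where
    items = proj₂ (menus m)
    w : Fin (menuSize m) → Dom
    w j = proj₁ (proj₁ (proj₂ (items j))) fz
    it : ∀ j → u (item m) (toℕ j) (w j)
    it j = proj₁ (proj₂ (proj₂ (proj₁ (proj₂ (items j)))) fz)
    w-inj : Injective _≡_ _≡_ w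
    w-inj {i} {j} e with i Finₚ.≟ j
    ... | yes i≡j = i≡j
    ... | no i≢j  = ⊥-elim (dis⁻ (nameU (item m) (toℕ i)) (nameU (item m) (toℕ j))
      (proj₂ (proj₂ (items j)) i (cong not (dec-false (i Finₚ.≟ j) i≢j))) (it i) (subst (u (item m) (toℕ j)) (sym e) (it j)))

  module Block (a : Axis) (i : ℕ) (lt : i < width N a) where
    pair-bit : Pair (bit a) i
    pair-bit = proj₁ (blocks a i lt)
    pair-sum : Pair (sum a) i
    pair-sum = proj₁ (proj₂ (blocks a i lt))
    pair-car : Pair (car a) (suc i)
    pair-car = proj₁ (proj₂ (proj₂ (blocks a i lt)))

    private
      rest = proj₂ (proj₂ (proj₂ (blocks a i lt)))

    choose : ∀ {y} → Cell y → ¬ ¬ ∃ λ m → u (menu adder) 0 m × r (add a) i y m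
    choose = total⁻ (nameU (sgn true cell) 0) (nameB (add a) i) (nameU (menu adder) 0) (proj₁ rest)

    rows : ∀ j → Holds N i (rowTree a cur j)
    rows = proj₁ (proj₂ rest)

    step-ban : ∀ b {y y′} → u (sgn b (sum a)) i y → r (move a) 0 y y′ → ¬ u (sgn (not b) (bit a)) i y′
    step-ban true  s m n = ban⁻ (nameU (sgn true (sum a)) i) (nameB (move a) 0) (nameU (sgn false (bit a)) i)
      (proj₁ (proj₂ (proj₂ rest))) s n m
    step-ban false s m n = ban⁻ (nameU (sgn false (sum a)) i) (nameB (move a) 0) (nameU (sgn true (bit a)) i)
      (proj₁ (proj₂ (proj₂ (proj₂ rest)))) s n m

    keep-ban : ∀ b {y y′} → u (sgn b (bit a)) i y → r (move (other a)) 0 y y′ → ¬ u (sgn (not b) (bit a)) i y′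
    keep-ban true  s m n = ban⁻ (nameU (sgn true (bit a)) i) (nameB (move (other a)) 0) (nameU (sgn false (bit a)) i)
      (proj₁ (proj₂ (proj₂ (proj₂ (proj₂ rest))))) s n m
    keep-ban false s m n = ban⁻ (nameU (sgn false (bit a)) i) (nameB (move (other a)) 0) (nameU (sgn true (bit a)) i)
      (proj₁ (proj₂ (proj₂ (proj₂ (proj₂ (proj₂ rest)))))) s n m

    start-bit : ∀ {y} → Cell y → u (sgn true inp) (N ^ 1) y → ¬ ¬ u (sgn false (bit a)) i y
    start-bit {y} Cy Iy = do
      m , Mm , ym ← choose Cy
      j , jm ← menu-cover adder Mm
      Dy ← cell-dom Cy
      force pair-bit false Dy λ n → conclude (proj₁ (elem finite-Row j))
        (λ e → ban⁻ (nameU (sgn true inp) (N ^ 1)) (nameB (add a) i) (nameU (item adder) (toℕ j))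
          (proj₂ (proj₂ (proj₂ (proj₂ (proj₂ (proj₂ rest))))) j e) Iy jm ym)
        (λ n → ban⁻ (nameU (sgn (not (proj₁ (elem finite-Row j))) (bit a)) i) (nameB (add a) i)
          (nameU (item adder) (toℕ j)) (proj₁ (rows j)) n jm ym) n
      where
      conclude : ∀ b → (b ≡ true → ⊥) → ¬ u (sgn (not b) (bit a)) i y → u (sgn true (bit a)) i y → ⊥
      conclude true  h k n = h refl
      conclude false h k n = k n

    add-step : ∀ {b c y} → Cell y → u (sgn b (bit a)) i y → u (sgn c (car a)) i y →
      ¬ ¬ (u (sgn (b xor c) (sum a)) i y × u (sgn (b ∧ c) (car a)) (suc i) y)
    add-step {b} {c} {y} Cy hb hc = do
      m , Mm , ym ← choose Cy
      j , jm ← menu-cover adder Mm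
      Dy ← cell-dom Cy
      let b′ , c′ = elem finite-Row j
          h₁ , h₂ , h₃ , h₄ = rows j
          banned : ∀ v π i′ → Holds N i (ban (codeU (sgn (not v) π) , abs i′) (add a atᵇ cur 0) (item adder at abs (toℕ j))) →
            ¬ u (sgn (not v) π) i′ y
          banned v π i′ h p = ban⁻ (nameU (sgn (not v) π) i′) (nameB (add a) i) (nameU (item adder) (toℕ j)) h p jm ym
      conclude b′ c′ Dy (banned b′ (bit a) i h₁) (banned c′ (car a) i h₂)
        (banned (b′ xor c′) (sum a) i h₃) (banned (b′ ∧ c′) (car a) (suc i) h₄)
      where
      conclude : ∀ b′ c′ → Dm y → ¬ u (sgn (not b′) (bit a)) i y → ¬ u (sgn (not c′) (car a)) i y →
        ¬ u (sgn (not (b′ xor c′)) (sum a)) i y → ¬ u (sgn (not (b′ ∧ c′)) (car a)) (suc i) y →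
        ¬ ¬ (u (sgn (b xor c) (sum a)) i y × u (sgn (b ∧ c) (car a)) (suc i) y)
      conclude b′ c′ Dy n₁ n₂ n₃ n₄ with force-≡ b′ hb n₁ | force-≡ c′ hc n₂
      ... | refl | refl = do
        s ← force pair-sum (b xor c) Dy n₃
        t ← force pair-car (b ∧ c) Dy n₄
        pure (s , t)

  -- Only digits below the width are recorded, so v stands for its residue modulo 2^width, and moves
  -- can be counted by `suc` with no case for the wrap.
  Coord : Axis → ℕ → Dom → Set
  Coord a v y = ∀ i → i < width N a → u (sgn (bitOf v i) (bit a)) i y

  pair-car : ∀ a i → i ≤ width N a → Pair (car a) i
  pair-car a zero    le = proj₁ (axes a)
  pair-car a (suc i) le = Block.pair-car a i le

  carries : ∀ a v {y} → Cell y → Coord a v y → ∀ i → i ≤ width N a → ¬ ¬ u (sgn (carry v i) (car a)) i y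
  carries a v Cy h zero    le =
    sub⁻ (nameU (sgn true cell) 0) (nameU (sgn true (car a)) 0) (proj₁ (proj₂ (axes a))) Cy
  carries a v Cy h (suc i) le = do
    c ← carries a v Cy h i (ℕₚ.<⇒≤ le)
    _ , c′ ← Block.add-step a i le Cy (h i le) c
    pure c′

  moved : ∀ a v {y y′} → Cell y → Coord a v y → Cell y′ → r (move a) 0 y y′ → ¬ ¬ Coord a (suc v) y′
  moved a v Cy h Cy′ m = ¬¬-below (width N a) λ i lt → do
    c ← carries a v Cy h i (ℕₚ.<⇒≤ lt)
    s , _ ← Block.add-step a i lt Cy (h i lt) c
    Dy′ ← cell-dom Cy′
    force (Block.pair-bit a i lt) _ Dy′ (Block.step-ban a i lt _ s m)

  kept : ∀ a v {y y′} → Coord a v y → Cell y′ → r (move (other a)) 0 y y′ → ¬ ¬ Coord a v y′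
  kept a v h Cy′ m = ¬¬-below (width N a) λ i lt → do
    Dy′ ← cell-dom Cy′
    force (Block.pair-bit a i lt) _ Dy′ (Block.keep-ban a i lt _ (h i lt) m)

  coord-unique : ∀ a v v′ {y} → Coord a v y → Coord a v′ y → ∀ i → i < width N a → bitOf v i ≡ bitOf v′ i
  coord-unique a v v′ h h′ i lt = pair-excl (Block.pair-bit a i lt) _ _ (h i lt) (h′ i lt)

  Place : ℕ → ℕ → Dom → Set
  Place j t y = Cell y × Coord space j y × Coord time t y

  successor : ∀ a {y} → Cell y → ¬ ¬ ∃ λ y′ → Cell y′ × r (move a) 0 y y′
  successor a = total⁻ (nameU (sgn true cell) 0) (nameB (move a) 0) (nameU (sgn true cell) 0) (proj₁ (proj₂ (proj₂ (axes a))))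

  right-of : ∀ j t {y y′} → Place j t y → Cell y′ → r (move space) 0 y y′ → ¬ ¬ Place (suc j) t y′
  right-of j t (Cy , hj , ht) Cy′ m = do
    hj′ ← moved space j Cy hj Cy′ m
    ht′ ← kept time t ht Cy′ m
    pure (Cy′ , hj′ , ht′)

  after : ∀ j t {y y′} → Place j t y → Cell y′ → r (move time) 0 y y′ → ¬ ¬ Place j (suc t) y′
  after j t (Cy , hj , ht) Cy′ m = do
    hj′ ← kept space j hj Cy′ m
    ht′ ← moved time t Cy ht Cy′ m
    pure (Cy′ , hj′ , ht′)

  origin : ∃ λ y → u (sgn true inp) (N ^ 1) y × ¬ ¬ Place 0 0 y
  origin = let (G , _ , all) = start-exists ; (Iy , Cy) = all fz in G fz , Iy , do
    hs ← ¬¬-below (width N space) λ i lt → Block.start-bit space i lt Cy Iy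
    ht ← ¬¬-below (width N time) λ i lt → Block.start-bit time i lt Cy Iy
    pure (Cy , hs , ht)

  place-exists : ∀ j t → ¬ ¬ ∃ (Place j t)
  place-exists zero zero = do
    P ← proj₂ (proj₂ origin)
    pure (_ , P)
  place-exists (suc j) t = do
    y , P ← place-exists j t
    y′ , Cy′ , m ← successor space (proj₁ P)
    P′ ← right-of j t P Cy′ m
    pure (y′ , P′)
  place-exists zero (suc t) = do
    y , P ← place-exists zero t
    y′ , Cy′ , m ← successor time (proj₁ P)
    P′ ← after zero t P Cy′ m
    pure (y′ , P′)

  AtGrid : (ℕ → ℕ → Dom) → Set
  AtGrid gr = ∀ j → j < 2 ^ width N space → ∀ t → t < 2 ^ width N time → Place j t (gr j t)

  grid-exists : ¬ ¬ ∃ AtGrid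
  grid-exists = ¬¬-choice (2 ^ width N space) (λ _ → point) λ j _ →
    ¬¬-choice (2 ^ width N time) point λ t _ → place-exists j t

  defaultTile : Fin #tiles
  defaultTile = index finite-Tile
    (mkTile (NTM.start M) ␣ (NTM.start M , ␣ , stay) ␣ ␣ ␣ ␣ ␣ ␣ false false false)

  Labelled : Fin #tiles → Dom → Set
  Labelled s y = u (sgn true til) (toℕ s) y × ∃ λ m → u (item tiles) (toℕ s) m × r label 0 y m

  has-tile : ∀ {y} → Cell y → ¬ ¬ ∃ λ s → Labelled s y
  has-tile Cy = do
    m , Mm , ym ← total⁻ (nameU (sgn true cell) 0) (nameB label 0) (nameU (menu tiles) 0) (proj₁ tiling) Cy
    s , sm ← menu-cover tiles Mm
    Dy ← cell-dom Cy
    t ← force (proj₁ (proj₂ tiling s)) true Dy λ n →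
      ban⁻ (nameU (sgn false til) (toℕ s)) (nameB label 0) (nameU (item tiles) (toℕ s))
        (proj₁ (proj₂ (proj₂ tiling s))) n sm ym
    pure (s , t , m , sm , ym)

  flag-carry : ∀ a v {y y′ s} → Cell y → Coord a v y → r (move a) 0 y y′ → u (sgn true til) (toℕ s) y′ →
    ¬ ¬ (flag a (tileOf s) ≡ carry v (width N a))
  flag-carry a v {s = s} Cy h m ts = do
    c ← carries a v Cy h (width N a) ℕₚ.≤-refl
    pure (force-≡ (flag a (tileOf s)) c λ n → banned a s n ts m)
    where
    banned : ∀ a s {y y′} → u (sgn (not (flag a (tileOf s))) (car a)) (width N a) y →
      u (sgn true til) (toℕ s) y′ → r (move a) 0 y y′ → ⊥
    banned space s = ban⁻ (nameU (sgn (not (flag space (tileOf s))) (car space)) (width N space)) (nameB (move space) 0)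
      (nameU (sgn true til) (toℕ s)) (proj₂ (proj₂ (proj₂ (axes space))) s)
    banned time s = ban⁻ (nameU (sgn (not (flag time (tileOf s))) (car time)) (width N time)) (nameB (move time) 0)
      (nameU (sgn true til) (toℕ s)) (proj₂ (proj₂ (proj₂ (axes time))) s)

  W′ T′ : ℕ
  W′ = topOf space
  T′ = topOf time

  <W : ∀ {j} → j ≤ W′ → j < 2 ^ width N space
  <W {j} le = subst (j <_) (top-eq space) (s≤s le)

  <T : ∀ {t} → t ≤ T′ → t < 2 ^ width N time
  <T {t} le = subst (t <_) (top-eq time) (s≤s le)

  2≤N : 2 ≤ N
  2≤N = s≤s (s≤s z≤n)

  N-eq : N ≡ 2 + length x
  N-eq = length-workspace x

  n≤W′ : length x ≤ W′
  n≤W′ = ℕₚ.≤-trans (ℕₚ.≤-trans (ℕₚ.m≤n+m (length x) 2) (ℕₚ.≤-reflexive (sym N-eq))) (space-exceeds-N 2≤N)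

  module InputIndex {p} (lt : p < length x) where
    idx : ℕ
    idx = N ∸ suc p
    suc-idx : N ∸ p ≡ suc idx
    suc-idx = ℕₚ.+-∸-assoc 1 {N} {suc p} (ℕₚ.<-≤-trans lt
      (ℕₚ.≤-trans (ℕₚ.m≤n+m (length x) 2) (ℕₚ.≤-reflexive (sym N-eq))))
    idx<N : idx < N
    idx<N = ℕₚ.≤-trans (ℕₚ.≤-reflexive (sym suc-idx)) (ℕₚ.m∸n≤m N p)

  module Grid (gr : ℕ → ℕ → Dom) (placed : AtGrid gr) where

    OnGrid : Dom → Set
    OnGrid y = ∃ λ j → ∃ λ t → j < 2 ^ width N space × t < 2 ^ width N time × gr j t ≡ y

    grid-atLeast : AtLeast #cells OnGrid
    grid-atLeast = subst (λ c → AtLeast c OnGrid) (sym #cells-eq) (G , inj , λ i → _ , _ , Finₚ.toℕ<n _ , Finₚ.toℕ<n _ , refl)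
      where
      Wn = 2 ^ width N space
      Tn = 2 ^ width N time
      G : Fin (Wn * Tn) → Dom
      G i = let a , b = Fin.remQuot {Wn} Tn i in gr (toℕ a) (toℕ b)
      inj : Injective _≡_ _≡_ G
      inj {i} {i′} e = trans (sym (Finₚ.combine-remQuot {Wn} Tn i))
        (trans (cong₂ Fin.combine same-a same-b) (Finₚ.combine-remQuot {Wn} Tn i′))
        where
        a = proj₁ (Fin.remQuot {Wn} Tn i)
        b = proj₂ (Fin.remQuot {Wn} Tn i)
        a′ = proj₁ (Fin.remQuot {Wn} Tn i′)
        b′ = proj₂ (Fin.remQuot {Wn} Tn i′)
        P = placed (toℕ a) (Finₚ.toℕ<n a) (toℕ b) (Finₚ.toℕ<n b)
        P′ = subst (Place (toℕ a′) (toℕ b′)) (sym e) (placed (toℕ a′) (Finₚ.toℕ<n a′) (toℕ b′) (Finₚ.toℕ<n b′))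
        same-a : a ≡ a′
        same-a = Finₚ.toℕ-injective (bits-injective (width N space) (Finₚ.toℕ<n a) (Finₚ.toℕ<n a′)
          (coord-unique space (toℕ a) (toℕ a′) (proj₁ (proj₂ P)) (proj₁ (proj₂ P′))))
        same-b : b ≡ b′
        same-b = Finₚ.toℕ-injective (bits-injective (width N time) (Finₚ.toℕ<n b) (Finₚ.toℕ<n b′)
          (coord-unique time (toℕ b) (toℕ b′) (proj₂ (proj₂ P)) (proj₂ (proj₂ P′))))

    -- The grid supplies `#cells` distinct cells and the negative sign of `cell` another `#cells`
    -- elements. As `dom` has at most twice that many, no cell is left over.
    on-grid : ∀ {y} → Cell y → ¬ ¬ OnGrid y
    on-grid {y} Cy = do
      Dy ← cell-dom Cy
      inj₁ (i , e) ← halves pair-cell G G′ inj inj′ (λ i → grid-cell (all i)) (λ i → proj₁ (all′ i)) Dy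
        where inj₂ (i , e) → λ _ → absurd (subst (u (sgn false cell) 0) e (proj₁ (all′ i)))
      pure (subst OnGrid e (all i))
      where
      G = proj₁ grid-atLeast
      inj = proj₁ (proj₂ grid-atLeast)
      all = proj₂ (proj₂ grid-atLeast)
      rest = proj₂ (proj₂ (proj₂ (proj₂ pair-cell)))
      G′ = proj₁ rest
      inj′ = proj₁ (proj₂ rest)
      all′ = proj₂ (proj₂ rest)
      grid-cell : ∀ {y} → OnGrid y → Cell y
      grid-cell (j , t , j< , t< , refl) = proj₁ (placed j j< t t<)
      absurd : u (sgn false cell) 0 y → ⊥
      absurd n with () ← pair-excl pair-cell true false Cy n

    -- Some grid position is y, and its digits leave only one candidate. Agreement of digits is
    -- enough, which covers the wrap, where v is top + 1 and j is 0.
    locate : ∀ {j t} v s {y} → j ≤ W′ → t ≤ T′ → Place v s y →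
      (∀ i → i < width N space → bitOf j i ≡ bitOf v i) → (∀ i → i < width N time → bitOf t i ≡ bitOf s i) →
      ¬ ¬ (gr j t ≡ y)
    locate {j} {t} v s {y} j≤ t≤ (Cy , hv , hs) bj bt = do
      j′ , t′ , j′< , t′< , e ← on-grid Cy
      let _ , hj′ , ht′ = placed j′ j′< t′ t′<
          ej : j ≡ j′
          ej = bits-injective (width N space) (<W j≤) j′< λ i lt →
            trans (bj i lt) (coord-unique space v j′ hv (subst (Coord space j′) e hj′) i lt)
          et : t ≡ t′
          et = bits-injective (width N time) (<T t≤) t′< λ i lt →
            trans (bt i lt) (coord-unique time s t′ hs (subst (Coord time t′) e ht′) i lt)
      pure (trans (cong₂ gr ej et) e)

    -- Whichever successor the model provides, its coordinates are those of the right neighbour, and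
    -- so it is that neighbour.
    hor : ∀ {j t} → j ≤ W′ → t ≤ T′ → ¬ ¬ r (move space) 0 (gr j t) (gr (cyc W′ j) t)
    hor {j} {t} j≤ t≤ = do
      let P = placed j (<W j≤) t (<T t≤)
      y , Cy , m ← successor space (proj₁ P)
      Q ← right-of j t P Cy m
      e ← locate (suc j) t (cyc-≤ j≤) t≤ Q (bits-cyc {width N space} (top-eq space) j≤) (λ _ _ → refl)
      pure (subst (r (move space) 0 (gr j t)) (sym e) m)

    ver : ∀ {j t} → j ≤ W′ → t ≤ T′ → ¬ ¬ r (move time) 0 (gr j t) (gr j (cyc T′ t))
    ver {j} {t} j≤ t≤ = do
      let P = placed j (<W j≤) t (<T t≤)
      y , Cy , m ← successor time (proj₁ P)
      Q ← after j t P Cy m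
      e ← locate j (suc t) j≤ (cyc-≤ t≤) Q (λ _ _ → refl) (bits-cyc {width N time} (top-eq time) t≤)
      pure (subst (r (move time) 0 (gr j t)) (sym e) m)

    -- Induction along row 0: the origin has index N, and each move to the right lowers the index by
    -- one.
    marked : ∀ p → p ≤ length x → ¬ ¬ u (sgn true inp) (N ∸ p) (gr p 0)
    marked zero le = do
      P ← proj₂ (proj₂ origin)
      e ← locate 0 0 z≤n z≤n P (λ _ _ → refl) (λ _ _ → refl)
      pure (subst₂ (u (sgn true inp)) (ℕₚ.^-identityʳ N) (sym e) (proj₁ (proj₂ origin)))
    marked (suc p) lt = do
      h ← marked p (ℕₚ.<⇒≤ lt)
      m ← hor {p} {0} (ℕₚ.≤-trans (ℕₚ.<⇒≤ lt) n≤W′) z≤n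
      let e = cyc-suc (ℕₚ.<-≤-trans lt n≤W′)
          pr , bn , _ = inputs idx _ idx<N (workspace-bit x p lt)
      Dy ← cell-dom (proj₁ (placed (suc p) (<W (ℕₚ.≤-trans lt n≤W′)) 0 (<T z≤n)))
      force pr true Dy λ n → ban⁻ (nameU (sgn true inp) (suc idx)) (nameB (move space) 0) (nameU (sgn false inp) idx) bn
        (subst (λ i → u (sgn true inp) i (gr p 0)) suc-idx h) n
        (subst (λ j → r (move space) 0 (gr p 0) (gr j 0)) e m)
      where open InputIndex lt

    module _ (τ : ℕ → ℕ → Fin #tiles)
             (tiled : ∀ j → j < 2 ^ width N space → ∀ t → t < 2 ^ width N time → Labelled (τ j t) (gr j t))
      where

      tileThere : ∀ {j t} → j ≤ W′ → t ≤ T′ → u (sgn true til) (toℕ (τ j t)) (gr j t)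
      tileThere j≤ t≤ = proj₁ (tiled _ (<W j≤) _ (<T t≤))

      unlabelled : ∀ {i j t} → j ≤ W′ → t ≤ T′ → u (sgn true inp) i (gr j t) →
        𝔄 ⊨ cntNest atMost 0 (nameU (sgn true inp) i) atLeast 1 (nameU (item tiles) (toℕ (τ j t))) (nameB label 0) → ⊥
      unlabelled {i} {j} {t} j≤ t≤ Iy h = let _ , m , sm , ym = tiled _ (<W j≤) _ (<T t≤) in
        ban⁻ (nameU (sgn true inp) i) (nameB label 0) (nameU (item tiles) (toℕ (τ j t))) h Iy sm ym

      tile-flag : ∀ a {v j t j′ t′} → j ≤ W′ → t ≤ T′ → j′ ≤ W′ → t′ ≤ T′ → v ≤ topOf a → Coord a v (gr j t) →
        ¬ ¬ r (move a) 0 (gr j t) (gr j′ t′) → flag a (tileOf (τ j′ t′)) ≡ isZero (cyc (topOf a) v)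
      tile-flag a {v} j≤ t≤ j′≤ t′≤ v≤ h m = trans
        (decidable-stable (_ Boolₚ.≟ _) (m >>= λ m → flag-carry a v (proj₁ (placed _ (<W j≤) _ (<T t≤))) h m (tileThere j′≤ t′≤)))
        (carry-cyc {width N a} (top-eq a) v≤)

      -- All that a tableau asserts about tiles is decidable, so the double negations on moves and
      -- marks disappear here. Only the choice of grid and tiles stays under double negation.
      tableau : Tableau T′ W′ x
      tableau .Tableau.tileAt t j = tileOf (τ j t)
      tableau .Tableau.z-at {t} {j} t≤ j≤ =
        let j₀ , j₀≤ , e = cyc-pred j≤
            next≤ = cyc-≤ j₀≤
        in subst (λ j → z (tileOf (τ j t)) ≡ isZero j) e
             (tile-flag space j₀≤ t≤ next≤ t≤ j₀≤ (proj₁ (proj₂ (placed j₀ (<W j₀≤) t (<T t≤)))) (hor j₀≤ t≤))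
      tableau .Tableau.f-at {t} {j} t≤ j≤ =
        let t₀ , t₀≤ , e = cyc-pred t≤
            next≤ = cyc-≤ t₀≤
        in subst (λ t → f (tileOf (τ j t)) ≡ isZero t) e
             (tile-flag time j≤ t₀≤ j≤ next≤ t₀≤ (proj₂ (proj₂ (placed j (<W j≤) t₀ (<T t₀≤)))) (ver j≤ t₀≤))
      tableau .Tableau.hor-at {t} {j} t≤ j≤ = decidable-stable (hor? a b) λ not-hor → hor j≤ t≤ λ m →
        ban⁻ (nameU (sgn true til) (toℕ s)) (nameB (move space) 0) (nameU (sgn true til) (toℕ s′))
          (proj₁ (proj₂ (proj₂ (proj₂ (proj₂ tiling s))) s′) (cong not (dec-false (hor? a b) not-hor)))
          (tileThere j≤ t≤) (tileThere (cyc-≤ j≤) t≤) m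
        where
        s = τ j t
        s′ = τ (cyc W′ j) t
        a = tileOf s
        b = tileOf s′
      tableau .Tableau.ver-at {t} {j} t≤ j≤ = decidable-stable (ver? a b) λ not-ver → ver j≤ t≤ λ m →
        ban⁻ (nameU (sgn true til) (toℕ s)) (nameB (move time) 0) (nameU (sgn true til) (toℕ s′))
          (proj₂ (proj₂ (proj₂ (proj₂ (proj₂ tiling s))) s′) (cong not (dec-false (ver? a b) not-ver)))
          (tileThere j≤ t≤) (tileThere j≤ (cyc-≤ t≤)) m
        where
        s = τ j t
        s′ = τ j (cyc T′ t)
        a = tileOf s
        b = tileOf s′
      tableau .Tableau.inp-at {p} lt = trans
        (decidable-stable (rp (tileOf s) Finₚ.≟ bitSym b) λ ne → marked p (ℕₚ.<⇒≤ lt) λ h →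
          unlabelled (ℕₚ.≤-trans (ℕₚ.<⇒≤ lt) n≤W′) z≤n (subst (λ i → u (sgn true inp) i (gr p 0)) suc-idx h)
            (proj₂ (proj₂ (inputs idx b idx<N (workspace-bit x p lt))) s (cong not (dec-false (rp (tileOf s) Finₚ.≟ bitSym b) ne))))
        (sym (nth-map bitSym false ␣ x lt))
        where
        s = τ p 0
        b = nth false x p
        open InputIndex lt
      tableau .Tableau.end-at = decidable-stable (d (tileOf s) Boolₚ.≟ true) λ ne → marked (length x) ℕₚ.≤-refl λ h →
        unlabelled n≤W′ z≤n
          (subst (λ i → u (sgn true inp) i (gr (length x) 0)) (trans (cong (_∸ length x) N-eq) (ℕₚ.m+n∸n≡m 2 (length x))) h)
          (proj₁ (proj₂ (proj₂ (proj₂ tiling s))) (cong not (Boolₚ.¬-not ne)))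
        where
        s = τ (length x) 0

  tableau-exists : ¬ ¬ Tableau T′ W′ x
  tableau-exists = do
    gr , placed ← grid-exists
    τ , tiled ← ¬¬-choice (2 ^ width N space) (λ _ → defaultTile) λ j j< →
      ¬¬-choice (2 ^ width N time) defaultTile λ t t< → has-tile (proj₁ (placed j j< t t<))
    pure (Grid.tableau gr placed τ tiled)

-- Decidability of bounded acceptance by exhaustive search

module Acceptance (M : NTM) where
  open NTM M
  open TM nQ g
  open NTMRun M

  Accepting : ℕ → Config → Set
  Accepting t c = Σ Config λ c′ → Reach t c c′ × Config.state c′ ≡ accept

  accepting? : ∀ t c → Dec (Accepting t c)
  accepting? t c with Config.state c Finₚ.≟ accept
  ... | yes e = yes (c , done , e)
  accepting? zero c | no ne = no λ { (c′ , done , e) → ne e }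
  accepting? (suc t) c | no ne
    with Any.any? (λ a → accepting? t (apply c a)) (δ (Config.state c) (Config.hd c))
  ... | yes some = let a , a∈ , (c′ , R , e) = find some in yes (c′ , more (step a∈) R , e)
  ... | no none  = no λ { (c′ , done , e) → ne e ; (c′ , more (step a∈) R , e) → none (lose a∈ (c′ , R , e)) }

satisfiable⇒accepts : ∀ M k x → Satisfiable (Reduction.reduction M k x) →
  NTMRun.AcceptsWithin M (2 ^ ((2 + length x) ^ k)) x
satisfiable⇒accepts M k x (𝔄 , h) =
  subst (λ T → NTMRun.AcceptsWithin M T x) (trans (top-eq time) (cong (λ N → 2 ^ (N ^ k)) N-eq))
    (decidable-stable (Acceptance.accepting? M _ _) λ no → tableau-exists λ tab →
      no (Tiles.FromTableau.accepts M tab (space-exceeds-time 2≤N) n≤W′))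
  where
  open Extract M k x 𝔄 (Reduction.reduction⁻ M k 𝔄 x h)
  open Counts M k (length (workspace x))

-- From tableaux to models

atMost-injection : ∀ {D : Set} (P : D → Set) n (h : ∀ e → P e → Fin n) →
  (∀ {e e′} p p′ → h e p ≡ h e′ p′ → e ≡ e′) → AtMost n P
atMost-injection P n h h-inj (G , G-inj , all) =
  let i , j , i<j , e = Finₚ.pigeonhole ℕₚ.≤-refl (λ i → h (G i) (all i)) in
  Finₚ.<⇒≢ i<j (G-inj (h-inj (all i) (all j) e))

module Model (M : NTM) (k : ℕ) (x : List Bool) where
  open Tiles M
  open Reduction M k
  open NTM M using (nQ; g)
  open TM nQ g using (bitSym) renaming (blank to ␣)

  N : ℕ
  N = length (workspace x)

  open Counts M k N

  module _ (tab : Tableau (topOf time) (topOf space) x) where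
    open Tableau tab

    Wn Tn : ℕ
    Wn = 2 ^ width N space
    Tn = 2 ^ width N time

    -- place j t true is a cell of the grid, and place j t false its dummy: on
    -- the dummy every pair predicate takes the opposite value, so that each
    -- holds of exactly half of the places.
    data Element : Set where
      place : Fin Wn → Fin Tn → Bool → Element
      option : (m : Menu) → Fin (menuSize m) → Element

    coord : Axis → ℕ → ℕ → ℕ
    coord space j t = j
    coord time  j t = t

    val : PairKind → ℕ → ℕ → ℕ → Bool
    val cell    i j t = true
    val inp     i j t = isZero t ∧ does (j + i ℕₚ.≟ N)
    val til     i j t = does (toℕ (index finite-Tile (tileAt t j)) ℕₚ.≟ i)
    val (bit a) i j t = bitOf (coord a j t) i
    val (car a) i j t = carry (coord a j t) i
    val (sum a) i j t = bitOf (suc (coord a j t)) i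

    U′ : UKind → ℕ → Element → Set
    U′ dom       i (place j t c) = ⊤
    U′ (menu m)  i (option m′ s)  = m ≡ m′
    U′ (item m)  i (option m′ s)  = m ≡ m′ × i ≡ toℕ s
    U′ (sgn b π) i (place j t c) = val π i (toℕ j) (toℕ t) ≡ (if c then b else not b)
    U′ _         _ _             = ⊥

    Moves : Axis → ℕ → ℕ → ℕ → ℕ → Set
    Moves space j t j′ t′ = j′ ≡ cyc (topOf space) j × t′ ≡ t
    Moves time  j t j′ t′ = j′ ≡ j × t′ ≡ cyc (topOf time) t

    B′ : BKind → ℕ → Element → Element → Set
    B′ (move a) i (place j t true) (place j′ t′ true) = Moves a (toℕ j) (toℕ t) (toℕ j′) (toℕ t′)
    B′ (add a)  i (place j t true) (option adder s) =
      elem finite-Row s ≡ (val (bit a) i (toℕ j) (toℕ t) , val (car a) i (toℕ j) (toℕ t))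
    B′ label    i (place j t true) (option tiles s) = s ≡ index finite-Tile (tileAt (toℕ t) (toℕ j))
    B′ _        _ _                _               = ⊥

    0<Wn : 0 < Wn
    0<Wn = ℕₚ.m^n>0 2 (width N space)

    0<Tn : 0 < Tn
    0<Tn = ℕₚ.m^n>0 2 (width N time)

    zeroW : Fin Wn
    zeroW = Fin.fromℕ< 0<Wn

    zeroT : Fin Tn
    zeroT = Fin.fromℕ< 0<Tn

    𝔐 : Structure
    𝔐 .Structure.Dom   = Element
    𝔐 .Structure.point = place zeroW zeroT true
    -- A symbol is interpreted through the kind and index that it names. Injectivity of names makes
    -- this unambiguous, and a number that names nothing gets the empty predicate.
    𝔐 .Structure.U n e = ∃ λ κ → ∃ λ i → n ≡ nameU κ i × U′ κ i e
    𝔐 .Structure.B n e e′ = ∃ λ κ → ∃ λ i → n ≡ nameB κ i × B′ κ i e e′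

    open Structure 𝔐 using (U; B)
    open Semantics 𝔐
    open Meaning 𝔐

    U⁻ : ∀ {κ i e} → U (nameU κ i) e → U′ κ i e
    U⁻ (κ′ , i′ , eq , h) with nameU-injective eq
    ... | refl , refl = h

    B⁻ : ∀ {κ i e e′} → B (nameB κ i) e e′ → B′ κ i e e′
    B⁻ (κ′ , i′ , eq , h) with nameB-injective eq
    ... | refl , refl = h

    U⁺ : ∀ {κ i e} → U′ κ i e → U (nameU κ i) e
    U⁺ h = _ , _ , refl , h

    B⁺ : ∀ {κ i e e′} → B′ κ i e e′ → B (nameB κ i) e e′
    B⁺ h = _ , _ , refl , h

    sub′ : ∀ κ i κ′ i′ → (∀ e → U′ κ i e → U′ κ′ i′ e) → 𝔐 ⊨ cntNeg atMost 0 (nameU κ i) (nameU κ′ i′)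
    sub′ κ i κ′ i′ h = sub⁺ (nameU κ i) (nameU κ′ i′) λ e p → U⁺ (h e (U⁻ p))

    dis′ : ∀ κ i κ′ i′ → (∀ e → U′ κ i e → U′ κ′ i′ e → ⊥) → 𝔐 ⊨ cntPos atMost 0 (nameU κ i) (nameU κ′ i′)
    dis′ κ i κ′ i′ h = dis⁺ (nameU κ i) (nameU κ′ i′) λ e p q → h e (U⁻ p) (U⁻ q)

    total′ : ∀ κ i ρ l κ′ i′ → (∀ e → U′ κ i e → ∃ λ e′ → U′ κ′ i′ e′ × B′ ρ l e e′) →
      𝔐 ⊨ cntNest atMost 0 (nameU κ i) atMost 0 (nameU κ′ i′) (nameB ρ l)
    total′ κ i ρ l κ′ i′ h = total⁺ (nameU κ i) (nameB ρ l) (nameU κ′ i′) λ e p →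
      let e′ , q , b = h e (U⁻ p) in e′ , U⁺ q , B⁺ b

    ban′ : ∀ κ i ρ l κ′ i′ → (∀ e e′ → U′ κ i e → U′ κ′ i′ e′ → B′ ρ l e e′ → ⊥) →
      𝔐 ⊨ cntNest atMost 0 (nameU κ i) atLeast 1 (nameU κ′ i′) (nameB ρ l)
    ban′ κ i ρ l κ′ i′ h = ban⁺ (nameU κ i) (nameB ρ l) (nameU κ′ i′) λ e e′ p q b → h e e′ (U⁻ p) (U⁻ q) (B⁻ b)

    same : Bool → Bool → Bool
    same b v = not (b xor v)

    same-spec : ∀ b v → v ≡ (if same b v then b else not b)
    same-spec false false = refl
    same-spec false true  = refl
    same-spec true  false = refl
    same-spec true  true  = refl

    opposite : ∀ {v} c → v ≡ (if c then true else false) → v ≡ (if c then false else true) → ⊥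
    opposite true  refl ()
    opposite false refl ()

    false≢true : false ≢ true
    false≢true ()

    b≢not-b : ∀ b → b ≢ not b
    b≢not-b true  ()
    b≢not-b false ()

    -- Over each grid position exactly one of the cell and its dummy carries the sign b, and `same`
    -- selects it. This gives one element per position, whatever the values are.
    pair-has : ∀ b π i → AtLeast #cells (λ e → U (nameU (sgn b π) i) e × U (nameU (sgn b π) i) e)
    pair-has b π i = subst (λ c → AtLeast c (λ e → U (nameU (sgn b π) i) e × U (nameU (sgn b π) i) e)) (sym #cells-eq)
      (G , G-inj , λ e → let h = in-sgn e in U⁺ h , U⁺ h)
      where
      col : Fin (Wn * Tn) → Fin Wn
      col e = proj₁ (Fin.remQuot {Wn} Tn e)
      row : Fin (Wn * Tn) → Fin Tn
      row e = proj₂ (Fin.remQuot {Wn} Tn e)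
      v : Fin (Wn * Tn) → Bool
      v e = val π i (toℕ (col e)) (toℕ (row e))
      G : Fin (Wn * Tn) → Element
      G e = place (col e) (row e) (same b (v e))
      in-sgn : ∀ e → U′ (sgn b π) i (G e)
      in-sgn e = same-spec b (v e)
      coords : Element → Fin (Wn * Tn) → Fin (Wn * Tn)
      coords (place j t _) _ = Fin.combine j t
      coords (option _ _)   e = e
      G-inj : Injective _≡_ _≡_ G
      G-inj {e} {e′} eq = trans (sym (Finₚ.combine-remQuot {Wn} Tn e))
        (trans (cong (λ z → coords z e) eq) (Finₚ.combine-remQuot {Wn} Tn e′))

    pairs : ∀ π i → Holds N 0 (pair π (abs i))
    pairs π i =
      sub′ (sgn true π) i dom 0 (λ { (place _ _ _) _ → tt }) ,
      sub′ (sgn false π) i dom 0 (λ { (place _ _ _) _ → tt }) ,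
      dis′ (sgn true π) i (sgn false π) i (λ { (place _ _ c) p q → opposite c p q }) ,
      pair-has true π i , pair-has false π i

    finite-place : Finite ((Fin Wn × Fin Tn) × Bool)
    finite-place = finite-× (finite-× (finite-Fin Wn) (finite-Fin Tn)) finite-Bool

    dom-most : AtMost (evalSubscript N 0 doubled#) (λ e → U (nameU dom 0) e × U (nameU dom 0) e)
    dom-most = subst (λ c → AtMost c (λ e → U (nameU dom 0) e × U (nameU dom 0) e)) size-eq
      (atMost-injection (λ e → U (nameU dom 0) e × U (nameU dom 0) e) (size finite-place) (λ e p → h e (U⁻ (proj₁ p))) λ p p′ → h-inj (U⁻ (proj₁ p)) (U⁻ (proj₁ p′)))
      where
      size-eq : size finite-place ≡ evalSubscript N 0 doubled#
      size-eq = trans (arith (Wn * Tn)) (trans (cong₂ _+_ (sym #cells-eq) (sym #cells-eq)) (sym doubled-eq))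
        where
        arith : ∀ c → c * 2 ≡ c + c
        arith = solve-∀
      h : ∀ e → U′ dom 0 e → Fin (size finite-place)
      h (place j t c) _ = index finite-place ((j , t) , c)
      h-inj : ∀ {e e′} (p : U′ dom 0 e) (p′ : U′ dom 0 e′) → h e p ≡ h e′ p′ → e ≡ e′
      h-inj {place j t c} {place j′ t′ c′} _ _ eq with index-injective finite-place eq
      ... | refl = refl

    menuOK : ∀ m → Holds N 0 (menuTree m)
    menuOK m = atMost-injection (λ e → U (nameU (menu m) 0) e × U (nameU (menu m) 0) e) (menuSize m)
        (λ e p → h e (U⁻ (proj₁ p))) (λ p p′ → h-inj (U⁻ (proj₁ p)) (U⁻ (proj₁ p′))) ,
      λ j → sub′ (item m) (toℕ j) (menu m) 0 (λ { (option _ _) p → proj₁ p }) ,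
        atLeast-one (λ e → U (nameU (item m) (toℕ j)) e × U (nameU (item m) (toℕ j)) e)
          {option m j} (U⁺ (refl , refl) , U⁺ (refl , refl)) ,
        λ i ne → dis′ (item m) (toℕ i) (item m) (toℕ j) λ { (option _ s) (refl , p) (_ , q) → apart i j ne (trans p (sym q)) }
      where
      h : ∀ e → U′ (menu m) 0 e → Fin (menuSize m)
      h (option _ s) refl = s
      h-inj : ∀ {e e′} (p : U′ (menu m) 0 e) (p′ : U′ (menu m) 0 e′) → h e p ≡ h e′ p′ → e ≡ e′
      h-inj {option _ s} {option _ s′} refl refl refl = refl
      apart : ∀ i j → not (does (i Finₚ.≟ j)) ≡ true → toℕ i ≢ toℕ j
      apart i j ne e with () ← trans (sym ne) (cong not (dec-true (i Finₚ.≟ j) (Finₚ.toℕ-injective e)))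

    ≤top : ∀ a {v} → v < 2 ^ width N a → v ≤ topOf a
    ≤top a {v} lt = ℕₚ.≤-pred (subst (v <_) (sym (top-eq a)) lt)

    j≤ : (j : Fin Wn) → toℕ j ≤ topOf space
    j≤ j = ≤top space (Finₚ.toℕ<n j)

    t≤ : (t : Fin Tn) → toℕ t ≤ topOf time
    t≤ t = ≤top time (Finₚ.toℕ<n t)

    next< : ∀ a {v} → v < 2 ^ width N a → cyc (topOf a) v < 2 ^ width N a
    next< a {v} lt = subst (cyc (topOf a) v <_) (top-eq a) (s≤s (cyc-≤ (≤top a lt)))

    moves-total : ∀ a e → U′ (sgn true cell) 0 e → ∃ λ e′ → U′ (sgn true cell) 0 e′ × B′ (move a) 0 e e′
    moves-total space (place j t true) _ =
      place (Fin.fromℕ< (next< space (Finₚ.toℕ<n j))) t true , refl , Finₚ.toℕ-fromℕ< (next< space (Finₚ.toℕ<n j)) , refl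
    moves-total time (place j t true) _ =
      place j (Fin.fromℕ< (next< time (Finₚ.toℕ<n t))) true , refl , refl , Finₚ.toℕ-fromℕ< (next< time (Finₚ.toℕ<n t))

    til-tile : ∀ s j t → val til (toℕ s) j t ≡ true → tileOf s ≡ tileAt t j
    til-tile s j t e with toℕ (index finite-Tile (tileAt t j)) ℕₚ.≟ toℕ s
    ... | yes eq = trans (cong tileOf (sym (Finₚ.toℕ-injective eq))) (elem-index finite-Tile (tileAt t j))
    ... | no ne with () ← trans (sym e) (dec-false (toℕ (index finite-Tile (tileAt t j)) ℕₚ.≟ toℕ s) ne)

    contra : ∀ {v} b b′ → v ≡ not b → v ≡ b′ → b′ ≡ b → ⊥
    contra b _ p refl refl = b≢not-b b p

    -- The flag of the reached tile and the overflow of the increment are both `isZero` of the new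
    -- coordinate.
    flagOK : ∀ a s e e′ → U′ (sgn (not (flag a (tileOf s))) (car a)) (width N a) e →
      U′ (sgn true til) (toℕ s) e′ → B′ (move a) 0 e e′ → ⊥
    flagOK space s (place j t true) (place j′ t′ true) p q (ej , et) = contra (z (tileOf s)) (isZero (toℕ j′)) p
      (trans (carry-cyc {width N space} (top-eq space) (j≤ j)) (cong isZero (sym ej)))
      (sym (trans (cong z (til-tile s (toℕ j′) (toℕ t′) q)) (z-at (t≤ t′) (j≤ j′))))
    flagOK time s (place j t true) (place j′ t′ true) p q (ej , et) = contra (f (tileOf s)) (isZero (toℕ t′)) p
      (trans (carry-cyc {width N time} (top-eq time) (t≤ t)) (cong isZero (sym et)))
      (sym (trans (cong f (til-tile s (toℕ j′) (toℕ t′) q)) (f-at (t≤ t′) (j≤ j′))))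

    axisOK : ∀ a → Holds N 0 (axisTree a)
    axisOK a = pairs (car a) 0 ,
      sub′ (sgn true cell) 0 (sgn true (car a)) 0 (λ { (place _ _ true) _ → refl }) ,
      total′ (sgn true cell) 0 (move a) 0 (sgn true cell) 0 (moves-total a) ,
      λ s → flags a s
      where
      flags : ∀ a s → Holds N 0 (ban (sgn (not (flag a (tileOf s))) (car a) at topIx a) (move a atᵇ abs 0) (sgn true til at abs (toℕ s)))
      flags space s = ban′ (sgn (not (flag space (tileOf s))) (car space)) (width N space) (move space) 0 (sgn true til) (toℕ s) (flagOK space s)
      flags time s = ban′ (sgn (not (flag time (tileOf s))) (car time)) (width N time) (move time) 0 (sgn true til) (toℕ s) (flagOK time s)

    ∧-true : ∀ a {b} → a ∧ b ≡ true → a ≡ true × b ≡ true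
    ∧-true true e = refl , e

    inp-place : ∀ i j t → val inp i j t ≡ true → t ≡ 0 × j + i ≡ N
    inp-place i j t e with ∧-true (isZero t) e
    ... | e₁ , e₂ with j + i ℕₚ.≟ N
    ...   | yes eq = zero-of t e₁ , eq
      where
      zero-of : ∀ t → isZero t ≡ true → t ≡ 0
      zero-of zero _ = refl
    ...   | no ne with () ← trans (sym e₂) (dec-false (j + i ℕₚ.≟ N) ne)

    place-inp : ∀ i j → j + i ≡ N → val inp i j 0 ≡ true
    place-inp i j e = dec-true (j + i ℕₚ.≟ N) e

    labelled-tile : ∀ s s′ (j : Fin Wn) (t : Fin Tn) → toℕ s ≡ toℕ s′ → s′ ≡ index finite-Tile (tileAt (toℕ t) (toℕ j)) →
      tileOf s ≡ tileAt (toℕ t) (toℕ j)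
    labelled-tile s s′ j t e refl =
      trans (cong tileOf (Finₚ.toℕ-injective e)) (elem-index finite-Tile (tileAt (toℕ t) (toℕ j)))

    tileOK : (∀ s → d (tileOf s) ≡ false → ∀ j → j + 2 ≡ N → tileOf s ≢ tileAt 0 j) → Holds N 0 tileTree
    tileOK end =
      total′ (sgn true cell) 0 label 0 (menu tiles) 0 (λ { (place j t true) _ →
        option tiles (index finite-Tile (tileAt (toℕ t) (toℕ j))) , refl , refl }) ,
      λ s → pairs til (toℕ s) ,
        ban′ (sgn false til) (toℕ s) label 0 (item tiles) (toℕ s)
          (λ { (place j t true) (option tiles s′) p (_ , e) l → unlabelled s j t p (trans (Finₚ.toℕ-injective e) l) }) ,
        (λ nd → ban′ (sgn true inp) 2 label 0 (item tiles) (toℕ s)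
          (λ { (place j t true) (option tiles s′) p (_ , e) l → end-ban s nd j t p (labelled-tile s s′ j t e l) })) ,
        λ s′ →
          (λ nh → ban′ (sgn true til) (toℕ s) (move space) 0 (sgn true til) (toℕ s′)
            λ { (place j t true) (place j′ t′ true) p q (ej , et) → no-hor s s′ nh
                  (subst₂ Hor (sym (til-tile s _ _ p)) (sym (til-tile s′ _ _ q))
                    (subst₂ (λ j″ t″ → Hor (tileAt (toℕ t) (toℕ j)) (tileAt t″ j″)) (sym ej) (sym et) (hor-at (t≤ t) (j≤ j)))) }) ,
          (λ nv → ban′ (sgn true til) (toℕ s) (move time) 0 (sgn true til) (toℕ s′)
            λ { (place j t true) (place j′ t′ true) p q (ej , et) → no-ver s s′ nv
                  (subst₂ Ver (sym (til-tile s _ _ p)) (sym (til-tile s′ _ _ q))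
                    (subst₂ (λ j″ t″ → Ver (tileAt (toℕ t) (toℕ j)) (tileAt t″ j″)) (sym ej) (sym et) (ver-at (t≤ t) (j≤ j)))) })
      where
      unlabelled : ∀ s j t → val til (toℕ s) (toℕ j) (toℕ t) ≡ false →
        s ≡ index finite-Tile (tileAt (toℕ t) (toℕ j)) → ⊥
      unlabelled s j t e refl
        with () ← trans (sym e) (dec-true (toℕ (index finite-Tile (tileAt (toℕ t) (toℕ j))) ℕₚ.≟ toℕ s) refl)
      end-ban : ∀ s → not (d (tileOf s)) ≡ true → ∀ (j : Fin Wn) (t : Fin Tn) → val inp 2 (toℕ j) (toℕ t) ≡ true →
        tileOf s ≡ tileAt (toℕ t) (toℕ j) → ⊥
      end-ban s nd j t p l = let t≡0 , e = inp-place 2 (toℕ j) (toℕ t) p in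
        end s (Boolₚ.not-injective nd) (toℕ j) e (trans l (cong (λ t → tileAt t (toℕ j)) t≡0))
      no-hor : ∀ s s′ → not (does (hor? (tileOf s) (tileOf s′))) ≡ true → ¬ Hor (tileOf s) (tileOf s′)
      no-hor s s′ n h with () ← trans (sym n) (cong not (dec-true (hor? (tileOf s) (tileOf s′)) h))
      no-ver : ∀ s s′ → not (does (ver? (tileOf s) (tileOf s′))) ≡ true → ¬ Ver (tileOf s) (tileOf s′)
      no-ver s s′ n h with () ← trans (sym n) (cong not (dec-true (ver? (tileOf s) (tileOf s′)) h))

    N-eq : N ≡ 2 + length x
    N-eq = length-workspace x

    fixedOK : Holds N 0 fixedTree
    fixedOK = dom-most , pairs cell 0 , menuOK tiles , menuOK adder , axisOK space , axisOK time ,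
      tileOK end-tile , pairs inp (N ^ 1) ,
      atLeast-one (λ e → U (nameU (sgn true inp) (N ^ 1)) e × U (nameU (sgn true cell) 0) e)
        {place zeroW zeroT true} (U⁺ start-marked , U⁺ refl)
      where
      j≡n : ∀ j → j + 2 ≡ N → j ≡ length x
      j≡n j e = ℕₚ.+-cancelʳ-≡ 2 j (length x) (trans e (trans N-eq (ℕₚ.+-comm 2 (length x))))
      end-tile : ∀ s → d (tileOf s) ≡ false → ∀ j → j + 2 ≡ N → tileOf s ≢ tileAt 0 j
      end-tile s nd j e eq
        with () ← trans (sym nd) (trans (cong d eq) (subst (λ j → d (tileAt 0 j) ≡ true) (sym (j≡n j e)) end-at))
      start-marked : val inp (N ^ 1) (toℕ zeroW) (toℕ zeroT) ≡ true
      start-marked = trans (cong₂ (val inp (N ^ 1)) (Finₚ.toℕ-fromℕ< 0<Wn) (Finₚ.toℕ-fromℕ< 0<Tn))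
        (place-inp (N ^ 1) 0 (ℕₚ.^-identityʳ N))

    coord-moves : ∀ a {j t j′ t′} → Moves a j t j′ t′ → coord a j′ t′ ≡ cyc (topOf a) (coord a j t)
    coord-moves space (e , _) = e
    coord-moves time  (_ , e) = e

    coord-kept : ∀ a {j t j′ t′} → Moves (other a) j t j′ t′ → coord a j′ t′ ≡ coord a j t
    coord-kept space (e , _) = e
    coord-kept time  (_ , e) = e

    coord≤ : ∀ a (j : Fin Wn) (t : Fin Tn) → coord a (toℕ j) (toℕ t) ≤ topOf a
    coord≤ space j t = j≤ j
    coord≤ time  j t = t≤ t

    module _ (a : Axis) (i : ℕ) (lt : i < width N a) where

      row-at : ∀ {j s : Fin (menuSize adder)} {bc} → toℕ j ≡ toℕ s → elem finite-Row s ≡ bc → elem finite-Row j ≡ bc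
      row-at e h = trans (cong (elem finite-Row) (Finₚ.toℕ-injective e)) h

      row-ban : ∀ j π i′ (b : Bool × Bool → Bool) →
        (∀ p q → val π i′ p q ≡ b (val (bit a) i p q , val (car a) i p q)) →
        Holds N 0 (ban (sgn (not (b (elem finite-Row j))) π at abs i′) (add a atᵇ abs i) (item adder at abs (toℕ j)))
      row-ban j π i′ b spec = ban′ (sgn (not (b (elem finite-Row j))) π) i′ (add a) i (item adder) (toℕ j)
        λ { (place p q true) (option adder s) h (_ , e) r →
              contra (b (elem finite-Row j)) _ h (spec (toℕ p) (toℕ q)) (cong b (sym (row-at e r))) }

      step-ban : ∀ b → Holds N i (ban (sgn b (sum a) at cur 0) (move a atᵇ abs 0) (sgn (not b) (bit a) at cur 0))
      step-ban b = ban′ (sgn b (sum a)) i (move a) 0 (sgn (not b) (bit a)) i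
        λ { (place j t true) (place j′ t′ true) p q m → contra b _ q
              (trans (cong (λ v → bitOf v i) (coord-moves a m)) (bits-cyc {width N a} (top-eq a) (coord≤ a j t) i lt)) p }

      keep-ban : ∀ b → Holds N i (ban (sgn b (bit a) at cur 0) (move (other a) atᵇ abs 0) (sgn (not b) (bit a) at cur 0))
      keep-ban b = ban′ (sgn b (bit a)) i (move (other a)) 0 (sgn (not b) (bit a)) i
        λ { (place j t true) (place j′ t′ true) p q m → contra b _ q (cong (λ v → bitOf v i) (coord-kept a m)) p }

      coord-zero : ∀ a {j t} → j ≡ 0 → t ≡ 0 → coord a j t ≡ 0
      coord-zero space e _ = e
      coord-zero time  _ e = e

      start-ban : ∀ j → proj₁ (elem finite-Row j) ≡ true →
        Holds N i (ban (sgn true inp at pow 1 0) (add a atᵇ cur 0) (item adder at abs (toℕ j)))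
      start-ban j b = ban′ (sgn true inp) (N ^ 1) (add a) i (item adder) (toℕ j)
        λ { (place p q true) (option adder s) h (_ , e) r →
              let q≡0 , p+N = inp-place (N ^ 1) (toℕ p) (toℕ q) h
                  p≡0 = ℕₚ.+-cancelʳ-≡ (N ^ 1) (toℕ p) 0 (trans p+N (sym (ℕₚ.^-identityʳ N)))
              in false≢true (sym (trans (sym b) (trans (cong proj₁ (row-at e r)) (cong (λ v → bitOf v i) (coord-zero a p≡0 q≡0))))) }

      blockOK : Holds N i (block a cur)
      blockOK = pairs (bit a) i , pairs (sum a) i , pairs (car a) (suc i) ,
        total′ (sgn true cell) 0 (add a) i (menu adder) 0 (λ { (place j t true) _ →
          option adder (index finite-Row (bitOf (coord a (toℕ j) (toℕ t)) i , carry (coord a (toℕ j) (toℕ t)) i)) , refl ,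
            elem-index finite-Row (bitOf (coord a (toℕ j) (toℕ t)) i , carry (coord a (toℕ j) (toℕ t)) i) }) ,
        (λ j → row-ban j (bit a) i proj₁ (λ _ _ → refl) , row-ban j (car a) i proj₂ (λ _ _ → refl) ,
               row-ban j (sum a) i (λ bc → proj₁ bc xor proj₂ bc) (λ _ _ → refl) ,
               row-ban j (car a) (suc i) (λ bc → proj₁ bc ∧ proj₂ bc) (λ _ _ → refl)) ,
        step-ban true , step-ban false , keep-ban true , keep-ban false , start-ban

    inputOK : ∀ j b → j < N → nth pad (workspace x) j ≡ ty b → Holds N j (inputTree b)
    inputOK j b j<N e = pairs inp j ,
      ban′ (sgn true inp) (suc j) (move space) 0 (sgn false inp) j
        (λ { (place p t true) (place p′ t′ true) h n (ep , et) → advance p t p′ t′ h n ep et }) ,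
      λ s ne → ban′ (sgn true inp) (suc j) label 0 (item tiles) (toℕ s)
        λ { (place p t true) (option tiles s′) h (_ , e′) l → wrong s ne p t h (labelled-tile s s′ p t e′ l) }
      where
      -- The two pads hold no bit, so j ≥ 2, and the marked column N - 1 - j lies inside the input.
      beyond-pads : ∀ j → nth pad (workspace x) j ≡ ty b → 2 ≤ j
      beyond-pads (suc (suc j)) e = s≤s (s≤s z≤n)
      position : ∀ p → p + suc j ≡ N → p < length x
      position p eq = ℕₚ.≤-trans (ℕₚ.≤-reflexive (sym (ℕₚ.m+n∸n≡m (suc p) 2)))
        (ℕₚ.≤-trans (ℕₚ.∸-monoˡ-≤ 2 le) (ℕₚ.≤-reflexive (ℕₚ.m+n∸m≡n 2 (length x))))
        where
        le : suc p + 2 ≤ 2 + length x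
        le = ℕₚ.≤-trans (ℕₚ.+-monoʳ-≤ (suc p) (beyond-pads j e))
          (ℕₚ.≤-reflexive (trans (sym (ℕₚ.+-suc p j)) (trans eq N-eq)))
      small : ∀ p → p + suc j ≡ N → p < topOf space
      small p eq = ℕₚ.<-≤-trans (subst (p <_) eq (ℕₚ.m<m+n p (s≤s z≤n))) (space-exceeds-N (s≤s (s≤s z≤n)))
      advance : ∀ (p : Fin Wn) (t : Fin Tn) (p′ : Fin Wn) (t′ : Fin Tn) → val inp (suc j) (toℕ p) (toℕ t) ≡ true →
        val inp j (toℕ p′) (toℕ t′) ≡ false → toℕ p′ ≡ cyc (topOf space) (toℕ p) → toℕ t′ ≡ toℕ t → ⊥
      advance p t p′ t′ h n ep et = let t≡0 , eq = inp-place (suc j) (toℕ p) (toℕ t) h in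
        false≢true (trans (sym n) (trans
          (cong₂ (val inp j) (trans ep (cyc-suc (small (toℕ p) eq))) (trans et t≡0))
          (place-inp j (suc (toℕ p)) (trans (sym (ℕₚ.+-suc (toℕ p) j)) eq))))
      bit-there : ∀ p → p + suc j ≡ N → b ≡ nth false x p
      bit-there p eq = ty-injective (trans (sym e) (trans (cong (nth pad (workspace x)) j≡) (workspace-bit x p (position p eq))))
        where
        j≡ : j ≡ N ∸ suc p
        j≡ = sym (trans (cong (_∸ suc p) (trans (sym eq) (ℕₚ.+-suc p j))) (ℕₚ.m+n∸m≡n (suc p) j))
        ty-injective : ∀ {b b′} → ty b ≡ ty b′ → b ≡ b′
        ty-injective refl = refl
      wrong : ∀ s → not (does (rp (tileOf s) Finₚ.≟ bitSym b)) ≡ true → ∀ (p : Fin Wn) (t : Fin Tn) →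
        val inp (suc j) (toℕ p) (toℕ t) ≡ true → tileOf s ≡ tileAt (toℕ t) (toℕ p) → ⊥
      wrong s ne p t h l = let t≡0 , eq = inp-place (suc j) (toℕ p) (toℕ t) h in
        false≢true (trans (sym (cong not (dec-true (rp (tileOf s) Finₚ.≟ bitSym b)
          (trans (cong rp (trans l (cong (λ t → tileAt t (toℕ p)) t≡0)))
            (trans (inp-at (position (toℕ p) eq)) (trans (nth-map bitSym false ␣ x (position (toℕ p) eq))
              (cong bitSym (sym (bit-there (toℕ p) eq))))))))) ne)

    model : Satisfiable (reduction x)
    model = 𝔐 , reduction⁺ 𝔐 x (record { fixed = fixedOK ; blocks = blockOK ; inputs = inputOK })

accepts⇒satisfiable : ∀ M k x → NTMRun.AcceptsWithin M (2 ^ ((2 + length x) ^ k)) x →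
  Satisfiable (Reduction.reduction M k x)
accepts⇒satisfiable M k x acc =
  let c , R , e = subst (λ T → NTMRun.AcceptsWithin M T x)
        (sym (trans (top-eq time) (cong (λ N → 2 ^ (N ^ k)) (length-workspace x)))) acc
  in Model.model M k x (Tiles.ToTableau.tableau M R e)
  where open Counts M k (length (workspace x))

theorem11 : ∀ (L : List Bool → Set) → InNEXPTIME L →
    Σ (List Bool → List N2) λ f →
    PolyTimeComputable (λ x → encSet (f x)) × (∀ x → L x ⇔ Satisfiable (f x))
theorem11 L (M , k , decides) = reduction , reduction-poly-time , λ x →
  mk⇔ (λ Lx → accepts⇒satisfiable M k x (Equivalence.to (decides x) Lx))
      (λ sat → Equivalence.from (decides x) (satisfiable⇒accepts M k x sat))
  where open Reduction M k
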